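{- For each $z\in\mathbb Z[\tau]$ there is a unique $w$-NAF $\xi\in\mathcal N^{\mathrm{fin}.0}$ with $\mathrm{value}(\xi)=z$; thus $\mathcal D$ is a width-$w$ non-adjacent digit set. Moreover, the following algorithm terminates for every input $z\in\mathbb Z[\tau]$ and outputs this $w$-NAF: set $\ell\leftarrow0$, $y\leftarrow z$; while $y\ne0$: if $\tau\mid y$ set $\xi_\ell\leftarrow0$, otherwise let $\xi_\ell$ be the element of $\mathcal D$ with $\xi_\ell\equiv y\pmod{\tau^w}$; then set $y\leftarrow(y-\xi_\ell)/\tau$ and $\ell\leftarrow\ell+1$; finally output $\xi_{\ell-1}\dots\xi_1\xi_0$.
   Context: Let $p,q\in\mathbb Z$ with $4q-p^2>0$ and let $\tau$ be a root of $X^2-pX+q$, with $|\tau|>1$; let $w\ge2$ be an integer. Voronoi cell $V=\{z\in\mathbb C:|z|\le|z-y|\ \forall y\in\mathbb Z[\tau]\}$ (a convex polygon). Label its vertices counter-clockwise $v_0,\dots,v_{m-1}$ starting with the vertex of real part $1/2$ and positive imaginary part, indices mod $m$, $v_{k+1/2}$ the midpoint of $v_kv_{k+1}$. The restricted Voronoi cell $\widetilde V$ consists of the interior of $V$, the segments from $v_{k+1/2}$ (excluded) to $v_{k+1}$ (excluded) for all $k$, the points $v_{k+1/2}$ for $0\le k\le\lfloor m/2\rfloor-1$ and the points $v_k$ for $1\le k\le\lfloor m/3\rfloor$; the translates $u+\widetilde V$, $u\in\mathbb Z[\tau]$, partition $\mathbb C$. Digit set $\mathcal D$: $0$ together with,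 for each residue class modulo $\tau^w$ not divisible by $\tau$, its unique element in $\tau^w\widetilde V$. A $w$-NAF is a sequence $(\xi_j)_{j\in\mathbb Z}\in\mathcal D^{\mathbb Z}$ in which each block of $w$ consecutive digits contains at most one nonzero digit; $\mathcal N^{\mathrm{fin}.0}$ is the set of $w$-NAFs with $\xi_j=0$ for all $j<0$ and all but finitely many $j$; $\mathrm{value}(\xi)=\sum_j\xi_j\tau^j$. A digit set is a width-$w$ non-adjacent digit set if every element of $\mathbb Z[\tau]$ has a unique $w$-NAF in $\mathcal N^{\mathrm{fin}.0}$. -}

module Defs where

open import Data.Nat as ℕ using (ℕ; zero; suc; _≤_; _<_)
open import Data.Nat.DivMod using (_mod_; _/_)
open import Data.Integer as ℤ using (ℤ; +_)
open import Data.Rational as ℚ using (ℚ; ½; 0ℚ; 1ℚ)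
open import Data.Sign using (Sign)
open import Data.Fin using (Fin)
open import Data.List using (List; []; _∷_)
open import Data.Product using (Σ; _×_; _,_; ∃)
open import Data.Sum using (_⊎_)
open import Relation.Binary.PropositionalEquality using (_≡_)
open import Relation.Nullary using (¬_)

-- Z[τ] where τ is a root of X² - pX + q (4q - p² > 0).
-- An element  a + bτ  is represented by the pair (a , b).
-- τ is fixed among the two (complex conjugate) roots by the sign σ of
-- its imaginary part: Im τ = σ · sqrt(4q - p²)/2.

ZT : Set
ZT = ℤ × ℤ

-- Q(τ) = Q + Qτ, again in the basis (1, τ).  All points of the plane that
-- occur below (vertices of V, their midpoints, z/τ^w for z ∈ Z[τ]) lie here.
QT : Set
QT = ℚ × ℚ

module Setup (p q : ℤ) (σ : Sign) where

  -- ring operations on Z[τ], using τ² = pτ - q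
  0Z : ZT
  0Z = (+ 0 , + 0)

  τZ : ZT
  τZ = (+ 0 , + 1)

  _+Z_ : ZT → ZT → ZT
  (a , b) +Z (c , d) = (a ℤ.+ c , b ℤ.+ d)

  _-Z_ : ZT → ZT → ZT
  (a , b) -Z (c , d) = (a ℤ.- c , b ℤ.- d)

  _*Z_ : ZT → ZT → ZT
  (a , b) *Z (c , d) =
    (a ℤ.* c ℤ.- q ℤ.* (b ℤ.* d) , a ℤ.* d ℤ.+ b ℤ.* c ℤ.+ p ℤ.* (b ℤ.* d))

  _^Z_ : ZT → ℕ → ZT
  x ^Z zero = (+ 1 , + 0)
  x ^Z suc n = x *Z (x ^Z n)

  -- |a + bτ|² = a² + pab + qb²
  normZ : ZT → ℤ
  normZ (a , b) = a ℤ.* a ℤ.+ p ℤ.* (a ℤ.* b) ℤ.+ q ℤ.* (b ℤ.* b)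

  _∣Z_ : ZT → ZT → Set
  x ∣Z y = Σ ZT λ c → y ≡ x *Z c

  _≡_[modZ_] : ZT → ZT → ZT → Set
  x ≡ y [modZ m ] = m ∣Z (x -Z y)

  fromℤ : ℤ → ℚ
  fromℤ z = z ℚ./ 1

  pQ qQ : ℚ
  pQ = fromℤ p
  qQ = fromℤ q

  embed : ZT → QT
  embed (a , b) = (fromℤ a , fromℤ b)

  _+Q_ : QT → QT → QT
  (a , b) +Q (c , d) = (a ℚ.+ c , b ℚ.+ d)

  _-Q_ : QT → QT → QT
  (a , b) -Q (c , d) = (a ℚ.- c , b ℚ.- d)

  _·Q_ : ℚ → QT → QT
  t ·Q (a , b) = (t ℚ.* a , t ℚ.* b)

  _*Q_ : QT → QT → QT
  (a , b) *Q (c , d) =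
    (a ℚ.* c ℚ.- qQ ℚ.* (b ℚ.* d) , a ℚ.* d ℚ.+ b ℚ.* c ℚ.+ pQ ℚ.* (b ℚ.* d))

  normQ : QT → ℚ
  normQ (a , b) = a ℚ.* a ℚ.+ pQ ℚ.* (a ℚ.* b) ℚ.+ qQ ℚ.* (b ℚ.* b)

  re : QT → ℚ
  re (a , b) = a ℚ.+ b ℚ.* (pQ ℚ.* ½)

  sgnℚ : Sign → ℚ
  sgnℚ Sign.+ = 1ℚ
  sgnℚ Sign.- = ℚ.- 1ℚ

  ImPos : QT → Set
  ImPos (a , b) = 0ℚ ℚ.< sgnℚ σ ℚ.* b

  -- Im( conj(u) · v ) = det_{(1,τ)}(u,v) · Im τ ; its sign is the
  -- orientation of the pair (u , v) in the complex plane.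
  detQ : QT → QT → ℚ
  detQ (a , b) (c , d) = a ℚ.* d ℚ.- b ℚ.* c

  LeftOrOn : QT → QT → Set
  LeftOrOn u v = 0ℚ ℚ.≤ sgnℚ σ ℚ.* detQ u v

  InV : QT → Set
  InV z = (y : ZT) → normQ z ℚ.≤ normQ (z -Q embed y)

  InteriorV : QT → Set
  InteriorV z = (y : ZT) → ¬ (y ≡ 0Z) → normQ z ℚ.< normQ (z -Q embed y)

  -- a vertex of the polygon V: a point of V on two non-parallel bounding
  -- lines (perpendicular bisectors of 0,y₁ and 0,y₂)
  IsVertex : QT → Set
  IsVertex z = InV z × Σ ZT λ y₁ → Σ ZT λ y₂ →
    ¬ (y₁ ≡ 0Z) × ¬ (y₂ ≡ 0Z) × ¬ (detQ (embed y₁) (embed y₂) ≡ 0ℚ) ×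
    normQ z ≡ normQ (z -Q embed y₁) × normQ z ≡ normQ (z -Q embed y₂)

  record Labelling : Set where
    field
      m-1 : ℕ
      vtx : Fin (suc m-1) → QT

    m : ℕ
    m = suc m-1

    v : ℕ → QT
    v k = vtx (k mod m)

    field
      vtx-vertex  : (i : Fin m) → IsVertex (vtx i)
      vtx-all     : (z : QT) → IsVertex z → Σ (Fin m) λ i → vtx i ≡ z
      vtx-inj     : (i j : Fin m) → vtx i ≡ vtx j → i ≡ j
      v₀-re       : re (v 0) ≡ ½
      v₀-im       : ImPos (v 0)
      -- v_{k+1} follows v_k counter-clockwise: every vertex lies to the
      -- left of or on the directed edge v_k → v_{k+1}
      ccw         : (k : ℕ) (i : Fin m) →
                    LeftOrOn (v (suc k) -Q v k) (vtx i -Q v k)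

    mid : ℕ → QT
    mid k = ½ ·Q (v k +Q v (suc k))

  module _ (L : Labelling) where
    open Labelling L

    InṼ : QT → Set
    InṼ z =
      InteriorV z
      ⊎ (Σ ℕ λ k → Σ ℚ λ t → 0ℚ ℚ.< t × t ℚ.< 1ℚ ×
           z ≡ mid k +Q (t ·Q (v (suc k) -Q mid k)))
      ⊎ (Σ ℕ λ k → suc k ≤ m / 2 × z ≡ mid k)
      ⊎ (Σ ℕ λ k → 1 ≤ k × k ≤ m / 3 × z ≡ v k)

    module Width (w : ℕ) where

      InτʷṼ : ZT → Set
      InτʷṼ z = Σ QT λ u → InṼ u × (embed (τZ ^Z w) *Q u) ≡ embed z

      InD : ZT → Set
      InD d = d ≡ 0Z
            ⊎ (¬ (τZ ∣Z d) × InτʷṼ d ×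
               ((d' : ZT) → d' ≡ d [modZ (τZ ^Z w) ] → InτʷṼ d' → d' ≡ d))

      -- sequences ξ : ℤ → 𝒟 with ξ_j = 0 for j < 0 are represented by
      -- their restriction ℕ → ZT
      Seq : Set
      Seq = ℕ → ZT

      FinSupp : Seq → ℕ → Set
      FinSupp ξ N = (j : ℕ) → N ≤ j → ξ j ≡ 0Z

      partialValue : ℕ → Seq → ZT
      partialValue zero ξ = 0Z
      partialValue (suc N) ξ = partialValue N ξ +Z (ξ N *Z (τZ ^Z N))

      record IsNAFfin0 (ξ : Seq) : Set where
        field
          digits  : (j : ℕ) → InD (ξ j)
          nonadj  : (i j : ℕ) → i < j → j < i ℕ.+ w → ξ i ≡ 0Z ⊎ ξ j ≡ 0Z
          finite  : Σ ℕ (FinSupp ξ)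

      HasValue : Seq → ZT → Set
      HasValue ξ z = Σ ℕ λ N → FinSupp ξ N × partialValue N ξ ≡ z

      IsWidthNAFDigitSet : Set
      IsWidthNAFDigitSet = (z : ZT) → Σ Seq λ ξ → IsNAFfin0 ξ × HasValue ξ z ×
        ((ξ' : Seq) → IsNAFfin0 ξ' → HasValue ξ' z → (j : ℕ) → ξ' j ≡ ξ j)

      -- runs of the algorithm: Alg y ds  means that, started with y, the
      -- algorithm terminates and produces the digits ds = ξ₀ ∷ ξ₁ ∷ …
      data Alg : ZT → List ZT → Set where
        done  : Alg 0Z []
        step0 : ∀ {y y' ds} → ¬ (y ≡ 0Z) → τZ ∣Z y → y ≡ τZ *Z y' →
                Alg y' ds → Alg y (0Z ∷ ds)
        stepD : ∀ {y y' d ds} → ¬ (y ≡ 0Z) → ¬ (τZ ∣Z y) →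
                InD d → d ≡ y [modZ (τZ ^Z w) ] → (y -Z d) ≡ τZ *Z y' →
                Alg y' ds → Alg y (d ∷ ds)

      listSeq : List ZT → Seq
      listSeq [] j = 0Z
      listSeq (d ∷ ds) zero = d
      listSeq (d ∷ ds) (suc j) = listSeq ds j

      AlgorithmCorrect : Set
      AlgorithmCorrect = (z : ZT) →
        Σ (List ZT) (Alg z) ×
        ((ds : List ZT) → Alg z ds → IsNAFfin0 (listSeq ds) × HasValue (listSeq ds) z)

{-# OPTIONS --safe #-}
module Submission where

-- Write s for the sign of Im τ and ω = sτ - h with h an integer such that Re ω is 0 or 1/2.  In the coordinates
-- α = 2⟨u,1⟩, β = 2⟨u,ω⟩ of a point u, the comparison |u| ≤ |u - (i + jω)| becomes the linear inequality
-- iα + jβ ≤ |i + jω|².  With c = |ω|², the Voronoi cell is the rectangle |α| ≤ 1, |β| ≤ c for even p and the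
-- hexagon |α| ≤ 1, |β| ≤ c, |β - α| ≤ c for odd p, and every statement about the cell, its vertices and its
-- restricted version, in particular that the translates of the latter partition the plane, is a finite case
-- distinction in linear arithmetic.
--
-- For termination, let y be not divisible by τ, let d be its digit and y - d = τʷx.  From |2y + d|² ≥ 0 one gets
-- 2|τʷ|²|x|² ≤ 6|y|² + 3|d|², and 4|d|² ≤ (q + 1)|τʷ|² because V lies in the disc of radius √(q+1)/2.  If
-- 4|y|² < |τʷ|², then y/τʷ is in the interior of V, so y = d and x = 0; otherwise these inequalities give |x| < |y|
-- unless q = w = 2 (for q = 3, w = 2 one also needs 4|y|² ≠ 9).  For q = w = 2, |x| ≥ |y| forces τ² to divide 2y,
-- which is impossible for p = ±1; for even p it forces d = -y, so that x = d for p = 0, while for p = ±2 two such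
-- steps in a row lead from y to -y = d.
--
-- Uniqueness holds because two w-NAFs of the same value have lowest digits congruent modulo τ, hence both zero or
-- both nonzero, and in the latter case congruent modulo τʷ.

open import Defs
open import Algebra.Bundles using (CommutativeRing)
import Algebra.Properties.Ring as RingProperties
open import Algebra.Structures using (IsCommutativeRing)
open import Data.Bool using (Bool; true; false; _∧_; _∨_; if_then_else_; T)
open import Data.Empty using (⊥; ⊥-elim)
open import Data.Fin as Fin using (Fin)
import Data.Fin.Properties as Finₚ
open import Data.Integer as ℤ using (ℤ; +_; -[1+_])
import Data.Integer.DivMod as ℤ
import Data.Integer.Divisibility.Signed as ℤ
import Data.Integer.Properties as ℤₚ
open import Data.List using (List; []; _∷_; map; _++_; concatMap; foldr; replicate; length)
import Data.List.Properties as Listₚ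
open import Data.Maybe using (Maybe; just; nothing)
open import Data.Nat as ℕ using (ℕ; zero; suc)
import Data.Nat.Divisibility as ℕ
import Data.Nat.DivMod as ℕ
open import Data.Nat.GeneralisedArithmetic using (fold)
open import Data.Nat.Induction using (<-wellFounded)
import Data.Nat.Properties as ℕₚ
open import Data.Product using (Σ; _×_; _,_; proj₁; proj₂)
open import Data.Product.Properties using (≡-dec)
open import Data.Rational as ℚ using (ℚ; ½; 0ℚ; 1ℚ)
import Data.Rational.Properties as ℚₚ
import Data.Rational.Unnormalised as ℚᵘ
import Data.Rational.Unnormalised.Properties as ℚᵘₚ
open import Data.Sign using (Sign)
open import Data.Sum using (_⊎_; inj₁; inj₂; [_,_]′)
open import Data.Unit using (tt)
open import Data.Vec as Vec using (Vec; []; _∷_; lookup; allFin)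
open import Data.Vec.N-ary using (N-ary; _$ⁿ_)
open import Function using (_∘_; _$_)
open import Induction.WellFounded using (Acc; acc)
open import Relation.Binary.Definitions using (tri<; tri≈; tri>)
open import Relation.Binary.PropositionalEquality
  using (_≡_; refl; sym; trans; cong; cong₂; subst; subst₂; module ≡-Reasoning)
open import Relation.Nullary using (Dec; yes; no; ¬_; does)
open import Relation.Nullary.Decidable using (map′; _×-dec_)

-- Replacing τ by ω makes the geometry finite: the Gram matrix of 1, ω involves only e = 2 Re ω,
-- which is 0 or 1, and c = |ω|² ≥ 1, so each of the two shapes of the cell is a linear problem with
-- one symbolic parameter c, however large p is. Everything takes place in ℚ(τ) in the basis 1, τ.
-- No square root occurs; the imaginary part is visible only through its sign and through Δ = 4c -
-- e² = 4q - p².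
--
-- The weights in |2y + d|² ≥ 0 are sharp for |d| = 2|y|. When 4|y|² ≥ |τʷ|², the bound on |d|
-- allows the ratio |d|/|y| to reach √(q + 1), so by the triangle inequality |x| < |y| is assured if
-- 1 + √(q + 1) < |τʷ|. For q = 3, w = 2 both sides are 3 and the worst ratio is 2, which is where
-- these weights come from. For q = 2, w = 3 the inequality holds narrowly (2.73 against 2.82). For
-- q = w = 2 it fails, and the norm can really stay the same in a step, so that descent on the norm
-- needs the extra arithmetic of these small rings.

-- Linear arithmetic over ordered rings by certified Fourier-Motzkin elimination

module LinearArithmetic where

  infixl 9 _⊕_ _⊖_
  infixl 10 _⊗_
  infix  11 ⊝_ #_

  data Expr (n : ℕ) : Set where
    var         : Fin n → Expr n
    #_          : ℕ → Expr n
    _⊕_ _⊖_ _⊗_ : Expr n → Expr n → Expr n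
    ⊝_          : Expr n → Expr n

  infix  8 _≦_ _⋖_ _≐_
  infixr 7 _⩓_
  infixr 6 _⩔_

  data Formula (n : ℕ) : Set where
    _≦_ _⋖_ _≐_ : Expr n → Expr n → Formula n
    _⩓_ _⩔_     : Formula n → Formula n → Formula n
    ff          : Formula n

  infix 2 _⊢_
  record Sequent (n : ℕ) : Set where
    constructor _⊢_
    field
      hypotheses : List (Formula n)
      conclusion : Formula n

  Monomial : ℕ → Set
  Monomial n = List (Fin n)

  Polynomial : ℕ → Set
  Polynomial n = List (ℤ × Monomial n)

  module _ {n : ℕ} where

    _≟ₘ_ : (m m′ : Monomial n) → Dec (m ≡ m′)
    _≟ₘ_ = Listₚ.≡-dec Finₚ._≟_

    insertVar : Fin n → Monomial n → Monomial n
    insertVar i [] = i ∷ []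
    insertVar i (j ∷ m) = if does (Fin.toℕ i ℕ.≤? Fin.toℕ j) then i ∷ j ∷ m else j ∷ insertVar i m

    _·ₘ_ : Monomial n → Monomial n → Monomial n
    m ·ₘ m′ = foldr insertVar m′ m

    addTerm : ℤ → Monomial n → Polynomial n → Polynomial n
    addTerm k m [] = (k , m) ∷ []
    addTerm k m ((k′ , m′) ∷ f) with m ≟ₘ m′
    ... | yes _ = (k ℤ.+ k′ , m′) ∷ f
    ... | no _  = (k′ , m′) ∷ addTerm k m f

    _+ₚ_ : Polynomial n → Polynomial n → Polynomial n
    [] +ₚ g = g
    ((k , m) ∷ f) +ₚ g = addTerm k m (f +ₚ g)

    termTimes : ℤ → Monomial n → Polynomial n → Polynomial n
    termTimes k m [] = []
    termTimes k m ((k′ , m′) ∷ f) = addTerm (k ℤ.* k′) (m ·ₘ m′) (termTimes k m f)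

    _*ₚ_ : Polynomial n → Polynomial n → Polynomial n
    [] *ₚ g = []
    ((k , m) ∷ f) *ₚ g = termTimes k m g +ₚ (f *ₚ g)

    scale : ℤ → Polynomial n → Polynomial n
    scale k [] = []
    scale k ((k′ , m) ∷ f) = (k ℤ.* k′ , m) ∷ scale k f

    polynomial : Expr n → Polynomial n
    polynomial (var i) = (+ 1 , i ∷ []) ∷ []
    polynomial (# k)   = (+ k , []) ∷ []
    polynomial (e ⊕ f) = polynomial e +ₚ polynomial f
    polynomial (e ⊖ f) = polynomial e +ₚ scale (-[1+ 0 ]) (polynomial f)
    polynomial (e ⊗ f) = polynomial e *ₚ polynomial f
    polynomial (⊝ e)   = scale (-[1+ 0 ]) (polynomial e)

    -- `addTerm` keeps terms whose coefficients have cancelled, so non-constant terms with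
    -- coefficient 0 must be tolerated here.
    constantTerm : Polynomial n → Maybe ℤ
    constantTerm [] = just (+ 0)
    constantTerm ((k , []) ∷ f) with constantTerm f
    ... | nothing = nothing
    ... | just k′ = just (k ℤ.+ k′)
    constantTerm ((k , _ ∷ _) ∷ f) with k ℤ.≟ + 0
    ... | yes _ = constantTerm f
    ... | no _  = nothing

    data Relation : Set where
      eqᵣ leᵣ ltᵣ : Relation

    -- A row (R , f) stands for 0 R f.
    Row : Set
    Row = Relation × Polynomial n

    atom : Relation → Expr n → Expr n → Row
    atom r e f = r , polynomial (f ⊖ e)

    _⊔ᵣ_ : Relation → Relation → Relation
    eqᵣ ⊔ᵣ r  = r
    ltᵣ ⊔ᵣ r  = ltᵣ
    leᵣ ⊔ᵣ eqᵣ = leᵣ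
    leᵣ ⊔ᵣ r  = r

    addRow : Row → Row → Row
    addRow (r , f) (r′ , g) = r ⊔ᵣ r′ , f +ₚ g

    scaleRow : ℤ → Row → Maybe Row
    scaleRow k (eqᵣ , f)         = just (eqᵣ , scale k f)
    scaleRow (+ 0) (_ , f)      = just (eqᵣ , [])
    scaleRow (+ suc k) (r , f)  = just (r , scale (+ suc k) f)
    scaleRow -[1+ k ] (_ , f)   = nothing

    combine : List ℤ → List Row → Maybe Row
    combine [] _ = just (eqᵣ , [])
    combine (k ∷ ks) [] = just (eqᵣ , [])
    combine (k ∷ ks) (ρ ∷ ρs) with scaleRow k ρ | combine ks ρs
    ... | just ρ′ | just ρ″ = just (addRow ρ′ ρ″)
    ... | _       | _       = nothing

    absurdConstant : Relation → ℤ → Bool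
    absurdConstant r  (-[1+ _ ]) = true
    absurdConstant eqᵣ (+ suc _)  = true
    absurdConstant ltᵣ (+ 0)      = true
    absurdConstant _  _          = false

    absurdRow : Row → Bool
    absurdRow (r , f) with constantTerm f
    ... | just k  = absurdConstant r k
    ... | nothing = false

    -- Fourier–Motzkin elimination on rows that carry the coefficients expressing them through the
    -- input rows.  Only its output, a list of such coefficients, is verified.
    private
      Tracked : Set
      Tracked = Row × List ℤ

      coefficient : Monomial n → Polynomial n → ℤ
      coefficient m [] = + 0
      coefficient m ((k , m′) ∷ f) = if does (m ≟ₘ m′) then k ℤ.+ coefficient m f else coefficient m f

      addCoefficients : List ℤ → List ℤ → List ℤ
      addCoefficients [] ks = ks
      addCoefficients (k ∷ ks) [] = k ∷ ks
      addCoefficients (k ∷ ks) (l ∷ ls) = k ℤ.+ l ∷ addCoefficients ks ls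

      dropZeros : Polynomial n → Polynomial n
      dropZeros [] = []
      dropZeros ((k , m) ∷ f) = if does (k ℤ.≟ + 0) then dropZeros f else (k , m) ∷ dropZeros f

      linearCombination : ℤ → Tracked → ℤ → Tracked → Tracked
      linearCombination k ((r , f) , ks) l ((r′ , g) , ls) =
        (r ⊔ᵣ r′ , dropZeros (scale k f +ₚ scale l g)) ,
        addCoefficients (map (k ℤ.*_) ks) (map (l ℤ.*_) ls)

      pivot : Polynomial n → Maybe (Monomial n)
      pivot [] = nothing
      pivot ((k , []) ∷ f) = pivot f
      pivot ((k , m@(_ ∷ _)) ∷ f) = if does (k ℤ.≟ + 0) then pivot f else just m

      isPositive isNegative : ℤ → Bool
      isPositive (+ suc _) = true
      isPositive _         = false
      isNegative -[1+ _ ]  = true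
      isNegative _         = false

      isEquality : Relation → Bool
      isEquality eqᵣ = true
      isEquality _  = false

      equalityPivot : List Tracked → Maybe (Tracked × Monomial n)
      equalityPivot [] = nothing
      equalityPivot (t@((r , f) , _) ∷ ts) with isEquality r | pivot f
      ... | true | just m = just (t , m)
      ... | _    | _      = equalityPivot ts

      -- The monomial whose elimination combines the fewest pairs of rows.
      inequalityPivot : List Tracked → Maybe (Monomial n)
      inequalityPivot ts = best nothing (concatMap (λ ((_ , f) , _) → map proj₂ f) ts)
        where
        count : (ℤ → Bool) → Monomial n → ℕ
        count P m = foldr (λ ((_ , f) , _) k → if P (coefficient m f) then suc k else k) 0 ts
        best : Maybe (ℕ × Monomial n) → List (Monomial n) → Maybe (Monomial n)
        best nothing        []       = nothing
        best (just (_ , m)) []       = just m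
        best b ([] ∷ ms) = best b ms
        best b (m@(_ ∷ _) ∷ ms) with b | count isPositive m ℕ.* count isNegative m
        ... | nothing       | cost = best (just (cost , m)) ms
        ... | just (c , m′) | cost = if cost ℕ.<ᵇ c then best (just (cost , m)) ms else best b ms

      -- Kohler's criterion: after k eliminations a row combined from more than k + 1 inputs is redundant.
      prune : ℕ → List Tracked → List Tracked
      prune k [] = []
      prune k (t@(_ , ks) ∷ ts) =
        if foldr (λ { (+ 0) n → n ; _ n → suc n }) 0 ks ℕ.≤ᵇ suc k then t ∷ prune k ts else prune k ts

      -- The two cases keep the multiplier of `t′` nonnegative, so that `t′` may be an inequality;
      -- the equation `t` may take a multiplier of either sign.
      substituteEquality : Tracked → Monomial n → Tracked → Tracked
      substituteEquality t@((_ , f) , _) m t′@((_ , g) , _) with coefficient m f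
      ... | + k      = linearCombination (ℤ.- coefficient m g) t (+ k) t′
      ... | -[1+ k ] = linearCombination (coefficient m g) t (+ suc k) t′

      eliminate : Monomial n → List Tracked → List Tracked
      eliminate m ts = without ts ++ concatMap (λ t → map (cancel t) (withSign isNegative ts))
          (withSign isPositive ts)
        where
        coeff : Tracked → ℤ
        coeff ((_ , f) , _) = coefficient m f
        withSign : (ℤ → Bool) → List Tracked → List Tracked
        withSign P [] = []
        withSign P (t ∷ ts) = if P (coeff t) then t ∷ withSign P ts else withSign P ts
        without : List Tracked → List Tracked
        without [] = []
        without (t ∷ ts) = if does (coeff t ℤ.≟ + 0) then t ∷ without ts else without ts
        cancel : Tracked → Tracked → Tracked
        cancel t t′ = linearCombination (ℤ.- coeff t′) t (coeff t) t′

      contradictoryRow : List Tracked → Maybe (List ℤ)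
      contradictoryRow [] = nothing
      contradictoryRow ((r , ks) ∷ ts) = if absurdRow r then just ks else contradictoryRow ts

      search : ℕ → ℕ → List Tracked → List ℤ
      search zero k ts = []
      search (suc fuel) k ts with contradictoryRow ts | equalityPivot ts | inequalityPivot ts
      ... | just ks | _            | _       = ks
      ... | nothing | just (t , m) | _       = search fuel (suc k) (map (substituteEquality t m) ts)
      ... | nothing | nothing      | just m  = search fuel (suc k) (prune (suc k) (eliminate m ts))
      ... | nothing | nothing      | nothing = []

      track : ℕ → List Row → List Tracked
      track k [] = []
      track k ((r , f) ∷ ρs) = ((r , dropZeros f) , replicate k (+ 0) ++ (+ 1) ∷ []) ∷ track (suc k) ρs

    -- The number 60 is fuel bounding the eliminations. If it runs out, the certificate is empty and
    -- its combination 0 = 0 is not absurd, so a failed search can only reject a goal.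
    certificate : List Row → List ℤ
    certificate ρs = search 60 0 (track 0 ρs)

    refutes : List ℤ → List Row → Bool
    refutes ks ρs with combine ks ρs
    ... | just ρ  = absurdRow ρ
    ... | nothing = false

    -- The continuation is run once per branch, so that each disjunction among the hypotheses
    -- multiplies the branches and every branch sees all its atoms.
    split : Formula n → (List Row → Bool) → List Row → Bool
    split (e ≦ f) k as = k (atom leᵣ e f ∷ as)
    split (e ⋖ f) k as = k (atom ltᵣ e f ∷ as)
    split (e ≐ f) k as = k (atom eqᵣ e f ∷ as)
    split (g ⩓ h) k as = split g (split h k) as
    split (g ⩔ h) k as = split g k as ∧ split h k as
    split ff      k as = true

    refutable : List Row → Bool
    refutable as = refutes (certificate as) as

    -- Within a branch a disjunctive conclusion has to be reached through one of its disjuncts.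
    -- Hence distinctions such as the position of a point on an edge are prepared outside, by
    -- `compare` and `≤-split`.
    follows : Formula n → List Row → Bool
    follows (e ≦ f) as = refutable (atom ltᵣ f e ∷ as)
    follows (e ⋖ f) as = refutable (atom leᵣ f e ∷ as)
    follows (e ≐ f) as = refutable (atom ltᵣ f e ∷ as) ∧ refutable (atom ltᵣ e f ∷ as)
    follows (g ⩓ h) as = follows g as ∧ follows h as
    follows (g ⩔ h) as = follows g as ∨ follows h as
    follows ff      as = refutable as

    provable : List (Formula n) → Formula n → List Row → Bool
    provable []       g as = follows g as
    provable (h ∷ hs) g as = split h (provable hs g) as

  record OrderedRing : Set₁ where
    infix 4 _≤_ _<_
    infixl 6 _+_
    infixl 7 _*_
    field
      Carrier   : Set
      _+_ _*_   : Carrier → Carrier → Carrier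
      -_        : Carrier → Carrier
      0# 1#     : Carrier
      isCommutativeRing : IsCommutativeRing _≡_ _+_ _*_ -_ 0# 1#
      _≤_ _<_   : Carrier → Carrier → Set
      fromInteger : ℤ → Carrier
      fromInteger-0 : fromInteger (+ 0) ≡ 0#
      fromInteger-1 : fromInteger (+ 1) ≡ 1#
      fromInteger-+ : ∀ k l → fromInteger (k ℤ.+ l) ≡ fromInteger k + fromInteger l
      fromInteger-* : ∀ k l → fromInteger (k ℤ.* l) ≡ fromInteger k * fromInteger l
      fromInteger-negative : ∀ k → fromInteger -[1+ k ] < 0#
      fromInteger-positive : ∀ k → 0# < fromInteger (+ suc k)
      <-irrefl  : ∀ {x} → ¬ (x < x)
      ≤-refl    : ∀ {x} → x ≤ x
      ≤-antisym : ∀ {x y} → x ≤ y → y ≤ x → x ≡ y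
      <⇒≤       : ∀ {x y} → x < y → x ≤ y
      ≮⇒≥       : ∀ {x y} → ¬ (x < y) → y ≤ x
      ≰⇒>       : ∀ {x y} → ¬ (x ≤ y) → y < x
      <-≤-trans : ∀ {x y z} → x < y → y ≤ z → x < z
      ≤-trans   : ∀ {x y z} → x ≤ y → y ≤ z → x ≤ z
      +-monoˡ-≤ : ∀ z {x y} → x ≤ y → x + z ≤ y + z
      +-monoˡ-< : ∀ z {x y} → x < y → x + z < y + z
      *-pos-pos : ∀ {x y} → 0# < x → 0# < y → 0# < x * y
      *-pos-nonNeg : ∀ {x y} → 0# < x → 0# ≤ y → 0# ≤ x * y

  module Linear (R : OrderedRing) where
    open OrderedRing R

    private
      commutativeRing : CommutativeRing _ _
      commutativeRing = record { isCommutativeRing = isCommutativeRing }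

    open CommutativeRing commutativeRing
      using (+-assoc; +-comm; +-identityˡ; +-identityʳ; *-assoc; *-comm; *-identityˡ; *-identityʳ; distribˡ; distribʳ; zeroˡ; zeroʳ; -‿inverseʳ; -‿inverseˡ; ring)
    open RingProperties ring using (-1*x≈-x)
    open ≡-Reasoning

    infixl 6 _-_
    _-_ : Carrier → Carrier → Carrier
    x - y = x + (- y)

    ⟦_⟧ : ∀ {n} → Expr n → Vec Carrier n → Carrier
    ⟦ var i ⟧ ρ = lookup ρ i
    ⟦ # k   ⟧ ρ = fromInteger (+ k)
    ⟦ e ⊕ f ⟧ ρ = ⟦ e ⟧ ρ + ⟦ f ⟧ ρ
    ⟦ e ⊖ f ⟧ ρ = ⟦ e ⟧ ρ - ⟦ f ⟧ ρ
    ⟦ e ⊗ f ⟧ ρ = ⟦ e ⟧ ρ * ⟦ f ⟧ ρ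
    ⟦ ⊝ e   ⟧ ρ = - ⟦ e ⟧ ρ

    ⟦_⟧ᶠ : ∀ {n} → Formula n → Vec Carrier n → Set
    ⟦ e ≦ f ⟧ᶠ ρ = ⟦ e ⟧ ρ ≤ ⟦ f ⟧ ρ
    ⟦ e ⋖ f ⟧ᶠ ρ = ⟦ e ⟧ ρ < ⟦ f ⟧ ρ
    ⟦ e ≐ f ⟧ᶠ ρ = ⟦ e ⟧ ρ ≡ ⟦ f ⟧ ρ
    ⟦ g ⩓ h ⟧ᶠ ρ = ⟦ g ⟧ᶠ ρ × ⟦ h ⟧ᶠ ρ
    ⟦ g ⩔ h ⟧ᶠ ρ = ⟦ g ⟧ᶠ ρ ⊎ ⟦ h ⟧ᶠ ρ
    ⟦ ff    ⟧ᶠ ρ = ⊥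

    infixr 0 _⇒[_]_
    _⇒[_]_ : ∀ {n} → List (Formula n) → Vec Carrier n → Set → Set
    []       ⇒[ ρ ] A = A
    (h ∷ hs) ⇒[ ρ ] A = ⟦ h ⟧ᶠ ρ → hs ⇒[ ρ ] A

    ⟦_⟧ˢ : ∀ {n} → Sequent n → Vec Carrier n → Set
    ⟦ hs ⊢ g ⟧ˢ ρ = hs ⇒[ ρ ] ⟦ g ⟧ᶠ ρ

    module _ {n : ℕ} (ρ : Vec Carrier n) where

      ⟦_⟧ₘ : Monomial n → Carrier
      ⟦ [] ⟧ₘ    = 1#
      ⟦ i ∷ m ⟧ₘ = lookup ρ i * ⟦ m ⟧ₘ

      ⟦_⟧ₚ : Polynomial n → Carrier
      ⟦ [] ⟧ₚ          = 0#
      ⟦ (k , m) ∷ f ⟧ₚ = fromInteger k * ⟦ m ⟧ₘ + ⟦ f ⟧ₚ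

      swap-* : ∀ x y z → x * (y * z) ≡ y * (x * z)
      swap-* x y z = trans (sym (*-assoc x y z)) (trans (cong (_* z) (*-comm x y)) (*-assoc y x z))

      swap-+ : ∀ x y z → x + (y + z) ≡ y + (x + z)
      swap-+ x y z = trans (sym (+-assoc x y z)) (trans (cong (_+ z) (+-comm x y)) (+-assoc y x z))

      insertVar-correct : ∀ i m → ⟦ insertVar i m ⟧ₘ ≡ lookup ρ i * ⟦ m ⟧ₘ
      insertVar-correct i [] = refl
      insertVar-correct i (j ∷ m) with does (Fin.toℕ i ℕ.≤? Fin.toℕ j)
      ... | true  = refl
      ... | false = trans (cong (lookup ρ j *_) (insertVar-correct i m)) (swap-* _ _ _)

      ·ₘ-correct : ∀ m m′ → ⟦ m ·ₘ m′ ⟧ₘ ≡ ⟦ m ⟧ₘ * ⟦ m′ ⟧ₘ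
      ·ₘ-correct [] m′ = sym (*-identityˡ _)
      ·ₘ-correct (i ∷ m) m′ = trans (insertVar-correct i (m ·ₘ m′))
        (trans (cong (lookup ρ i *_) (·ₘ-correct m m′)) (sym (*-assoc _ _ _)))

      addTerm-correct : ∀ k m f → ⟦ addTerm k m f ⟧ₚ ≡ fromInteger k * ⟦ m ⟧ₘ + ⟦ f ⟧ₚ
      addTerm-correct k m [] = refl
      addTerm-correct k m ((k′ , m′) ∷ f) with m ≟ₘ m′
      ... | yes refl = trans
            (cong (_+ ⟦ f ⟧ₚ) (trans (cong (_* ⟦ m ⟧ₘ) (fromInteger-+ k k′)) (distribʳ _ _ _)))
            (+-assoc _ _ _)
      ... | no _ = trans (cong₂ _+_ refl (addTerm-correct k m f)) (swap-+ _ _ _)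

      +ₚ-correct : ∀ f g → ⟦ f +ₚ g ⟧ₚ ≡ ⟦ f ⟧ₚ + ⟦ g ⟧ₚ
      +ₚ-correct [] g = sym (+-identityˡ _)
      +ₚ-correct ((k , m) ∷ f) g = trans (addTerm-correct k m (f +ₚ g))
        (trans (cong₂ _+_ refl (+ₚ-correct f g)) (sym (+-assoc _ _ _)))

      private
        term-* : ∀ k m k′ m′ →
          fromInteger (k ℤ.* k′) * (⟦ m ⟧ₘ * ⟦ m′ ⟧ₘ) ≡ (fromInteger k * ⟦ m ⟧ₘ) * (fromInteger k′ * ⟦ m′ ⟧ₘ)
        term-* k m k′ m′ = begin
          fromInteger (k ℤ.* k′) * (⟦ m ⟧ₘ * ⟦ m′ ⟧ₘ)                 ≡⟨ cong₂ _*_ (fromInteger-* k k′) refl ⟩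
          (fromInteger k * fromInteger k′) * (⟦ m ⟧ₘ * ⟦ m′ ⟧ₘ)       ≡⟨ *-assoc _ _ _ ⟩
          fromInteger k * (fromInteger k′ * (⟦ m ⟧ₘ * ⟦ m′ ⟧ₘ))       ≡⟨ cong (fromInteger k *_) (swap-* _ _ _) ⟩
          fromInteger k * (⟦ m ⟧ₘ * (fromInteger k′ * ⟦ m′ ⟧ₘ))       ≡⟨ sym (*-assoc _ _ _) ⟩
          (fromInteger k * ⟦ m ⟧ₘ) * (fromInteger k′ * ⟦ m′ ⟧ₘ)       ∎

      termTimes-correct : ∀ k m f → ⟦ termTimes k m f ⟧ₚ ≡ (fromInteger k * ⟦ m ⟧ₘ) * ⟦ f ⟧ₚ
      termTimes-correct k m [] = sym (zeroʳ _)
      termTimes-correct k m ((k′ , m′) ∷ f) = begin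
        ⟦ addTerm (k ℤ.* k′) (m ·ₘ m′) (termTimes k m f) ⟧ₚ
          ≡⟨ addTerm-correct (k ℤ.* k′) (m ·ₘ m′) (termTimes k m f) ⟩
        fromInteger (k ℤ.* k′) * ⟦ m ·ₘ m′ ⟧ₘ + ⟦ termTimes k m f ⟧ₚ
          ≡⟨ cong₂ _+_ (trans (cong (fromInteger (k ℤ.* k′) *_) (·ₘ-correct m m′)) (term-* k m k′ m′))
                       (termTimes-correct k m f) ⟩
        (fromInteger k * ⟦ m ⟧ₘ) * (fromInteger k′ * ⟦ m′ ⟧ₘ) + (fromInteger k * ⟦ m ⟧ₘ) * ⟦ f ⟧ₚ
          ≡⟨ sym (distribˡ _ _ _) ⟩
        (fromInteger k * ⟦ m ⟧ₘ) * (fromInteger k′ * ⟦ m′ ⟧ₘ + ⟦ f ⟧ₚ) ∎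

      *ₚ-correct : ∀ f g → ⟦ f *ₚ g ⟧ₚ ≡ ⟦ f ⟧ₚ * ⟦ g ⟧ₚ
      *ₚ-correct [] g = sym (zeroˡ _)
      *ₚ-correct ((k , m) ∷ f) g = trans (+ₚ-correct (termTimes k m g) (f *ₚ g))
        (trans (cong₂ _+_ (termTimes-correct k m g) (*ₚ-correct f g)) (sym (distribʳ _ _ _)))

      scale-correct : ∀ k f → ⟦ scale k f ⟧ₚ ≡ fromInteger k * ⟦ f ⟧ₚ
      scale-correct k [] = sym (zeroʳ _)
      scale-correct k ((k′ , m) ∷ f) = trans
        (cong₂ _+_ (trans (cong (_* ⟦ m ⟧ₘ) (fromInteger-* k k′)) (*-assoc _ _ _)) (scale-correct k f))
        (sym (distribˡ _ _ _))

      fromInteger-minus : ∀ x → fromInteger -[1+ 0 ] * x ≡ - x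
      fromInteger-minus x = trans (cong (_* x) minus-one) (-1*x≈-x x)
        where
        minus-one : fromInteger -[1+ 0 ] ≡ - 1#
        minus-one = begin
          fromInteger -[1+ 0 ]                                  ≡⟨ sym (+-identityʳ _) ⟩
          fromInteger -[1+ 0 ] + 0#                             ≡⟨ cong₂ _+_ refl (sym (-‿inverseʳ 1#)) ⟩
          fromInteger -[1+ 0 ] + (1# + - 1#)                    ≡⟨ sym (+-assoc _ _ _) ⟩
          (fromInteger -[1+ 0 ] + 1#) + - 1#
            ≡⟨ cong (λ x → (fromInteger -[1+ 0 ] + x) + - 1#) (sym fromInteger-1) ⟩
          (fromInteger -[1+ 0 ] + fromInteger (+ 1)) + - 1#
            ≡⟨ cong (_+ - 1#) (trans (sym (fromInteger-+ -[1+ 0 ] (+ 1))) fromInteger-0) ⟩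
          0# + - 1#                                             ≡⟨ +-identityˡ _ ⟩
          - 1#                                                  ∎

      polynomial-correct : ∀ e → ⟦ polynomial e ⟧ₚ ≡ ⟦ e ⟧ ρ
      polynomial-correct (var i) = trans (+-identityʳ _) (trans (cong₂ _*_ fromInteger-1 refl)
        (trans (*-identityˡ _) (*-identityʳ _)))
      polynomial-correct (# k) = trans (+-identityʳ _) (*-identityʳ _)
      polynomial-correct (e ⊕ f) = trans (+ₚ-correct (polynomial e) (polynomial f))
        (cong₂ _+_ (polynomial-correct e) (polynomial-correct f))
      polynomial-correct (e ⊖ f) = trans (+ₚ-correct (polynomial e) (scale -[1+ 0 ] (polynomial f)))
        (cong₂ _+_ (polynomial-correct e)
          (trans (scale-correct -[1+ 0 ] (polynomial f))
            (trans (fromInteger-minus _) (cong -_ (polynomial-correct f)))))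
      polynomial-correct (e ⊗ f) = trans (*ₚ-correct (polynomial e) (polynomial f))
        (cong₂ _*_ (polynomial-correct e) (polynomial-correct f))
      polynomial-correct (⊝ e) = trans (scale-correct -[1+ 0 ] (polynomial e))
        (trans (fromInteger-minus _) (cong -_ (polynomial-correct e)))

      constantTerm-correct : ∀ f {k} → constantTerm f ≡ just k → ⟦ f ⟧ₚ ≡ fromInteger k
      constantTerm-correct [] refl = sym fromInteger-0
      constantTerm-correct ((k , []) ∷ f) e with constantTerm f in e′
      constantTerm-correct ((k , []) ∷ f) refl | just k′ = trans
        (cong₂ _+_ (*-identityʳ _) (constantTerm-correct f e′)) (sym (fromInteger-+ k k′))
      constantTerm-correct ((k , _ ∷ _) ∷ f) e with k ℤ.≟ + 0
      ... | yes refl = trans (cong₂ _+_ (trans (cong₂ _*_ fromInteger-0 refl) (zeroˡ _)) (constantTerm-correct f e))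
                             (+-identityˡ _)

      Holds : Relation {n} → Carrier → Set
      Holds eqᵣ x = x ≡ 0#
      Holds leᵣ x = 0# ≤ x
      Holds ltᵣ x = 0# < x

      HoldsRow : Row → Set
      HoldsRow (r , f) = Holds r ⟦ f ⟧ₚ

      private
        ≤-plus : ∀ {x y} → 0# ≤ x → 0# ≤ y → 0# ≤ x + y
        ≤-plus {x} {y} 0≤x 0≤y = ≤-trans 0≤y (subst (_≤ x + y) (+-identityˡ y) (+-monoˡ-≤ y 0≤x))

        <-plus : ∀ {x y} → 0# < x → 0# ≤ y → 0# < x + y
        <-plus {x} {y} 0<x 0≤y = <-≤-trans 0<x
          (subst₂ _≤_ (+-identityˡ x) (+-comm y x) (+-monoˡ-≤ x 0≤y))

        difference-≤ : ∀ {x y} → x ≤ y → 0# ≤ y - x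
        difference-≤ {x} x≤y = subst (_≤ _) (-‿inverseʳ x) (+-monoˡ-≤ (- x) x≤y)

        difference-< : ∀ {x y} → x < y → 0# < y - x
        difference-< {x} x<y = subst (_< _) (-‿inverseʳ x) (+-monoˡ-< (- x) x<y)

      Holds-+ : ∀ r r′ {x y} → Holds r x → Holds r′ y → Holds (r ⊔ᵣ r′) (x + y)
      Holds-+ eqᵣ r′ {y = y} refl hy = subst (Holds r′) (sym (+-identityˡ y)) hy
      Holds-+ leᵣ eqᵣ {x} hx refl = subst (0# ≤_) (sym (+-identityʳ x)) hx
      Holds-+ leᵣ leᵣ hx hy = ≤-plus hx hy
      Holds-+ leᵣ ltᵣ {x} {y} hx hy = subst (0# <_) (+-comm y x) (<-plus hy hx)
      Holds-+ ltᵣ eqᵣ hx refl = <-plus hx ≤-refl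
      Holds-+ ltᵣ leᵣ hx hy = <-plus hx hy
      Holds-+ ltᵣ ltᵣ hx hy = <-plus hx (<⇒≤ hy)

      addRow-correct : ∀ a b → HoldsRow a → HoldsRow b → HoldsRow (addRow a b)
      addRow-correct (r , f) (r′ , g) ha hb = subst (Holds (r ⊔ᵣ r′)) (sym (+ₚ-correct f g)) (Holds-+ r r′ ha hb)

      scaleRow-correct : ∀ k a {b} → scaleRow k a ≡ just b → HoldsRow a → HoldsRow b
      scaleRow-correct k (eqᵣ , f) refl ha =
        trans (scale-correct k f) (trans (cong (fromInteger k *_) ha) (zeroʳ _))
      scaleRow-correct (+ 0) (leᵣ , f) refl ha = refl
      scaleRow-correct (+ 0) (ltᵣ , f) refl ha = refl
      scaleRow-correct (+ suc k) (leᵣ , f) refl ha =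
        subst (0# ≤_) (sym (scale-correct (+ suc k) f)) (*-pos-nonNeg (fromInteger-positive k) ha)
      scaleRow-correct (+ suc k) (ltᵣ , f) refl ha =
        subst (0# <_) (sym (scale-correct (+ suc k) f)) (*-pos-pos (fromInteger-positive k) ha)

      data AllHold : List Row → Set where
        []  : AllHold []
        _∷_ : ∀ {a as} → HoldsRow a → AllHold as → AllHold (a ∷ as)

      combine-correct : ∀ ks as {b} → combine ks as ≡ just b → AllHold as → HoldsRow b
      combine-correct [] as refl h = refl
      combine-correct (k ∷ ks) [] refl h = refl
      combine-correct (k ∷ ks) (a ∷ as) e (ha ∷ has) with scaleRow k a in e₁ | combine ks as in e₂
      combine-correct (k ∷ ks) (a ∷ as) refl (ha ∷ has) | just a′ | just a″ =
        addRow-correct a′ a″ (scaleRow-correct k a e₁ ha) (combine-correct ks as e₂ has)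

      absurdConstant-correct : ∀ r k → T (absurdConstant r k) → ¬ Holds r (fromInteger k)
      absurdConstant-correct eqᵣ -[1+ k ] _ h = <-irrefl (subst (_< 0#) h (fromInteger-negative k))
      absurdConstant-correct eqᵣ (+ suc k) _ h = <-irrefl (subst (0# <_) h (fromInteger-positive k))
      absurdConstant-correct leᵣ -[1+ k ] _ h = <-irrefl (<-≤-trans (fromInteger-negative k) h)
      absurdConstant-correct ltᵣ -[1+ k ] _ h = <-irrefl (<-≤-trans (fromInteger-negative k) (<⇒≤ h))
      absurdConstant-correct ltᵣ (+ 0) _ h = <-irrefl (subst (0# <_) fromInteger-0 h)

      absurdRow-correct : ∀ a → T (absurdRow a) → ¬ HoldsRow a
      absurdRow-correct (r , f) t h with constantTerm f in e
      ... | just k = absurdConstant-correct r k t (subst (Holds r) (constantTerm-correct f e) h)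

      refutes-correct : ∀ ks as → T (refutes ks as) → ¬ AllHold as
      refutes-correct ks as t h with combine ks as in e
      ... | just a = absurdRow-correct a t (combine-correct ks as e h)

      data AllTrue : List (Formula n) → Set where
        []  : AllTrue []
        _∷_ : ∀ {h hs} → ⟦ h ⟧ᶠ ρ → AllTrue hs → AllTrue (h ∷ hs)

      atom-≤ : ∀ e f → ⟦ e ⟧ ρ ≤ ⟦ f ⟧ ρ → HoldsRow (atom leᵣ e f)
      atom-≤ e f h = subst (0# ≤_) (sym (polynomial-correct (f ⊖ e))) (difference-≤ h)

      atom-< : ∀ e f → ⟦ e ⟧ ρ < ⟦ f ⟧ ρ → HoldsRow (atom ltᵣ e f)
      atom-< e f h = subst (0# <_) (sym (polynomial-correct (f ⊖ e))) (difference-< h)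

      atom-≡ : ∀ e f → ⟦ e ⟧ ρ ≡ ⟦ f ⟧ ρ → HoldsRow (atom eqᵣ e f)
      atom-≡ e f h = trans (polynomial-correct (f ⊖ e))
        (trans (cong (λ x → ⟦ f ⟧ ρ + - x) h) (-‿inverseʳ _))

      ∧-split : ∀ a {b} → T (a ∧ b) → T a × T b
      ∧-split true t = tt , t

      ∨-split : ∀ a {b} → T (a ∨ b) → T a ⊎ T b
      ∨-split true  t = inj₁ tt
      ∨-split false t = inj₂ t

      split-correct : ∀ {A : Set} g (k : List Row → Bool) as → T (split g k as) → ⟦ g ⟧ᶠ ρ → AllHold as →
        (∀ as → T (k as) → AllHold as → A) → A
      split-correct (e ≦ f) k as t h has κ = κ _ t (atom-≤ e f h ∷ has)
      split-correct (e ⋖ f) k as t h has κ = κ _ t (atom-< e f h ∷ has)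
      split-correct (e ≐ f) k as t h has κ = κ _ t (atom-≡ e f h ∷ has)
      split-correct (g ⩓ g′) k as t (h , h′) has κ = split-correct g (split g′ k) as t h has
        λ bs t′ hbs → split-correct g′ k bs t′ h′ hbs κ
      split-correct (g ⩔ g′) k as t (inj₁ h) has κ =
        split-correct g k as (proj₁ (∧-split (split g k as) t)) h has κ
      split-correct (g ⩔ g′) k as t (inj₂ h) has κ =
        split-correct g′ k as (proj₂ (∧-split (split g k as) t)) h has κ

      refutable-correct : ∀ as → T (refutable as) → ¬ AllHold as
      refutable-correct as = refutes-correct (certificate as) as

      follows-correct : ∀ g as → T (follows g as) → AllHold as → ⟦ g ⟧ᶠ ρ
      follows-correct (e ≦ f) as t has = ≮⇒≥ λ p → refutable-correct (atom ltᵣ f e ∷ as) t (atom-< f e p ∷ has)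
      follows-correct (e ⋖ f) as t has = ≰⇒> λ p → refutable-correct (atom leᵣ f e ∷ as) t (atom-≤ f e p ∷ has)
      follows-correct (e ≐ f) as t has
        with t₁ , t₂ ← ∧-split (refutable (atom ltᵣ f e ∷ as)) t = ≤-antisym
        (≮⇒≥ λ p → refutable-correct (atom ltᵣ f e ∷ as) t₁ (atom-< f e p ∷ has))
        (≮⇒≥ λ p → refutable-correct (atom ltᵣ e f ∷ as) t₂ (atom-< e f p ∷ has))
      follows-correct (g ⩓ h) as t has with t₁ , t₂ ← ∧-split (follows g as) t =
        follows-correct g as t₁ has , follows-correct h as t₂ has
      follows-correct (g ⩔ h) as t has with ∨-split (follows g as) t
      ... | inj₁ t₁ = inj₁ (follows-correct g as t₁ has)
      ... | inj₂ t₂ = inj₂ (follows-correct h as t₂ has)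
      follows-correct ff as t has = refutable-correct as t has

      provable-correct : ∀ hs g as → T (provable hs g as) → AllTrue hs → AllHold as → ⟦ g ⟧ᶠ ρ
      provable-correct [] g as t [] has = follows-correct g as t has
      provable-correct (h ∷ hs) g as t (p ∷ ps) has = split-correct h (provable hs g) as t p has
        λ bs t′ → provable-correct hs g bs t′ ps

      curryHypotheses : ∀ hs {A : Set} → (AllTrue hs → A) → hs ⇒[ ρ ] A
      curryHypotheses [] k = k []
      curryHypotheses (h ∷ hs) k p = curryHypotheses hs λ ps → k (p ∷ ps)

    ForAll : ∀ n → (Vec Carrier n → Set) → Set
    ForAll zero P = P []
    ForAll (suc n) P = ∀ x → ForAll n λ ρ → P (x ∷ ρ)

    forAll : ∀ n {P : Vec Carrier n → Set} → (∀ ρ → P ρ) → ForAll n P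
    forAll zero f = f []
    forAll (suc n) f = λ x → forAll n λ ρ → f (x ∷ ρ)

    close : ∀ n → N-ary n (Expr n) (Sequent n) → Sequent n
    close n f = f $ⁿ Vec.map var (allFin n)

    Valid : ∀ {n} → Sequent n → Set
    Valid (hs ⊢ g) = T (provable hs g [])

    abstract
      -- The unit-typed argument is filled by evaluation, so checking a use runs the search.
      -- Monomials of degree 2 or more are unknowns of their own to the elimination; whatever is to
      -- be known about a product is passed as a hypothesis on that product.
      lin : ∀ n (f : N-ary n (Expr n) (Sequent n)) {_ : Valid (close n f)} → ForAll n ⟦ close n f ⟧ˢ
      lin n f {t} = forAll n λ ρ → curryHypotheses ρ (Sequent.hypotheses (close n f))
        λ ps → provable-correct ρ (Sequent.hypotheses (close n f)) (Sequent.conclusion (close n f)) [] t ps []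

open LinearArithmetic using
  ( Expr; var; #_; _⊕_; _⊖_; _⊗_; ⊝_; Formula; _≦_; _⋖_; _≐_; _⩓_; _⩔_; ff; Sequent; _⊢_
  ; OrderedRing; module OrderedRing; module Linear )

-- The rationals and the integers as ordered rings

-- The same body as `Setup.fromℤ`, hence convertible with it, but free of the parameters `p`, `q`,
-- `σ`.
fromℤ : ℤ → ℚ
fromℤ z = z ℚ./ 1

toℚᵘ-fromℤ : ∀ k → ℚ.toℚᵘ (fromℤ k) ℚᵘ.≃ ℚᵘ.mkℚᵘ k 0
toℚᵘ-fromℤ k = ℚₚ.toℚᵘ-fromℚᵘ (ℚᵘ.mkℚᵘ k 0)

fromℤ-+ : ∀ k l → fromℤ (k ℤ.+ l) ≡ fromℤ k ℚ.+ fromℤ l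
fromℤ-+ k l = ℚₚ.toℚᵘ-injective $ begin
  ℚ.toℚᵘ (fromℤ (k ℤ.+ l))                    ≈⟨ toℚᵘ-fromℤ (k ℤ.+ l) ⟩
  ℚᵘ.mkℚᵘ (k ℤ.+ l) 0                         ≈⟨ ℚᵘ.*≡* (cong (ℤ._* + 1) (sym (cong₂ ℤ._+_ (ℤₚ.*-identityʳ k)
      (ℤₚ.*-identityʳ l)))) ⟩
  ℚᵘ.mkℚᵘ k 0 ℚᵘ.+ ℚᵘ.mkℚᵘ l 0                ≈⟨ ℚᵘₚ.+-cong (toℚᵘ-fromℤ k) (toℚᵘ-fromℤ l) ⟨
  ℚ.toℚᵘ (fromℤ k) ℚᵘ.+ ℚ.toℚᵘ (fromℤ l)      ≈⟨ ℚₚ.toℚᵘ-homo-+ (fromℤ k) (fromℤ l) ⟨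
  ℚ.toℚᵘ (fromℤ k ℚ.+ fromℤ l)                ∎
  where open ℚᵘₚ.≃-Reasoning

fromℤ-* : ∀ k l → fromℤ (k ℤ.* l) ≡ fromℤ k ℚ.* fromℤ l
fromℤ-* k l = ℚₚ.toℚᵘ-injective $ begin
  ℚ.toℚᵘ (fromℤ (k ℤ.* l))                    ≈⟨ toℚᵘ-fromℤ (k ℤ.* l) ⟩
  ℚᵘ.mkℚᵘ k 0 ℚᵘ.* ℚᵘ.mkℚᵘ l 0                ≈⟨ ℚᵘₚ.*-cong (toℚᵘ-fromℤ k) (toℚᵘ-fromℤ l) ⟨
  ℚ.toℚᵘ (fromℤ k) ℚᵘ.* ℚ.toℚᵘ (fromℤ l)      ≈⟨ ℚₚ.toℚᵘ-homo-* (fromℤ k) (fromℤ l) ⟨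
  ℚ.toℚᵘ (fromℤ k ℚ.* fromℤ l)                ∎
  where open ℚᵘₚ.≃-Reasoning

fromℤ-mono-< : ∀ {k l} → k ℤ.< l → fromℤ k ℚ.< fromℤ l
fromℤ-mono-< {k} {l} k<l = ℚₚ.toℚᵘ-cancel-< $ ℚᵘₚ.<-respˡ-≃ (ℚᵘₚ.≃-sym (toℚᵘ-fromℤ k)) $
  ℚᵘₚ.<-respʳ-≃ (ℚᵘₚ.≃-sym (toℚᵘ-fromℤ l)) $
  ℚᵘ.*<* (subst₂ ℤ._<_ (sym (ℤₚ.*-identityʳ k)) (sym (ℤₚ.*-identityʳ l)) k<l)

ℚ-orderedRing : OrderedRing
ℚ-orderedRing = record
  { Carrier = ℚ
  ; _+_ = ℚ._+_ ; _*_ = ℚ._*_ ; -_ = ℚ.-_ ; 0# = 0ℚ ; 1# = 1ℚ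
  ; isCommutativeRing = ℚₚ.+-*-isCommutativeRing
  ; _≤_ = ℚ._≤_ ; _<_ = ℚ._<_
  ; fromInteger = fromℤ
  ; fromInteger-0 = refl ; fromInteger-1 = refl
  ; fromInteger-+ = fromℤ-+ ; fromInteger-* = fromℤ-*
  ; fromInteger-negative = λ k → fromℤ-mono-< { -[1+ k ]} {+ 0} ℤ.-<+
  ; fromInteger-positive = λ k → fromℤ-mono-< {+ 0} {+ suc k} (ℤ.+<+ ℕ.z<s)
  ; <-irrefl = ℚₚ.<-irrefl refl
  ; ≤-refl = ℚₚ.≤-refl ; ≤-antisym = ℚₚ.≤-antisym ; <⇒≤ = ℚₚ.<⇒≤
  ; ≮⇒≥ = ℚₚ.≮⇒≥ ; ≰⇒> = ℚₚ.≰⇒>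
  ; <-≤-trans = ℚₚ.<-≤-trans ; ≤-trans = ℚₚ.≤-trans
  ; +-monoˡ-≤ = ℚₚ.+-monoˡ-≤ ; +-monoˡ-< = ℚₚ.+-monoˡ-<
  ; *-pos-pos = λ {x} {y} 0<x 0<y → subst (ℚ._< x ℚ.* y) (ℚₚ.*-zeroʳ x)
      (ℚₚ.*-monoʳ-<-pos x {{ℚ.positive 0<x}} 0<y)
  ; *-pos-nonNeg = λ {x} {y} 0<x 0≤y → subst (ℚ._≤ x ℚ.* y) (ℚₚ.*-zeroʳ x)
      (ℚₚ.*-monoˡ-≤-nonNeg x {{ℚ.nonNegative (ℚₚ.<⇒≤ 0<x)}} 0≤y)
  }

ℤ-orderedRing : OrderedRing
ℤ-orderedRing = record
  { Carrier = ℤ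
  ; _+_ = ℤ._+_ ; _*_ = ℤ._*_ ; -_ = ℤ.-_ ; 0# = + 0 ; 1# = + 1
  ; isCommutativeRing = ℤₚ.+-*-isCommutativeRing
  ; _≤_ = ℤ._≤_ ; _<_ = ℤ._<_
  ; fromInteger = λ k → k
  ; fromInteger-0 = refl ; fromInteger-1 = refl
  ; fromInteger-+ = λ k l → refl ; fromInteger-* = λ k l → refl
  ; fromInteger-negative = λ k → ℤ.-<+
  ; fromInteger-positive = λ k → ℤ.+<+ ℕ.z<s
  ; <-irrefl = ℤₚ.<-irrefl refl
  ; ≤-refl = ℤₚ.≤-refl ; ≤-antisym = ℤₚ.≤-antisym ; <⇒≤ = ℤₚ.<⇒≤
  ; ≮⇒≥ = ℤₚ.≮⇒≥ ; ≰⇒> = ℤₚ.≰⇒>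
  ; <-≤-trans = ℤₚ.<-≤-trans ; ≤-trans = ℤₚ.≤-trans
  ; +-monoˡ-≤ = ℤₚ.+-monoˡ-≤ ; +-monoˡ-< = ℤₚ.+-monoˡ-<
  ; *-pos-pos = λ {x} {y} 0<x 0<y → subst (ℤ._< x ℤ.* y) (ℤₚ.*-zeroʳ x)
      (ℤₚ.*-monoˡ-<-pos x {{ℤ.positive 0<x}} 0<y)
  ; *-pos-nonNeg = λ {x} {y} 0<x 0≤y → subst (ℤ._≤ x ℤ.* y) (ℤₚ.*-zeroʳ x)
      (ℤₚ.*-monoˡ-≤-nonNeg x {{ℤ.nonNegative (ℤₚ.<⇒≤ 0<x)}} 0≤y)
  }

open Linear ℚ-orderedRing public using () renaming (lin to linℚ)
open Linear ℤ-orderedRing public using () renaming (lin to linℤ)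

fromℤ-neg : ∀ k → fromℤ (ℤ.- k) ≡ ℚ.- fromℤ k
fromℤ-neg k = linℚ 3 (λ z x y → (z ≐ # 0 ∷ z ≐ x ⊕ y ∷ [] ⊢ y ≐ ⊝ x)) (fromℤ (k ℤ.+ ℤ.- k)) (fromℤ k) (fromℤ (ℤ.- k))
  (cong fromℤ (ℤₚ.+-inverseʳ k)) (fromℤ-+ k (ℤ.- k))

fromℤ-minus : ∀ k l → fromℤ (k ℤ.- l) ≡ fromℤ k ℚ.- fromℤ l
fromℤ-minus k l = trans (fromℤ-+ k (ℤ.- l)) (cong (fromℤ k ℚ.+_) (fromℤ-neg l))

fromℤ-mono-≤ : ∀ {k l} → k ℤ.≤ l → fromℤ k ℚ.≤ fromℤ l
fromℤ-mono-≤ {k} {l} k≤l with k ℤ.≟ l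
... | yes refl = ℚₚ.≤-refl
... | no k≢l   = ℚₚ.<⇒≤ (fromℤ-mono-< (ℤₚ.≤∧≢⇒< k≤l k≢l))

fromℤ-cancel-< : ∀ {k l} → fromℤ k ℚ.< fromℤ l → k ℤ.< l
fromℤ-cancel-< k<l = ℤₚ.≰⇒> λ l≤k → ℚₚ.<-irrefl refl (ℚₚ.<-≤-trans k<l (fromℤ-mono-≤ l≤k))

fromℤ-cancel-≤ : ∀ {k l} → fromℤ k ℚ.≤ fromℤ l → k ℤ.≤ l
fromℤ-cancel-≤ k≤l = ℤₚ.≮⇒≥ λ l<k → ℚₚ.<-irrefl refl (ℚₚ.<-≤-trans (fromℤ-mono-< l<k) k≤l)

fromℤ-injective : ∀ {k l} → fromℤ k ≡ fromℤ l → k ≡ l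
fromℤ-injective eq = ℤₚ.≤-antisym (fromℤ-cancel-≤ (ℚₚ.≤-reflexive eq)) (fromℤ-cancel-≤ (ℚₚ.≤-reflexive (sym eq)))

*-nonNeg : ∀ {x y} → 0ℚ ℚ.≤ x → 0ℚ ℚ.≤ y → 0ℚ ℚ.≤ x ℚ.* y
*-nonNeg {x} {y} 0≤x 0≤y = subst (ℚ._≤ x ℚ.* y) (ℚₚ.*-zeroʳ x)
      (ℚₚ.*-monoˡ-≤-nonNeg x {{ℚ.nonNegative 0≤x}} 0≤y)

*-pos : ∀ {x y} → 0ℚ ℚ.< x → 0ℚ ℚ.< y → 0ℚ ℚ.< x ℚ.* y
*-pos = OrderedRing.*-pos-pos ℚ-orderedRing

abstract
  reciprocal : ∀ {x} → 0ℚ ℚ.< x → Σ ℚ λ r → 0ℚ ℚ.< r × x ℚ.* r ≡ 1ℚ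
  reciprocal {x} 0<x = ℚ.1/ x , ℚₚ.positive⁻¹ (ℚ.1/ x) {{ℚₚ.1/pos⇒pos x}} , ℚₚ.*-inverseʳ x
    where instance
      x-positive : ℚ.Positive x
      x-positive = ℚ.positive 0<x
      x-nonZero : ℚ.NonZero x
      x-nonZero = ℚₚ.pos⇒nonZero x

cancel-zero : ∀ {x y} → 0ℚ ℚ.< x → x ℚ.* y ≡ 0ℚ → y ≡ 0ℚ
cancel-zero {x} {y} 0<x xy≡0 with ℚₚ.<-cmp y 0ℚ
... | tri< y<0 _ _ = ⊥-elim (linℚ 2 (λ x y → (# 0 ⋖ x ⊗ ⊝ y ∷ x ⊗ y ≐ # 0 ∷ [] ⊢ ff)) x y
        (*-pos 0<x (linℚ 1 (λ y → (y ⋖ # 0 ∷ [] ⊢ # 0 ⋖ ⊝ y)) y y<0)) xy≡0)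

... | tri≈ _ y≡0 _ = y≡0
... | tri> _ _ y>0 = ⊥-elim (linℚ 2 (λ x y → (# 0 ⋖ x ⊗ y ∷ x ⊗ y ≐ # 0 ∷ [] ⊢ ff)) x y (*-pos 0<x y>0) xy≡0)

-- Coordinates adapted to the lattice basis 1, ω

sgnℤ : Sign → ℤ
sgnℤ Sign.+ = + 1
sgnℤ Sign.- = -[1+ 0 ]

sgnℤ-involutive : ∀ σ m → sgnℤ σ ℤ.* (sgnℤ σ ℤ.* m) ≡ m
sgnℤ-involutive Sign.+ = linℤ 1 (λ m → ([] ⊢ # 1 ⊗ (# 1 ⊗ m) ≐ m))
sgnℤ-involutive Sign.- = linℤ 1 (λ m → ([] ⊢ ⊝ # 1 ⊗ (⊝ # 1 ⊗ m) ≐ m))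

IsUnit : ℚ → Set
IsUnit s = s ≡ 1ℚ ⊎ s ≡ ℚ.- 1ℚ

-- The point a + bτ is described by α = 2⟨u,1⟩ and β = 2⟨u,ω⟩ where ω = sτ - h and ⟨_,_⟩ is the
-- bilinear form with ⟨u,u⟩ = |u|².
module Syntax {n : ℕ} (s h e c : Expr n) where
  p′ q′ Δ′ : Expr n
  p′ = s ⊗ (# 2 ⊗ h ⊕ e)
  q′ = c ⊕ h ⊗ h ⊕ e ⊗ h
  Δ′ = # 4 ⊗ c ⊖ e ⊗ e

  α′ β′ norm′ : Expr n → Expr n → Expr n
  α′ a b = a ⊕ a ⊕ p′ ⊗ b
  β′ a b = e ⊗ a ⊕ (q′ ⊗ s ⊕ q′ ⊗ s ⊖ p′ ⊗ h) ⊗ b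
  norm′ a b = a ⊗ a ⊕ p′ ⊗ (a ⊗ b) ⊕ q′ ⊗ (b ⊗ b)

  -- the norm of i + jω
  form′ i′ : Expr n → Expr n → Expr n
  form′ i j = i ⊗ i ⊕ e ⊗ (i ⊗ j) ⊕ c ⊗ (j ⊗ j)
  i′ a b = a ⊕ h ⊗ (s ⊗ b)

  j′ : Expr n → Expr n
  j′ b = s ⊗ b

  -- |u - y|² = |u|² + |y|² - 2⟨u,y⟩ for the lattice point y = i + jω.
  normDifference : Expr n → Expr n → Expr n → Expr n → Formula n
  normDifference a b l m = norm′ (a ⊖ l) (b ⊖ m) ≐ norm′ a b ⊕ (form′ (i′ l m) (j′ m) ⊖ (i′ l m ⊗ α′ a b ⊕
      j′ m ⊗ β′ a b))
  -- (α, β) is the image of the coordinates along 1, ω under the Gram matrix with rows (2, e) and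
  -- (e, 2c), of determinant Δ. This formula, `norm-αβ`, `height`, `inverse-α` and `inverse-β` are
  -- the consequences of that and of Cramer's rule.
  det-αβ : Expr n → Expr n → Expr n → Expr n → Formula n
  det-αβ a b l m = Δ′ ⊗ (s ⊗ (a ⊗ m ⊖ b ⊗ l)) ≐ α′ a b ⊗ β′ l m ⊖ β′ a b ⊗ α′ l m
  lattice-α : Expr n → Expr n → Formula n
  lattice-α l m = α′ l m ≐ # 2 ⊗ i′ l m ⊕ e ⊗ j′ m
  lattice-β : Expr n → Expr n → Formula n
  lattice-β l m = β′ l m ≐ e ⊗ i′ l m ⊕ # 2 ⊗ c ⊗ j′ m
  norm-αβ : Expr n → Expr n → Formula n
  norm-αβ a b = Δ′ ⊗ norm′ a b ≐ c ⊗ (α′ a b ⊗ α′ a b) ⊖ e ⊗ (α′ a b ⊗ β′ a b) ⊕ β′ a b ⊗ β′ a b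
  height : Expr n → Expr n → Formula n
  height a b = Δ′ ⊗ (s ⊗ b) ≐ # 2 ⊗ β′ a b ⊖ e ⊗ α′ a b
  det-ij : Expr n → Expr n → Expr n → Expr n → Formula n
  det-ij a b l m = s ⊗ (a ⊗ m ⊖ b ⊗ l) ≐ i′ a b ⊗ j′ m ⊖ j′ b ⊗ i′ l m

  discriminant : Formula n
  discriminant = Δ′ ≐ # 4 ⊗ q′ ⊖ p′ ⊗ p′

  inverse-α inverse-β : Expr n → Expr n → Expr n → Formula n
  inverse-α A B r = α′ ((# 2 ⊗ c ⊗ A ⊖ e ⊗ B) ⊗ r ⊖ h ⊗ ((# 2 ⊗ B ⊖ e ⊗ A) ⊗ r))
      (s ⊗ ((# 2 ⊗ B ⊖ e ⊗ A) ⊗ r)) ≐ Δ′ ⊗ r ⊗ A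
  inverse-β A B r = β′ ((# 2 ⊗ c ⊗ A ⊖ e ⊗ B) ⊗ r ⊖ h ⊗ ((# 2 ⊗ B ⊖ e ⊗ A) ⊗ r))
      (s ⊗ ((# 2 ⊗ B ⊖ e ⊗ A) ⊗ r)) ≐ Δ′ ⊗ r ⊗ B

module Coordinates (s p q h e c : ℚ) where

  open import Data.Rational using (_+_; _*_; _-_; -_)

  α β norm i form : ℚ → ℚ → ℚ
  α a b = a + a + p * b
  β a b = e * a + (q * s + q * s - p * h) * b
  norm a b = a * a + p * (a * b) + q * (b * b)
  i a b = a + h * (s * b)
  form x y = x * x + e * (x * y) + c * (y * y)

  Δ : ℚ
  Δ = fromℤ (+ 4) * c - e * e

module Identities (s p q h e c : ℚ) where

  open import Data.Rational using (_+_; _*_; _-_; -_)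
  open Coordinates s p q h e c

  -- s² = 1 is not known to the polynomial normaliser, so every identity is proved for s = 1 and for
  -- s = -1; once p and q are substituted it is an identity of polynomials in the remaining
  -- variables.
  Parametrised : Set
  Parametrised = IsUnit s × p ≡ s * (fromℤ (+ 2) * h + e) × q ≡ c + h * h + e * h

  normDifference : Parametrised → ∀ a b l m → norm (a - l) (b - m) ≡ norm a b + (form (i l m) (s * m) -
      (i l m * α a b + (s * m) * β a b))
  normDifference (inj₁ refl , refl , refl) = linℚ 7 (λ h e c a b l m → ([] ⊢ Syntax.normDifference
      (# 1) h e c a b l m)) h e c
  normDifference (inj₂ refl , refl , refl) = linℚ 7 (λ h e c a b l m → ([] ⊢ Syntax.normDifference
      (⊝ # 1) h e c a b l m)) h e c

  det-αβ : Parametrised → ∀ a b l m → Δ * (s * (a * m - b * l)) ≡ α a b * β l m - β a b * α l m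
  det-αβ (inj₁ refl , refl , refl) = linℚ 7 (λ h e c a b l m → ([] ⊢ Syntax.det-αβ (# 1) h e c a b l m)) h e c
  det-αβ (inj₂ refl , refl , refl) = linℚ 7 (λ h e c a b l m → ([] ⊢ Syntax.det-αβ (⊝ # 1) h e c a b l m)) h e c

  lattice-α : Parametrised → ∀ l m → α l m ≡ fromℤ (+ 2) * i l m + e * (s * m)
  lattice-α (inj₁ refl , refl , refl) = linℚ 5 (λ h e c l m → ([] ⊢ Syntax.lattice-α (# 1) h e c l m)) h e c
  lattice-α (inj₂ refl , refl , refl) = linℚ 5 (λ h e c l m → ([] ⊢ Syntax.lattice-α (⊝ # 1) h e c l m)) h e c

  lattice-β : Parametrised → ∀ l m → β l m ≡ e * i l m + fromℤ (+ 2) * c * (s * m)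
  lattice-β (inj₁ refl , refl , refl) = linℚ 5 (λ h e c l m → ([] ⊢ Syntax.lattice-β (# 1) h e c l m)) h e c
  lattice-β (inj₂ refl , refl , refl) = linℚ 5 (λ h e c l m → ([] ⊢ Syntax.lattice-β (⊝ # 1) h e c l m)) h e c

  norm-αβ : Parametrised → ∀ a b → Δ * norm a b ≡ c * (α a b * α a b) - e * (α a b * β a b) + β a b * β a b
  norm-αβ (inj₁ refl , refl , refl) = linℚ 5 (λ h e c a b → ([] ⊢ Syntax.norm-αβ (# 1) h e c a b)) h e c
  norm-αβ (inj₂ refl , refl , refl) = linℚ 5 (λ h e c a b → ([] ⊢ Syntax.norm-αβ (⊝ # 1) h e c a b)) h e c

  height : Parametrised → ∀ a b → Δ * (s * b) ≡ fromℤ (+ 2) * β a b - e * α a b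
  height (inj₁ refl , refl , refl) = linℚ 5 (λ h e c a b → ([] ⊢ Syntax.height (# 1) h e c a b)) h e c
  height (inj₂ refl , refl , refl) = linℚ 5 (λ h e c a b → ([] ⊢ Syntax.height (⊝ # 1) h e c a b)) h e c

  det-ij : Parametrised → ∀ a b l m → s * (a * m - b * l) ≡ i a b * (s * m) - (s * b) * i l m
  det-ij (inj₁ refl , refl , refl) = linℚ 7 (λ h e c a b l m → ([] ⊢ Syntax.det-ij (# 1) h e c a b l m)) h e c
  det-ij (inj₂ refl , refl , refl) = linℚ 7 (λ h e c a b l m → ([] ⊢ Syntax.det-ij (⊝ # 1) h e c a b l m)) h e c

  discriminant : Parametrised → Δ ≡ fromℤ (+ 4) * q - p * p
  discriminant (inj₁ refl , refl , refl) = linℚ 3 (λ h e c → ([] ⊢ Syntax.discriminant (# 1) h e c)) h e c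
  discriminant (inj₂ refl , refl , refl) = linℚ 3 (λ h e c → ([] ⊢ Syntax.discriminant (⊝ # 1) h e c)) h e c

  inverse-α : Parametrised → ∀ A B r → let y = (fromℤ (+ 2) * B - e * A) * r in
    α ((fromℤ (+ 2) * c * A - e * B) * r - h * y) (s * y) ≡ Δ * r * A
  inverse-α (inj₁ refl , refl , refl) = linℚ 6 (λ h e c A B r → ([] ⊢ Syntax.inverse-α (# 1) h e c A B r)) h e c
  inverse-α (inj₂ refl , refl , refl) = linℚ 6 (λ h e c A B r → ([] ⊢ Syntax.inverse-α (⊝ # 1) h e c A B r)) h e c

  inverse-β : Parametrised → ∀ A B r → let y = (fromℤ (+ 2) * B - e * A) * r in
    β ((fromℤ (+ 2) * c * A - e * B) * r - h * y) (s * y) ≡ Δ * r * B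
  inverse-β (inj₁ refl , refl , refl) = linℚ 6 (λ h e c A B r → ([] ⊢ Syntax.inverse-β (# 1) h e c A B r)) h e c
  inverse-β (inj₂ refl , refl , refl) = linℚ 6 (λ h e c A B r → ([] ⊢ Syntax.inverse-β (⊝ # 1) h e c A B r)) h e c

-- For ω = sτ - h the two equations say that 2 Re ω = e and |ω|² = c.
module Frame (p q : ℤ) (σ : Sign) (h : ℤ) (e : ℕ) (c : ℤ)
  (sp≡2h+e : sgnℤ σ ℤ.* p ≡ + 2 ℤ.* h ℤ.+ + e) (q≡ : q ≡ c ℤ.+ h ℤ.* h ℤ.+ + e ℤ.* h) where

  open Setup p q σ hiding (fromℤ)
  open import Data.Rational using (_+_; _*_; _-_; -_; _≤_; _<_)

  s hQ eQ cQ Δ : ℚ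
  s  = sgnℚ σ
  hQ = fromℤ h
  eQ = fromℤ (+ e)
  cQ = fromℤ c
  Δ  = fromℤ (+ 4) * cQ - eQ * eQ

  s-unit : IsUnit s
  s-unit = sgnℚ-unit σ
    where
    sgnℚ-unit : ∀ σ′ → IsUnit (sgnℚ σ′)
    sgnℚ-unit Sign.+ = inj₁ refl
    sgnℚ-unit Sign.- = inj₂ refl

  s≡ : s ≡ fromℤ (sgnℤ σ)
  s≡ = sgnℚ≡ σ
    where
    sgnℚ≡ : ∀ σ′ → sgnℚ σ′ ≡ fromℤ (sgnℤ σ′)
    sgnℚ≡ Sign.+ = refl
    sgnℚ≡ Sign.- = refl

  pQ≡ : pQ ≡ s * (fromℤ (+ 2) * hQ + eQ)
  pQ≡ = solve s-unit s*pQ≡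
    where
    s*pQ≡ : s * pQ ≡ fromℤ (+ 2) * hQ + eQ
    s*pQ≡ = begin
      s * pQ                              ≡⟨ cong (_* pQ) s≡ ⟩
      fromℤ (sgnℤ σ) * pQ                 ≡⟨ fromℤ-* (sgnℤ σ) p ⟨
      fromℤ (sgnℤ σ ℤ.* p)                ≡⟨ cong fromℤ sp≡2h+e ⟩
      fromℤ (+ 2 ℤ.* h ℤ.+ + e)           ≡⟨ fromℤ-+ (+ 2 ℤ.* h) (+ e) ⟩
      fromℤ (+ 2 ℤ.* h) + eQ              ≡⟨ cong (_+ eQ) (fromℤ-* (+ 2) h) ⟩
      fromℤ (+ 2) * hQ + eQ               ∎
      where open ≡-Reasoning
    solve : ∀ {s p x} → IsUnit s → s * p ≡ x → p ≡ s * x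
    solve {p = p} {x} (inj₁ refl) = linℚ 2 (λ p x → (# 1 ⊗ p ≐ x ∷ [] ⊢ p ≐ # 1 ⊗ x)) p x
    solve {p = p} {x} (inj₂ refl) = linℚ 2 (λ p x → (⊝ # 1 ⊗ p ≐ x ∷ [] ⊢ p ≐ ⊝ # 1 ⊗ x)) p x

  qQ≡ : qQ ≡ cQ + hQ * hQ + eQ * hQ
  qQ≡ = begin
    fromℤ q                                      ≡⟨ cong fromℤ q≡ ⟩
    fromℤ (c ℤ.+ h ℤ.* h ℤ.+ + e ℤ.* h)          ≡⟨ fromℤ-+ (c ℤ.+ h ℤ.* h) (+ e ℤ.* h) ⟩
    fromℤ (c ℤ.+ h ℤ.* h) + fromℤ (+ e ℤ.* h)
      ≡⟨ cong₂ _+_ (trans (fromℤ-+ c (h ℤ.* h)) (cong (λ x → cQ + x) (fromℤ-* h h))) (fromℤ-* (+ e) h) ⟩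
    cQ + hQ * hQ + eQ * hQ                       ∎
    where open ≡-Reasoning

  α β : QT → ℚ
  α (a , b) = a + a + pQ * b
  β (a , b) = eQ * a + (qQ * s + qQ * s - pQ * hQ) * b

  form : ℚ → ℚ → ℚ
  form i j = i * i + eQ * (i * j) + cQ * (j * j)

  -- Coordinates along 1, ω; as s² = 1, one has τ = s(ω + h).
  iZ jZ : ZT → ℤ
  jZ (l , m) = sgnℤ σ ℤ.* m
  iZ (l , m) = l ℤ.+ h ℤ.* (sgnℤ σ ℤ.* m)

  fromIJ : ℤ → ℤ → ZT
  fromIJ i j = (i ℤ.- h ℤ.* j , sgnℤ σ ℤ.* j)

  iQ jQ : ZT → ℚ
  iQ y = fromℤ (iZ y)
  jQ y = fromℤ (jZ y)

  private
    jQ≡ : ∀ y → jQ y ≡ s * fromℤ (proj₂ y)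
    jQ≡ (l , m) = trans (fromℤ-* (sgnℤ σ) m) (cong (_* fromℤ m) (sym s≡))

    iQ≡ : ∀ y → iQ y ≡ fromℤ (proj₁ y) + hQ * (s * fromℤ (proj₂ y))
    iQ≡ y@(l , m) = trans (fromℤ-+ l (h ℤ.* (sgnℤ σ ℤ.* m)))
      (cong (λ x → fromℤ l + x) (trans (fromℤ-* h (sgnℤ σ ℤ.* m)) (cong (hQ *_) (jQ≡ y))))

    sgn² : ∀ m → sgnℤ σ ℤ.* (sgnℤ σ ℤ.* m) ≡ m
    sgn² m = sgnℤ-involutive σ m

  fromIJ-i : ∀ i j → iZ (fromIJ i j) ≡ i
  fromIJ-i i j = trans (cong (λ x → i ℤ.- h ℤ.* j ℤ.+ h ℤ.* x) (sgn² j))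
    (linℤ 3 (λ i h j → ([] ⊢ i ⊖ h ⊗ j ⊕ h ⊗ j ≐ i)) i h j)

  fromIJ-j : ∀ i j → jZ (fromIJ i j) ≡ j
  fromIJ-j i j = sgn² j

  fromIJ-iZ-jZ : ∀ y → fromIJ (iZ y) (jZ y) ≡ y
  fromIJ-iZ-jZ (l , m) = cong₂ _,_
    (linℤ 3 (λ l h j → ([] ⊢ l ⊕ h ⊗ j ⊖ h ⊗ j ≐ l)) l h (sgnℤ σ ℤ.* m)) (sgn² m)

  jZ-0 : jZ 0Z ≡ + 0
  jZ-0 = ℤₚ.*-zeroʳ (sgnℤ σ)

  iZ-0 : iZ 0Z ≡ + 0
  iZ-0 = linℤ 2 (λ h s → ([] ⊢ # 0 ⊕ h ⊗ (s ⊗ # 0) ≐ # 0)) h (sgnℤ σ)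

  fromIJ-0 : fromIJ (+ 0) (+ 0) ≡ 0Z
  fromIJ-0 = cong₂ _,_ (linℤ 1 (λ h → ([] ⊢ # 0 ⊖ h ⊗ # 0 ≐ # 0)) h) (ℤₚ.*-zeroʳ (sgnℤ σ))

  α-+ : ∀ u v → α (u +Q v) ≡ α u + α v
  α-+ (a , b) (l , m) = linℚ 5 (λ p a b l m → ([] ⊢
    (a ⊕ l) ⊕ (a ⊕ l) ⊕ p ⊗ (b ⊕ m) ≐ a ⊕ a ⊕ p ⊗ b ⊕ (l ⊕ l ⊕ p ⊗ m))) pQ a b l m

  β-+ : ∀ u v → β (u +Q v) ≡ β u + β v
  β-+ (a , b) (l , m) = linℚ 6 (λ e k a b l m → ([] ⊢
    e ⊗ (a ⊕ l) ⊕ k ⊗ (b ⊕ m) ≐ e ⊗ a ⊕ k ⊗ b ⊕ (e ⊗ l ⊕ k ⊗ m))) eQ (qQ * s + qQ * s - pQ * hQ) a b l m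

  α-minus : ∀ u v → α (u -Q v) ≡ α u - α v
  α-minus (a , b) (l , m) = linℚ 5 (λ p a b l m → ([] ⊢
    (a ⊖ l) ⊕ (a ⊖ l) ⊕ p ⊗ (b ⊖ m) ≐ a ⊕ a ⊕ p ⊗ b ⊖ (l ⊕ l ⊕ p ⊗ m))) pQ a b l m

  β-minus : ∀ u v → β (u -Q v) ≡ β u - β v
  β-minus (a , b) (l , m) = linℚ 6 (λ e k a b l m → ([] ⊢
    e ⊗ (a ⊖ l) ⊕ k ⊗ (b ⊖ m) ≐ e ⊗ a ⊕ k ⊗ b ⊖ (e ⊗ l ⊕ k ⊗ m))) eQ (qQ * s + qQ * s - pQ * hQ) a b l m

  α-· : ∀ t u → α (t ·Q u) ≡ t * α u
  α-· t (a , b) = linℚ 4 (λ p t a b → ([] ⊢ t ⊗ a ⊕ t ⊗ a ⊕ p ⊗ (t ⊗ b) ≐ t ⊗ (a ⊕ a ⊕ p ⊗ b))) pQ t a b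

  β-· : ∀ t u → β (t ·Q u) ≡ t * β u
  β-· t (a , b) = linℚ 5 (λ e k t a b → ([] ⊢ e ⊗ (t ⊗ a) ⊕ k ⊗ (t ⊗ b) ≐ t ⊗ (e ⊗ a ⊕ k ⊗ b)))
    eQ (qQ * s + qQ * s - pQ * hQ) t a b

  open Identities s pQ qQ hQ eQ cQ

  parametrised : Parametrised
  parametrised = s-unit , pQ≡ , qQ≡

  normQ-minus : ∀ z y → normQ (z -Q embed y) ≡ normQ z + (form (iQ y) (jQ y) - (iQ y * α z + jQ y * β z))
  normQ-minus z@(a , b) y@(l , m) =
    subst₂ (λ i j → normQ (z -Q embed y) ≡ normQ z + (form i j - (i * α z + j * β z)))
      (sym (iQ≡ y)) (sym (jQ≡ y)) (normDifference parametrised a b (fromℤ l) (fromℤ m))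

  α-embed : ∀ y → α (embed y) ≡ fromℤ (+ 2) * iQ y + eQ * jQ y
  α-embed y@(l , m) = subst₂ (λ i j → α (embed y) ≡ fromℤ (+ 2) * i + eQ * j) (sym (iQ≡ y)) (sym (jQ≡ y))
    (lattice-α parametrised (fromℤ l) (fromℤ m))

  β-embed : ∀ y → β (embed y) ≡ eQ * iQ y + fromℤ (+ 2) * cQ * jQ y
  β-embed y@(l , m) = subst₂ (λ i j → β (embed y) ≡ eQ * i + fromℤ (+ 2) * cQ * j) (sym (iQ≡ y)) (sym (jQ≡ y))
    (lattice-β parametrised (fromℤ l) (fromℤ m))

  detQ-embed : ∀ y y′ → s * detQ (embed y) (embed y′) ≡ iQ y * jQ y′ - jQ y * iQ y′
  detQ-embed y@(l , m) y′@(l′ , m′)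
    rewrite iQ≡ y | jQ≡ y | iQ≡ y′ | jQ≡ y′ = det-ij parametrised (fromℤ l) (fromℤ m) (fromℤ l′) (fromℤ m′)

  normQ-αβ : ∀ z → Δ * normQ z ≡ cQ * (α z * α z) - eQ * (α z * β z) + β z * β z
  normQ-αβ (a , b) = norm-αβ parametrised a b

  Δ*height : ∀ z → Δ * (s * proj₂ z) ≡ fromℤ (+ 2) * β z - eQ * α z
  Δ*height (a , b) = height parametrised a b

  Δ*detQ : ∀ u v → Δ * (s * detQ u v) ≡ α u * β v - β u * α v
  Δ*detQ (a , b) (l , m) = det-αβ parametrised a b l m

  α-translate : ∀ z y → α (z -Q embed y) ≡ α z - (fromℤ (+ 2) * iQ y + eQ * jQ y)
  α-translate z y = trans (α-minus z (embed y)) (cong (λ x → α z - x) (α-embed y))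

  β-translate : ∀ z y → β (z -Q embed y) ≡ β z - (eQ * iQ y + fromℤ (+ 2) * cQ * jQ y)
  β-translate z y = trans (β-minus z (embed y)) (cong (λ x → β z - x) (β-embed y))

  Δ≡4q-p² : Δ ≡ fromℤ (+ 4) * qQ - pQ * pQ
  Δ≡4q-p² = discriminant parametrised

  Slack≥0 Slack>0 Tight : QT → ℤ → ℤ → Set
  Slack≥0 z i j = fromℤ i * α z + fromℤ j * β z ≤ form (fromℤ i) (fromℤ j)
  Slack>0 z i j = fromℤ i * α z + fromℤ j * β z < form (fromℤ i) (fromℤ j)
  Tight z i j = fromℤ i * α z + fromℤ j * β z ≡ form (fromℤ i) (fromℤ j)

  private

    atIJ : (P : ℤ → ℤ → Set) → ∀ i j → P (iZ (fromIJ i j)) (jZ (fromIJ i j)) → P i j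
    atIJ P i j = subst₂ P (fromIJ-i i j) (fromIJ-j i j)

  InV-elim : ∀ z → InV z → ∀ i j → Slack≥0 z i j
  InV-elim z inV i j = atIJ (Slack≥0 z) i j
    (linℚ 4 (λ n n′ f x → (n ≦ n′ ∷ n′ ≐ n ⊕ (f ⊖ x) ∷ [] ⊢ x ≦ f)) _ _ _ _ (inV (fromIJ i j)) (normQ-minus z
        (fromIJ i j)))

  InV-intro : ∀ z → (∀ i j → Slack≥0 z i j) → InV z
  InV-intro z slack y = linℚ 4 (λ n n′ f x → (x ≦ f ∷ n′ ≐ n ⊕ (f ⊖ x) ∷ [] ⊢ n ≦ n′)) _ _ _ _
    (slack (iZ y) (jZ y)) (normQ-minus z y)

  InteriorV-elim : ∀ z → InteriorV z → ∀ i j → ¬ (i ≡ + 0 × j ≡ + 0) → Slack>0 z i j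
  InteriorV-elim z int i j ij≢0 = atIJ (Slack>0 z) i j
    (linℚ 4 (λ n n′ f x → (n ⋖ n′ ∷ n′ ≐ n ⊕ (f ⊖ x) ∷ [] ⊢ x ⋖ f)) _ _ _ _
      (int (fromIJ i j) λ y≡0 → ij≢0 (zero-ij y≡0)) (normQ-minus z (fromIJ i j)))
    where
    zero-ij : fromIJ i j ≡ 0Z → i ≡ + 0 × j ≡ + 0
    zero-ij y≡0 = trans (sym (fromIJ-i i j)) (trans (cong iZ y≡0) iZ-0) ,
                  trans (sym (fromIJ-j i j)) (trans (cong jZ y≡0) jZ-0)

  InteriorV-intro : ∀ z → (∀ i j → ¬ (i ≡ + 0 × j ≡ + 0) → Slack>0 z i j) → InteriorV z
  InteriorV-intro z slack y y≢0 = linℚ 4 (λ n n′ f x → (x ⋖ f ∷ n′ ≐ n ⊕ (f ⊖ x) ∷ [] ⊢ n ⋖ n′)) _ _ _ _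
    (slack (iZ y) (jZ y) (λ ij≡0 → y≢0 (nonzero ij≡0))) (normQ-minus z y)
    where
    nonzero : iZ y ≡ + 0 × jZ y ≡ + 0 → y ≡ 0Z
    nonzero (i≡0 , j≡0) = trans (sym (fromIJ-iZ-jZ y)) (trans (cong₂ fromIJ i≡0 j≡0) fromIJ-0)

  Tight-elim : ∀ z y → normQ z ≡ normQ (z -Q embed y) → Tight z (iZ y) (jZ y)
  Tight-elim z y tight = linℚ 4 (λ n n′ f x → (n ≐ n′ ∷ n′ ≐ n ⊕ (f ⊖ x) ∷ [] ⊢ x ≐ f)) _ _ _ _ tight
      (normQ-minus z y)

  Tight-intro : ∀ z i j → Tight z i j → normQ z ≡ normQ (z -Q embed (fromIJ i j))
  Tight-intro z i j tight = linℚ 4 (λ n n′ f x → (x ≐ f ∷ n′ ≐ n ⊕ (f ⊖ x) ∷ [] ⊢ n ≐ n′)) _ _ _ _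
    (subst₂ (Tight z) (sym (fromIJ-i i j)) (sym (fromIJ-j i j)) tight) (normQ-minus z (fromIJ i j))

  embed-+ : ∀ y y′ → embed (y +Z y′) ≡ embed y +Q embed y′
  embed-+ (a , b) (l , m) = cong₂ _,_ (fromℤ-+ a l) (fromℤ-+ b m)

  minus-+Q : ∀ z u v → z -Q (u +Q v) ≡ (z -Q u) -Q v
  minus-+Q (a , b) (l , m) (l′ , m′) = cong₂ _,_ (minus a l l′) (minus b m m′)
    where
    minus : ∀ x y z → x - (y + z) ≡ (x - y) - z
    minus = linℚ 3 (λ x y z → ([] ⊢ x ⊖ (y ⊕ z) ≐ x ⊖ y ⊖ z))

  -- |z - y| = |z| ≤ |z - (y + y′)| = |(z - y) - y′|. So a tying y has both z and z - y in the cell,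
  -- which is what restricts y to a few vectors.
  InV-translate : ∀ z y → InV z → normQ z ≡ normQ (z -Q embed y) → InV (z -Q embed y)
  InV-translate z y inV tight y′ = subst₂ _≤_ tight
    (cong normQ (trans (cong (z -Q_) (embed-+ y y′)) (minus-+Q z (embed y) (embed y′)))) (inV (y +Z y′))

  module _ (Δ>0 : 0ℚ < Δ) where

    -- `Δ*height` recovers the second component from (α, β), and then α recovers the first.
    αβ-injective : ∀ u v → α u ≡ α v → β u ≡ β v → u ≡ v
    αβ-injective u@(a , b) v@(l , m) αu≡αv βu≡βv = cong₂ _,_ a≡l b≡m
      where
      unsign : ∀ {s} → IsUnit s → s * (b - m) ≡ 0ℚ → b ≡ m
      unsign (inj₁ refl) = linℚ 2 (λ b m → (# 1 ⊗ (b ⊖ m) ≐ # 0 ∷ [] ⊢ b ≐ m)) b m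
      unsign (inj₂ refl) = linℚ 2 (λ b m → (⊝ # 1 ⊗ (b ⊖ m) ≐ # 0 ∷ [] ⊢ b ≐ m)) b m
      b≡m : b ≡ m
      b≡m = unsign s-unit (cancel-zero Δ>0 (linℚ 6
        (λ d s b m x y → (d ⊗ (s ⊗ b) ≐ x ∷ d ⊗ (s ⊗ m) ≐ y ∷ x ≐ y ∷ [] ⊢ d ⊗ (s ⊗ (b ⊖ m)) ≐ # 0))
        Δ s b m _ _ (Δ*height u) (Δ*height v) (cong₂ (λ x y → fromℤ (+ 2) * x - eQ * y) βu≡βv αu≡αv)))
      a≡l : a ≡ l
      a≡l = linℚ 4 (λ a l x y → (a ⊕ a ⊕ x ≐ l ⊕ l ⊕ y ∷ x ≐ y ∷ [] ⊢ a ≐ l)) a l _ _ αu≡αv (cong (pQ *_) b≡m)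

    abstract
      -- Cramer's rule with `r` = 1/Δ gives the coordinates along 1, ω, which are carried to the
      -- basis 1, τ as in `fromIJ`.
      point : ∀ A B → Σ QT λ z → α z ≡ A × β z ≡ B
      point A B with r , _ , Δr≡1 ← reciprocal Δ>0 =
        ((fromℤ (+ 2) * cQ * A - eQ * B) * r - hQ * ((fromℤ (+ 2) * B - eQ * A) * r) , s *
            ((fromℤ (+ 2) * B - eQ * A) * r)) ,
        trans (inverse-α parametrised A B r) (trans (cong (_* A) Δr≡1) (ℚₚ.*-identityˡ A)) ,
        trans (inverse-β parametrised A B r) (trans (cong (_* B) Δr≡1) (ℚₚ.*-identityˡ B))

-- The Voronoi cell in the coordinates α, β

module PlaneGeometry where

  open import Data.Rational using (_+_; _*_; _-_; -_; _≤_; _<_)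

  positive-integer : ∀ {m} → + 0 ℤ.≤ m → ¬ m ≡ + 0 → 1ℚ ≤ fromℤ m
  positive-integer {m} 0≤m m≢0 = fromℤ-mono-≤ (ℤₚ.i<j⇒suc[i]≤j (ℤₚ.≤∧≢⇒< 0≤m λ 0≡m → m≢0 (sym 0≡m)))

  integer≤square : ∀ {m} → + 0 ℤ.≤ m → fromℤ m ≤ fromℤ m * fromℤ m
  integer≤square {m} 0≤m with m ℤ.≟ + 0
  ... | yes refl = ℚₚ.≤-refl
  ... | no m≢0 = linℚ 1 (λ x → (# 0 ≦ x ⊗ (x ⊖ # 1) ∷ [] ⊢ x ≦ x ⊗ x)) (fromℤ m)
    (*-nonNeg (fromℤ-mono-≤ 0≤m) (linℚ 1 (λ x → (# 1 ≦ x ∷ [] ⊢ # 0 ≦ x ⊖ # 1)) (fromℤ m) (positive-integer 0≤m m≢0)))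

  subtract-≤ : ∀ {x y} → x ≤ y → 0ℚ ≤ y - x
  subtract-≤ {x} {y} = linℚ 2 (λ x y → (x ≦ y ∷ [] ⊢ # 0 ≦ y ⊖ x)) x y

  subtract-< : ∀ {x y} → x < y → 0ℚ < y - x
  subtract-< {x} {y} = linℚ 2 (λ x y → (x ⋖ y ∷ [] ⊢ # 0 ⋖ y ⊖ x)) x y

  -- The lattice vector mg₁ + ng₂ has norm n₁m² + gmn + n₂n² where nᵢ = |gᵢ|² and g = 2⟨g₁,g₂⟩, and xᵢ is
  -- 2⟨u,gᵢ⟩: if u is closer to 0 than to g₁ and g₂, then also closer to 0 than to mg₁ + ng₂.
  cone : ∀ {n₁ n₂ g x₁ x₂ δ : ℚ} (m n : ℤ) → + 0 ℤ.≤ m → + 0 ℤ.≤ n → ¬ (m ≡ + 0 × n ≡ + 0) →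
    0ℚ ≤ n₁ → 0ℚ ≤ n₂ → 0ℚ ≤ g → 0ℚ ≤ δ → x₁ + δ ≤ n₁ → x₂ + δ ≤ n₂ →
    fromℤ m * x₁ + fromℤ n * x₂ + δ ≤ n₁ * (fromℤ m * fromℤ m) + g * (fromℤ m * fromℤ n) + n₂ * (fromℤ n * fromℤ n)
  cone {n₁} {n₂} {g} {x₁} {x₂} {δ} m n 0≤m 0≤n mn≢0 0≤n₁ 0≤n₂ 0≤g 0≤δ h₁ h₂ = linℚ 8
    (λ M N n₁ n₂ g x₁ x₂ δ →
      (# 0 ≦ M ⊗ (n₁ ⊖ (x₁ ⊕ δ)) ∷ # 0 ≦ N ⊗ (n₂ ⊖ (x₂ ⊕ δ)) ∷ # 0 ≦ n₁ ⊗ (M ⊗ M ⊖ M) ∷ # 0 ≦ n₂ ⊗ (N ⊗ N ⊖ N) ∷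
       # 0 ≦ g ⊗ (M ⊗ N) ∷ # 0 ≦ δ ⊗ (M ⊕ N ⊖ # 1) ∷ []
       ⊢ M ⊗ x₁ ⊕ N ⊗ x₂ ⊕ δ ≦ n₁ ⊗ (M ⊗ M) ⊕ g ⊗ (M ⊗ N) ⊕ n₂ ⊗ (N ⊗ N)))
    M N n₁ n₂ g x₁ x₂ δ
    (*-nonNeg 0≤M (subtract-≤ h₁)) (*-nonNeg 0≤N (subtract-≤ h₂))
    (*-nonNeg 0≤n₁ (subtract-≤ (integer≤square 0≤m))) (*-nonNeg 0≤n₂ (subtract-≤ (integer≤square 0≤n)))
    (*-nonNeg 0≤g (*-nonNeg 0≤M 0≤N)) (*-nonNeg 0≤δ one≤)
    where
    M N : ℚ
    M = fromℤ m
    N = fromℤ n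
    0≤M : 0ℚ ≤ M
    0≤M = fromℤ-mono-≤ 0≤m
    0≤N : 0ℚ ≤ N
    0≤N = fromℤ-mono-≤ 0≤n
    one≤ : 0ℚ ≤ M + N - 1ℚ
    one≤ with m ℤ.≟ + 0 | n ℤ.≟ + 0
    ... | yes m≡0 | yes n≡0 = ⊥-elim (mn≢0 (m≡0 , n≡0))
    ... | no m≢0  | _       = linℚ 2 (λ M N → (# 1 ≦ M ∷ # 0 ≦ N ∷ [] ⊢ # 0 ≦ M ⊕ N ⊖ # 1)) M N
        (positive-integer 0≤m m≢0) 0≤N
    ... | _       | no n≢0  = linℚ 2 (λ M N → (# 0 ≦ M ∷ # 1 ≦ N ∷ [] ⊢ # 0 ≦ M ⊕ N ⊖ # 1)) M N 0≤M
        (positive-integer 0≤n n≢0)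

  lowerBound : ∀ {x y} → 0ℚ < x → 0ℚ < y → Σ ℚ λ δ → 0ℚ < δ × δ ≤ x × δ ≤ y
  lowerBound {x} {y} 0<x 0<y with ℚₚ.≤-total x y
  ... | inj₁ x≤y = x , 0<x , ℚₚ.≤-refl , x≤y
  ... | inj₂ y≤x = y , 0<y , y≤x , ℚₚ.≤-refl

  trit : ∀ k → fromℤ -[1+ 1 ] < fromℤ k → fromℤ k < fromℤ (+ 2) → k ≡ + 0 ⊎ k ≡ + 1 ⊎ k ≡ -[1+ 0 ]
  trit k lo hi = go k (fromℤ-cancel-< lo) (fromℤ-cancel-< hi)
    where
    go : ∀ k → -[1+ 1 ] ℤ.< k → k ℤ.< + 2 → k ≡ + 0 ⊎ k ≡ + 1 ⊎ k ≡ -[1+ 0 ]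
    go (+ 0) _ _ = inj₁ refl
    go (+ 1) _ _ = inj₂ (inj₁ refl)
    go (+ suc (suc k)) _ (ℤ.+<+ (ℕ.s≤s (ℕ.s≤s ())))
    go -[1+ 0 ] _ _ = inj₂ (inj₂ refl)
    go -[1+ suc k ] (ℤ.-<- (ℕ.s≤s ())) _

  -- Recovers the parameter of a point on the far half of an edge: `d` is the extent of the edge in
  -- one coordinate and `x` the distance from its start in that coordinate.
  ratio : ∀ {x d} → 0ℚ < d → d < fromℤ (+ 2) * x → x < d → Σ ℚ λ r → r * d ≡ x × 1ℚ < fromℤ (+ 2) * r × r < 1ℚ
  ratio {x} {d} 0<d d<2x x<d with ι , 0<ι , dι≡1 ← reciprocal 0<d = x * ι ,
    trans (linℚ 3 (λ x d ι → ([] ⊢ x ⊗ ι ⊗ d ≐ x ⊗ (d ⊗ ι))) x d ι) (trans (cong (x *_) dι≡1) (ℚₚ.*-identityʳ x)) ,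
    linℚ 3 (λ x d ι → (d ⊗ ι ≐ # 1 ∷ # 0 ⋖ (# 2 ⊗ x ⊖ d) ⊗ ι ∷ [] ⊢ # 1 ⋖ # 2 ⊗ (x ⊗ ι))) x d ι dι≡1
        (*-pos (subtract-< d<2x) 0<ι) ,
    linℚ 3 (λ x d ι → (d ⊗ ι ≐ # 1 ∷ # 0 ⋖ (d ⊖ x) ⊗ ι ∷ [] ⊢ x ⊗ ι ⋖ # 1)) x d ι dι≡1 (*-pos (subtract-< x<d) 0<ι)

  0≤1 : 0ℚ ≤ 1ℚ
  0≤1 = ℚₚ.<⇒≤ (fromℤ-mono-< {+ 0} {+ 1} (ℤ.+<+ ℕ.z<s))

  0<2 : 0ℚ < fromℤ (+ 2)
  0<2 = fromℤ-mono-< {+ 0} {+ 2} (ℤ.+<+ ℕ.z<s)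

  -- Polymorphic in the number of variables, so that one formula can be placed in sequents over any
  -- context and also be evaluated at rational points.
  Region : Set
  Region = ∀ {n} → Expr n → Expr n → Expr n → Formula n

  ⟪_⟫ : Region → ℚ → ℚ → ℚ → Set
  ⟪ R ⟫ a b c = Linear.⟦_⟧ᶠ ℚ-orderedRing
    (R (var Fin.zero) (var (Fin.suc Fin.zero)) (var (Fin.suc (Fin.suc Fin.zero)))) (a Vec.∷ b Vec.∷ c Vec.∷ Vec.[])

  compare : ∀ x y → x ≤ y ⊎ y < x
  compare x y with x ℚ.≤? y
  ... | yes x≤y = inj₁ x≤y
  ... | no x≰y  = inj₂ (ℚₚ.≰⇒> x≰y)

  ≤-split : ∀ {x y} → x ≤ y → x < y ⊎ x ≡ y
  ≤-split {x} {y} x≤y with compare y x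
  ... | inj₁ y≤x = inj₂ (ℚₚ.≤-antisym x≤y y≤x)
  ... | inj₂ x<y = inj₁ x<y

  -- A lattice point i + jω acts on the plane by subtracting (2i + εj , εi + 2cj).
  module Translation (ε c : ℚ) where

    shiftα shiftβ : ℤ → ℤ → ℚ
    shiftα i j = fromℤ (+ 2) * fromℤ i + ε * fromℤ j
    shiftβ i j = ε * fromℤ i + fromℤ (+ 2) * c * fromℤ j

    Reducible : Region → ℚ → ℚ → Set
    Reducible R a b = Σ ℤ λ i → Σ ℤ λ j → ⟪ R ⟫ (a - shiftα i j) (b - shiftβ i j) c

    shifted : (R : Region) → ∀ {a b} i j → Reducible R (a - shiftα i j) (b - shiftβ i j) → Reducible R a b
    shifted R {a} {b} i j (i′ , j′ , r) = i ℤ.+ i′ , j ℤ.+ j′ , subst₂ (λ x y → ⟪ R ⟫ x y c)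
      (trans (linℚ 6 (λ ε a i j i′ j′ → ([] ⊢
          a ⊖ (# 2 ⊗ i ⊕ ε ⊗ j) ⊖ (# 2 ⊗ i′ ⊕ ε ⊗ j′) ≐ a ⊖ (# 2 ⊗ (i ⊕ i′) ⊕ ε ⊗ (j ⊕ j′))))
          ε a (fromℤ i) (fromℤ j) (fromℤ i′) (fromℤ j′))
        (sym (cong₂ (λ x y → a - (fromℤ (+ 2) * x + ε * y)) (fromℤ-+ i i′) (fromℤ-+ j j′))))
      (trans (linℚ 7 (λ ε c b i j i′ j′ → ([] ⊢
          b ⊖ (ε ⊗ i ⊕ # 2 ⊗ c ⊗ j) ⊖ (ε ⊗ i′ ⊕ # 2 ⊗ c ⊗ j′) ≐ b ⊖ (ε ⊗ (i ⊕ i′) ⊕ # 2 ⊗ c ⊗ (j ⊕ j′))))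
          ε c b (fromℤ i) (fromℤ j) (fromℤ i′) (fromℤ j′))
        (sym (cong₂ (λ x y → b - (ε * x + fromℤ (+ 2) * c * y)) (fromℤ-+ i i′) (fromℤ-+ j j′))))
      r

  -- The Voronoi cell in the coordinates α = 2⟨u,1⟩, β = 2⟨u,ω⟩, for a lattice ℤ + ℤω with |i + jω|² = i² + εij + cj².
  record Cell (ε c : ℚ) : Set₁ where
    open Translation ε c

    form : ℚ → ℚ → ℚ
    form i j = i * i + ε * (i * j) + c * (j * j)

    Tight : ℚ → ℚ → ℤ → ℤ → Set
    Tight a b i j = fromℤ i * a + fromℤ j * b ≡ form (fromℤ i) (fromℤ j)

    Δ : ℚ
    Δ = fromℤ (+ 4) * c - ε * ε

    field
      closed interior tile corners : Region
      Corner          : Set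
      start           : Corner
      next            : Corner → Corner
      cornerα cornerβ : Corner → ℚ
      sides           : ℕ
      -- The lines through 0 spanned by the lattice vectors whose bisector touches the cell.
      Axis            : Set
      axisᵢ axisⱼ     : Axis → ℤ
      onAxis          : Axis → Region

    corner : ℕ → Corner
    corner = fold start next

    edgeα : Corner → ℚ → ℚ
    edgeα κ r = cornerα κ + r * (cornerα (next κ) - cornerα κ)

    edgeβ : Corner → ℚ → ℚ
    edgeβ κ r = cornerβ κ + r * (cornerβ (next κ) - cornerβ κ)

    Midpoint : ℕ → ℚ → ℚ → Set
    Midpoint k a b = fromℤ (+ 2) * a ≡ cornerα (corner k) + cornerα (corner (suc k)) ×
                     fromℤ (+ 2) * b ≡ cornerβ (corner k) + cornerβ (corner (suc k))

    -- The cases of `InṼ`, with a point of a half edge described by its parameter on the whole edge,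
    -- so that the half edge is affine in the two corners.
    TileCases : ℚ → ℚ → Set
    TileCases a b =
      ⟪ interior ⟫ a b c
      ⊎ (Σ ℕ λ k → Σ ℚ λ r → 1ℚ < fromℤ (+ 2) * r × r < 1ℚ × a ≡ edgeα (corner k) r × b ≡ edgeβ (corner k) r)
      ⊎ (Σ ℕ λ k → suc k ℕ.≤ sides ℕ./ 2 × Midpoint k a b)
      ⊎ (Σ ℕ λ k → 1 ℕ.≤ k × k ℕ.≤ sides ℕ./ 3 × a ≡ cornerα (corner k) × b ≡ cornerβ (corner k))

    Along : Axis → ℤ → ℤ → Set
    Along x i j = Σ ℤ λ k → i ≡ k ℤ.* axisᵢ x × j ≡ k ℤ.* axisⱼ x

    field
      closed-intro   : ∀ a b → (∀ i j → fromℤ i * a + fromℤ j * b ≤ form (fromℤ i) (fromℤ j)) → ⟪ closed ⟫ a b c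
      closed-slack   : ∀ a b → ⟪ closed ⟫ a b c → ∀ i j → fromℤ i * a + fromℤ j * b ≤ form (fromℤ i) (fromℤ j)
      interior-intro : ∀ a b → (∀ i j → ¬ (i ≡ + 0 × j ≡ + 0) →
                       fromℤ i * a + fromℤ j * b < form (fromℤ i) (fromℤ j)) → ⟪ interior ⟫ a b c
      interior-slack : ∀ a b → ⟪ interior ⟫ a b c → ∀ i j → ¬ (i ≡ + 0 × j ≡ + 0) →
                       fromℤ i * a + fromℤ j * b < form (fromℤ i) (fromℤ j)
      interior⇒tile  : ∀ a b → ⟪ interior ⟫ a b c → ⟪ tile ⟫ a b c
      tile⇒closed    : ∀ a b → ⟪ tile ⟫ a b c → ⟪ closed ⟫ a b c
      norm-bound     : ∀ a b → ⟪ closed ⟫ a b c →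
                       fromℤ (+ 16) * (c * (a * a) - ε * (a * b) + b * b) ≤ Δ * (Δ + fromℤ (+ 4))
      no-translate   : ∀ a b i j → ¬ (i ≡ + 0 × j ≡ + 0) →
                       ⟪ tile ⟫ a b c → ⟪ tile ⟫ (a - shiftα i j) (b - shiftβ i j) c → ⊥
      -- Up to the factor Δ, 2β - εα is the coordinate of u along ω.
      reducible      : ∀ a b → a ≤ 1ℚ → - a ≤ 1ℚ →
                       fromℤ (+ 2) * (fromℤ (+ 2) * b - ε * a) ≤ Δ → - (fromℤ (+ 2) * (fromℤ (+ 2) * b - ε * a)) ≤ Δ →
                       Reducible tile a b
      corner∈corners : ∀ κ → ⟪ corners ⟫ (cornerα κ) (cornerβ κ) c
      corners⇒closed : ∀ a b → ⟪ corners ⟫ a b c → ⟪ closed ⟫ a b c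
      corner-normals : ∀ κ → Σ ℤ λ i → Σ ℤ λ j → Σ ℤ λ i′ → Σ ℤ λ j′ →
                       Tight (cornerα κ) (cornerβ κ) i j × Tight (cornerα κ) (cornerβ κ) i′ j′ ×
                       i ℤ.* j′ ℤ.- j ℤ.* i′ ≡ + 1
      direction      : ∀ a b i j → ¬ (i ≡ + 0 × j ≡ + 0) → ⟪ closed ⟫ a b c →
                       ⟪ closed ⟫ (a - shiftα i j) (b - shiftβ i j) c → Tight a b i j →
                       Σ Axis λ x → Along x i j × ⟪ onAxis x ⟫ a b c
      two-axes       : ∀ a b x x′ → ¬ x ≡ x′ → ⟪ closed ⟫ a b c →
                       ⟪ onAxis x ⟫ a b c → ⟪ onAxis x′ ⟫ a b c → ⟪ corners ⟫ a b c
      -- The determinant is nonnegative when `next κ` lies to the left of or on the line from κ to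
      -- (a, b). In a strictly convex polygon traversed counter-clockwise only the two ends of the
      -- edge pass this test.
      turn           : ∀ κ a b → ⟪ corners ⟫ a b c →
                       0ℚ ≤ (a - cornerα κ) * (cornerβ (next κ) - cornerβ κ) - (b - cornerβ κ) *
                           (cornerα (next κ) - cornerα κ) →
                       (a ≡ cornerα κ × b ≡ cornerβ κ) ⊎ (a ≡ cornerα (next κ) × b ≡ cornerβ (next κ))
      first-corner   : ∀ a b → ⟪ corners ⟫ a b c → a ≡ 1ℚ → 0ℚ < fromℤ (+ 2) * b - ε * a →
                       a ≡ cornerα start × b ≡ cornerβ start
      1<sides        : 1 ℕ.< sides
      -- Together with `full-turn`: `sides` is the least positive number of steps that leads back to
      -- the start.
      returns        : ∀ k → 1 ℕ.≤ k → k ℕ.≤ sides → cornerα (corner k) ≡ cornerα start →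
                       cornerβ (corner k) ≡ cornerβ start → k ≡ sides
      full-turn      : corner sides ≡ start
      tile-edge      : ∀ κ r → 1ℚ < fromℤ (+ 2) * r → r < 1ℚ → ⟪ tile ⟫ (edgeα κ r) (edgeβ κ r) c
      tile-mid       : ∀ k → suc k ℕ.≤ sides ℕ./ 2 → ∀ a b → Midpoint k a b → ⟪ tile ⟫ a b c
      tile-corner    : ∀ k → 1 ℕ.≤ k → k ℕ.≤ sides ℕ./ 3 → ⟪ tile ⟫ (cornerα (corner k)) (cornerβ (corner k)) c
      tile-cases     : ∀ a b → ⟪ tile ⟫ a b c → TileCases a b

    unique : ∀ a b i j → ⟪ tile ⟫ a b c → ⟪ tile ⟫ (a - shiftα i j) (b - shiftβ i j) c → i ≡ + 0 × j ≡ + 0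
    unique a b i j t t′ with (i ℤ.≟ + 0) ×-dec (j ℤ.≟ + 0)
    ... | yes ij≡0 = ij≡0
    ... | no ij≢0  = ⊥-elim (no-translate a b i j ij≢0 t t′)

    -- On a common axis the two vectors would be parallel, against the nonzero determinant; and two
    -- different axes can be tight together only at a corner.
    two-normals : ∀ a b i j i′ j′ → ⟪ closed ⟫ a b c →
      ⟪ closed ⟫ (a - shiftα i j) (b - shiftβ i j) c → ⟪ closed ⟫ (a - shiftα i′ j′) (b - shiftβ i′ j′) c →
      Tight a b i j → Tight a b i′ j′ → ¬ i ℤ.* j′ ℤ.- j ℤ.* i′ ≡ + 0 → ⟪ corners ⟫ a b c
    two-normals a b i j i′ j′ h h₁ h₂ t t′ det≢0 = meet
        (direction a b i j (λ { (refl , refl) → det≢0 (zeroˡ i′ j′) }) h h₁ t)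
        (direction a b i′ j′ (λ { (refl , refl) → det≢0 (zeroʳ i j) }) h h₂ t′)
      where
      zeroˡ : ∀ i j → + 0 ℤ.* j ℤ.- + 0 ℤ.* i ≡ + 0
      zeroˡ = linℤ 2 (λ i j → ([] ⊢ # 0 ⊗ j ⊖ # 0 ⊗ i ≐ # 0))
      zeroʳ : ∀ i j → i ℤ.* + 0 ℤ.- j ℤ.* + 0 ≡ + 0
      zeroʳ = linℤ 2 (λ i j → ([] ⊢ i ⊗ # 0 ⊖ j ⊗ # 0 ≐ # 0))
      parallel : ∀ x k k′ → i ≡ k ℤ.* axisᵢ x → j ≡ k ℤ.* axisⱼ x → i′ ≡ k′ ℤ.* axisᵢ x → j′ ≡ k′ ℤ.* axisⱼ x →
        i ℤ.* j′ ℤ.- j ℤ.* i′ ≡ + 0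
      parallel x k k′ refl refl refl refl =
        linℤ 4 (λ k k′ x y → ([] ⊢ k ⊗ x ⊗ (k′ ⊗ y) ⊖ k ⊗ y ⊗ (k′ ⊗ x) ≐ # 0)) k k′ (axisᵢ x) (axisⱼ x)
      meet : (Σ Axis λ x → Along x i j × ⟪ onAxis x ⟫ a b c) → (Σ Axis λ x → Along x i′ j′ × ⟪ onAxis x ⟫ a b c) →
          ⟪ corners ⟫ a b c
      meet (x , (k , i≡ , j≡) , on) (x′ , (k′ , i′≡ , j′≡) , on′) =
        two-axes a b x x′ (λ { refl → det≢0 (parallel x k k′ i≡ j≡ i′≡ j′≡) }) h on on′

  literal : ∀ {n} → ℤ → Expr n
  literal (+ k)    = # k
  literal -[1+ k ] = ⊝ # suc k

  module CellSyntax (e : ℕ) (c : ℚ) (1≤c : 1ℚ ≤ c) where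

    -- `c` remains a variable of the sequent, so one evaluation settles the inclusion for all c ≥ 1.
    infer : (H G : Region) {_ : Linear.Valid ℚ-orderedRing (Linear.close ℚ-orderedRing 3 λ a b c →
        (# 1 ≦ c ∷ H a b c ∷ [] ⊢ G a b c))} →
      ∀ a b → ⟪ H ⟫ a b c → ⟪ G ⟫ a b c
    infer H G {valid} a b = linℚ 3 (λ a b c → (# 1 ≦ c ∷ H a b c ∷ [] ⊢ G a b c)) {valid} a b c 1≤c

    translated : ℤ → ℤ → Region → Region
    translated i j R a b c = R (a ⊖ (# 2 ⊗ literal i ⊕ # e ⊗ literal j)) (b ⊖ (# e ⊗ literal i ⊕
        # 2 ⊗ c ⊗ literal j)) c

    norm′ : ∀ {n} → Expr n → Expr n → Expr n → Expr n
    norm′ c i j = i ⊗ i ⊕ # e ⊗ (i ⊗ j) ⊕ c ⊗ (j ⊗ j)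

    bisector halfPlane openHalfPlane : ℤ → ℤ → Region
    bisector i j a b c      = literal i ⊗ a ⊕ literal j ⊗ b ≐ norm′ c (literal i) (literal j)
    halfPlane i j a b c     = literal i ⊗ a ⊕ literal j ⊗ b ≦ norm′ c (literal i) (literal j)
    openHalfPlane i j a b c = literal i ⊗ a ⊕ literal j ⊗ b ⋖ norm′ c (literal i) (literal j)

    0≤c : 0ℚ ≤ c
    0≤c = linℚ 1 (λ c → (# 1 ≦ c ∷ [] ⊢ # 0 ≦ c)) c 1≤c

    within : ∀ x y {δ δ′} → δ′ ≤ y - x → δ ≤ δ′ → x + δ ≤ y
    within x y {δ} {δ′} = linℚ 4 (λ x y δ δ′ → (δ′ ≦ y ⊖ x ∷ δ ≦ δ′ ∷ [] ⊢ x ⊕ δ ≦ y)) x y δ δ′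

    +0 : ∀ {x y} → x ≤ y → x + 0ℚ ≤ y
    +0 {x} {y} = linℚ 2 (λ x y → (x ≦ y ∷ [] ⊢ x ⊕ # 0 ≦ y)) x y

    form : ℚ → ℚ → ℚ
    form i j = i * i + fromℤ (+ e) * (i * j) + c * (j * j)

  -- The hexagonal cell (odd p)

  module Hexagon (c : ℚ) (1≤c : 1ℚ ≤ c) where

    open CellSyntax 1 c 1≤c
    open Translation (fromℤ (+ 1)) c

    -- After the interior, `tile` lists the far halves of the edges counter-clockwise, beginning
    -- with the edge from `k₀` to `k₁`. For m = 6 the midpoints 0, 1, 2 and the vertices 1, 2 belong
    -- to the restricted cell, which decides between ≦ and ⋖ at the ends.
    closed interior tile : Region
    closed a b c = a ≦ # 1 ⩓ ⊝ a ≦ # 1 ⩓ b ≦ c ⩓ ⊝ b ≦ c ⩓ b ⊖ a ≦ c ⩓ a ⊖ b ≦ c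
    interior a b c = a ⋖ # 1 ⩓ ⊝ a ⋖ # 1 ⩓ b ⋖ c ⩓ ⊝ b ⋖ c ⩓ b ⊖ a ⋖ c ⩓ a ⊖ b ⋖ c
    tile a b c =
      interior a b c
      ⩔ (b ≐ c ⩓ # 0 ≦ a ⩓ # 2 ⊗ a ≦ # 1)
      ⩔ (b ⊖ a ≐ c ⩓ ⊝ # 1 ≦ a ⩓ # 2 ⊗ a ≦ ⊝ # 1)
      ⩔ (a ≐ ⊝ # 1 ⩓ ⊝ c ⋖ b ⩓ # 2 ⊗ b ≦ ⊝ # 1)
      ⩔ (b ≐ ⊝ c ⩓ ⊝ # 1 ⋖ # 2 ⊗ a ⩓ a ⋖ # 0)
      ⩔ (a ⊖ b ≐ c ⩓ # 1 ⋖ # 2 ⊗ a ⩓ a ⋖ # 1)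
      ⩔ (a ≐ # 1 ⩓ # 1 ⋖ # 2 ⊗ b ⩓ b ⋖ c)

    -- 0 and the six Voronoi-relevant vectors ±1, ±ω, ±(ω - 1).
    data Small : ℤ → ℤ → Set where
      origin : Small (+ 0) (+ 0)
      f₁     : Small (+ 1) (+ 0)
      f₂     : Small (+ 0) (+ 1)
      f₃     : Small -[1+ 0 ] (+ 1)
      -f₁    : Small -[1+ 0 ] (+ 0)
      -f₂    : Small (+ 0) -[1+ 0 ]
      -f₃    : Small (+ 1) -[1+ 0 ]

    0<2c-1 : 0ℚ < fromℤ (+ 2) * c - 1ℚ
    0<2c-1 = linℚ 1 (λ c → (# 1 ≦ c ∷ [] ⊢ # 0 ⋖ # 2 ⊗ c ⊖ # 1)) c 1≤c

    small : ∀ a b i j → ⟪ closed ⟫ a b c → ⟪ closed ⟫ (a - shiftα i j) (b - shiftβ i j) c → Small i j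
    small a b i j (a≤1 , -a≤1 , b≤c , -b≤c , b-a≤c , a-b≤c) (a′≤1 , -a′≤1 , b′≤c , -b′≤c , b′-a′≤c , a′-b′≤c) =
      classify (trit j j> j<) (trit i (proj₁ i-bounds) (proj₂ i-bounds))
      where
      I J : ℚ
      I = fromℤ i
      J = fromℤ j
      j< : J < fromℤ (+ 2)
      -- The sum of the four cell inequalities is free of a, b and i; it reads (4c - 1)j ≤ 4c.
      j< = ℚₚ.≰⇒> λ 2≤J → linℚ 5 (λ a b c i j → (# 1 ≦ c ∷ # 2 ≦ j ∷ # 0 ≦ (c ⊖ # 1) ⊗ (j ⊖ # 2) ∷
        b ≦ c ∷ b ⊖ a ≦ c ∷ ⊝ (b ⊖ (# 1 ⊗ i ⊕ # 2 ⊗ c ⊗ j)) ≦ c ∷ (a ⊖ (# 2 ⊗ i ⊕ # 1 ⊗ j)) ⊖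
            (b ⊖ (# 1 ⊗ i ⊕ # 2 ⊗ c ⊗ j)) ≦ c ∷ [] ⊢ ff)) a b c I J
        1≤c 2≤J (*-nonNeg (subtract-≤ 1≤c) (subtract-≤ 2≤J)) b≤c b-a≤c -b′≤c a′-b′≤c
      j> : fromℤ -[1+ 1 ] < J
      j> = ℚₚ.≰⇒> λ J≤-2 → linℚ 5 (λ a b c i j → (# 1 ≦ c ∷ j ≦ ⊝ # 2 ∷ # 0 ≦ (c ⊖ # 1) ⊗ (⊝ # 2 ⊖ j) ∷
        ⊝ b ≦ c ∷ a ⊖ b ≦ c ∷ (b ⊖ (# 1 ⊗ i ⊕ # 2 ⊗ c ⊗ j)) ≦ c ∷ (b ⊖ (# 1 ⊗ i ⊕ # 2 ⊗ c ⊗ j)) ⊖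
            (a ⊖ (# 2 ⊗ i ⊕ # 1 ⊗ j)) ≦ c ∷ [] ⊢ ff)) a b c I J
        1≤c J≤-2 (*-nonNeg (subtract-≤ 1≤c) (subtract-≤ J≤-2)) -b≤c a-b≤c b′≤c b′-a′≤c
      J∈ : J ≡ 0ℚ ⊎ J ≡ 1ℚ ⊎ J ≡ - 1ℚ
      J∈ with trit j j> j<
      ... | inj₁ refl        = inj₁ refl
      ... | inj₂ (inj₁ refl) = inj₂ (inj₁ refl)
      ... | inj₂ (inj₂ refl) = inj₂ (inj₂ refl)
      i-bounds : (fromℤ -[1+ 1 ] < I) × (I < fromℤ (+ 2))
      i-bounds = linℚ 3 (λ a i j → (j ≐ # 0 ⩔ j ≐ # 1 ⩔ j ≐ ⊝ # 1 ∷ a ≦ # 1 ∷ ⊝ a ≦ # 1 ∷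
          (a ⊖ (# 2 ⊗ i ⊕ # 1 ⊗ j)) ≦ # 1 ∷ ⊝ (a ⊖ (# 2 ⊗ i ⊕ # 1 ⊗ j)) ≦ # 1 ∷ [] ⊢
        ⊝ # 2 ⋖ i ⩓ i ⋖ # 2)) a I J J∈ a≤1 -a≤1 a′≤1 -a′≤1
      ¬same-sign : ¬ ((I ≡ 1ℚ × J ≡ 1ℚ) ⊎ (I ≡ - 1ℚ × J ≡ - 1ℚ))
      ¬same-sign ij = linℚ 3 (λ a i j → ((i ≐ # 1 ⩓ j ≐ # 1) ⩔ (i ≐ ⊝ # 1 ⩓ j ≐ ⊝ # 1) ∷
        a ≦ # 1 ∷ ⊝ a ≦ # 1 ∷ (a ⊖ (# 2 ⊗ i ⊕ # 1 ⊗ j)) ≦ # 1 ∷ ⊝ (a ⊖ (# 2 ⊗ i ⊕ # 1 ⊗ j)) ≦ # 1 ∷ [] ⊢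
            ff)) a I J ij a≤1 -a≤1 a′≤1 -a′≤1
      classify : j ≡ + 0 ⊎ j ≡ + 1 ⊎ j ≡ -[1+ 0 ] → i ≡ + 0 ⊎ i ≡ + 1 ⊎ i ≡ -[1+ 0 ] → Small i j
      classify (inj₁ refl) (inj₁ refl) = origin
      classify (inj₁ refl) (inj₂ (inj₁ refl)) = f₁
      classify (inj₁ refl) (inj₂ (inj₂ refl)) = -f₁
      classify (inj₂ (inj₁ refl)) (inj₁ refl) = f₂
      classify (inj₂ (inj₁ refl)) (inj₂ (inj₁ refl)) = ⊥-elim (¬same-sign (inj₁ (refl , refl)))
      classify (inj₂ (inj₁ refl)) (inj₂ (inj₂ refl)) = f₃
      classify (inj₂ (inj₂ refl)) (inj₁ refl) = -f₂
      classify (inj₂ (inj₂ refl)) (inj₂ (inj₁ refl)) = -f₃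
      classify (inj₂ (inj₂ refl)) (inj₂ (inj₂ refl)) = ⊥-elim (¬same-sign (inj₂ (refl , refl)))

    disjoint : ∀ {i j} → Small i j → ¬ (i ≡ + 0 × j ≡ + 0) → ∀ a b →
      ⟪ tile ⟫ a b c × ⟪ tile ⟫ (a - shiftα i j) (b - shiftβ i j) c → ⊥
    disjoint origin ij≢0 = ⊥-elim (ij≢0 (refl , refl))
    disjoint f₁ _ = infer (λ a b c → tile a b c ⩓ translated (+ 1) (+ 0) tile a b c) (λ _ _ _ → ff)
    disjoint f₂ _ = infer (λ a b c → tile a b c ⩓ translated (+ 0) (+ 1) tile a b c) (λ _ _ _ → ff)
    disjoint f₃ _ = infer (λ a b c → tile a b c ⩓ translated -[1+ 0 ] (+ 1) tile a b c) (λ _ _ _ → ff)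
    disjoint -f₁ _ = infer (λ a b c → tile a b c ⩓ translated -[1+ 0 ] (+ 0) tile a b c) (λ _ _ _ → ff)
    disjoint -f₂ _ = infer (λ a b c → tile a b c ⩓ translated (+ 0) -[1+ 0 ] tile a b c) (λ _ _ _ → ff)
    disjoint -f₃ _ = infer (λ a b c → tile a b c ⩓ translated (+ 1) -[1+ 0 ] tile a b c) (λ _ _ _ → ff)

    -- A point of the edge outside the tile is moved by the normal of the edge onto the selected
    -- half of the opposite edge. The vertices are different: modulo the lattice they form the
    -- classes v₀, v₂, v₄ and v₁, v₃, v₅, represented by v₂ and v₁, so that v₀ has to go to v₂.
    reducible-edge₀ : ∀ a b → ⟪ (λ a b c → b ≐ c ⩓ closed a b c) ⟫ a b c → Reducible tile a b
    reducible-edge₀ a b (b≡c , h) with compare (fromℤ (+ 2) * a) 1ℚ | ≤-split (proj₁ h)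
    ... | inj₁ 2a≤1 | _ = + 0 , + 0 , infer (λ a b c → b ≐ c ⩓ closed a b c ⩓ # 2 ⊗ a ≦ # 1) (translated (+ 0)
        (+ 0) tile) a b (b≡c , h , 2a≤1)
    ... | inj₂ 1<2a | inj₁ a<1 = + 0 , + 1 , infer (λ a b c → b ≐ c ⩓ # 1 ⋖ # 2 ⊗ a ⩓ a ⋖ # 1) (translated (+ 0)
        (+ 1) tile) a b (b≡c , 1<2a , a<1)
    ... | inj₂ 1<2a | inj₂ a≡1 = + 1 , + 0 , infer (λ a b c → b ≐ c ⩓ a ≐ # 1) (translated (+ 1) (+ 0) tile) a b
        (b≡c , a≡1)

    reducible-edge₁ : ∀ a b → ⟪ (λ a b c → b ⊖ a ≐ c ⩓ closed a b c) ⟫ a b c → Reducible tile a b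
    reducible-edge₁ a b (b-a≡c , h) with compare (fromℤ (+ 2) * a) (- 1ℚ) | compare 0ℚ a
    ... | inj₁ 2a≤-1 | _ = + 0 , + 0 , infer (λ a b c → b ⊖ a ≐ c ⩓ closed a b c ⩓ # 2 ⊗ a ≦ ⊝ # 1) (translated (+ 0)
        (+ 0) tile) a b (b-a≡c , h , 2a≤-1)
    ... | inj₂ -1<2a | inj₁ 0≤a = + 0 , + 0 , infer (λ a b c → b ⊖ a ≐ c ⩓ closed a b c ⩓ # 0 ≦ a) (translated (+ 0)
        (+ 0) tile) a b (b-a≡c , h , 0≤a)
    ... | inj₂ -1<2a | inj₂ a<0 = -[1+ 0 ] , + 1 , infer (λ a b c → b ⊖ a ≐ c ⩓ closed a b c ⩓ ⊝ # 1 ⋖ # 2 ⊗ a ⩓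
        a ⋖ # 0) (translated -[1+ 0 ] (+ 1) tile) a b (b-a≡c , h , -1<2a , a<0)

    reducible-edge₂ : ∀ a b → ⟪ (λ a b c → ⊝ a ≐ # 1 ⩓ closed a b c) ⟫ a b c → Reducible tile a b
    reducible-edge₂ a b (-a≡1 , h) with compare (fromℤ (+ 2) * b) (- 1ℚ) | compare b (- c) | compare (c - 1ℚ) b
    ... | inj₁ 2b≤-1 | inj₁ b≤-c | _ = + 0 , -[1+ 0 ] , infer (λ a b c → ⊝ a ≐ # 1 ⩓ closed a b c ⩓ b ≦ ⊝ c)
        (translated (+ 0) -[1+ 0 ] tile) a b (-a≡1 , h , b≤-c)
    ... | inj₁ 2b≤-1 | inj₂ -c<b | _ = + 0 , + 0 , infer (λ a b c → ⊝ a ≐ # 1 ⩓ # 2 ⊗ b ≦ ⊝ # 1 ⩓ ⊝ c ⋖ b)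
        (translated (+ 0) (+ 0) tile) a b (-a≡1 , 2b≤-1 , -c<b)
    ... | inj₂ -1<2b | _ | inj₁ c-1≤b = + 0 , + 0 , infer (λ a b c → ⊝ a ≐ # 1 ⩓ closed a b c ⩓ c ⊖ # 1 ≦ b)
        (translated (+ 0) (+ 0) tile) a b (-a≡1 , h , c-1≤b)
    ... | inj₂ -1<2b | _ | inj₂ b<c-1 = -[1+ 0 ] , + 0 , infer (λ a b c → ⊝ a ≐ # 1 ⩓ ⊝ # 1 ⋖ # 2 ⊗ b ⩓ b ⋖ c ⊖ # 1)
        (translated -[1+ 0 ] (+ 0) tile) a b (-a≡1 , -1<2b , b<c-1)

    -- The normals carry three of the edges onto the opposite ones, so that only three edges have to
    -- be treated.
    closed⇒reducible : ∀ a b → ⟪ closed ⟫ a b c → Reducible tile a b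
    closed⇒reducible a b h@(a≤1 , -a≤1 , b≤c , -b≤c , b-a≤c , a-b≤c)
      with ≤-split b≤c | ≤-split -b≤c | ≤-split b-a≤c | ≤-split a-b≤c | ≤-split -a≤1 | ≤-split a≤1
    ... | inj₂ b≡c | _ | _ | _ | _ | _ = reducible-edge₀ a b (b≡c , h)
    ... | _ | inj₂ -b≡c | _ | _ | _ | _ = shifted tile {a} {b} (+ 0) -[1+ 0 ] (reducible-edge₀ (a - shiftα
        (+ 0) -[1+ 0 ]) (b - shiftβ (+ 0) -[1+ 0 ])
      (infer (λ a b c → closed a b c ⩓ ⊝ b ≐ c) (translated (+ 0) -[1+ 0 ] (λ a b c → b ≐ c ⩓ closed a b c)) a b
          (h , -b≡c)))
    ... | _ | _ | inj₂ b-a≡c | _ | _ | _ = reducible-edge₁ a b (b-a≡c , h)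
    ... | _ | _ | _ | inj₂ a-b≡c | _ | _ = shifted tile {a} {b} (+ 1) -[1+ 0 ] (reducible-edge₁ (a - shiftα
        (+ 1) -[1+ 0 ]) (b - shiftβ (+ 1) -[1+ 0 ])
      (infer (λ a b c → closed a b c ⩓ a ⊖ b ≐ c) (translated (+ 1) -[1+ 0 ] (λ a b c → b ⊖ a ≐ c ⩓
          closed a b c)) a b (h , a-b≡c)))
    ... | _ | _ | _ | _ | inj₂ -a≡1 | _ = reducible-edge₂ a b (-a≡1 , h)
    ... | _ | _ | _ | _ | _ | inj₂ a≡1 = shifted tile {a} {b} (+ 1) (+ 0) (reducible-edge₂ (a - shiftα (+ 1) (+ 0))
        (b - shiftβ (+ 1) (+ 0))
      (infer (λ a b c → closed a b c ⩓ a ≐ # 1) (translated (+ 1) (+ 0) (λ a b c → ⊝ a ≐ # 1 ⩓ closed a b c)) a b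
          (h , a≡1)))
    ... | inj₁ b<c | inj₁ -b<c | inj₁ b-a<c | inj₁ a-b<c | inj₁ -a<1 | inj₁ a<1 =
      + 0 , + 0 , infer interior (translated (+ 0) (+ 0) tile) a b (a<1 , -a<1 , b<c , -b<c , b-a<c , a-b<c)

    strip : Region
    strip a b c = a ≦ # 1 ⩓ ⊝ a ≦ # 1 ⩓
      # 2 ⊗ (# 2 ⊗ b ⊖ # 1 ⊗ a) ≦ # 4 ⊗ c ⊖ # 1 ⊗ # 1 ⩓ ⊝ (# 2 ⊗ (# 2 ⊗ b ⊖ # 1 ⊗ a)) ≦ # 4 ⊗ c ⊖ # 1 ⊗ # 1

    -- The strip is the rectangle |Re u| ≤ 1/2, 2|Im u| ≤ Im ω. It sticks out of the hexagon only
    -- near corners, and from beyond a side one translation by the normal of that side leads into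
    -- the hexagon.
    strip⇒reducible : ∀ a b → ⟪ strip ⟫ a b c → Reducible tile a b
    strip⇒reducible a b h with compare b c | compare (- b) c | compare (b - a) c | compare (a - b) c
    ... | inj₂ c<b | _ | _ | _ = shifted tile {a} {b} (+ 0) (+ 1) (closed⇒reducible (a - shiftα (+ 0) (+ 1))
        (b - shiftβ (+ 0) (+ 1))
      (infer (λ a b c → strip a b c ⩓ c ⋖ b) (translated (+ 0) (+ 1) closed) a b (h , c<b)))
    ... | _ | inj₂ c<-b | _ | _ = shifted tile {a} {b} (+ 0) -[1+ 0 ] (closed⇒reducible (a - shiftα (+ 0) -[1+ 0 ])
        (b - shiftβ (+ 0) -[1+ 0 ])
      (infer (λ a b c → strip a b c ⩓ c ⋖ ⊝ b) (translated (+ 0) -[1+ 0 ] closed) a b (h , c<-b)))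
    ... | _ | _ | inj₂ c<b-a | _ = shifted tile {a} {b} -[1+ 0 ] (+ 1) (closed⇒reducible (a - shiftα -[1+ 0 ] (+ 1))
        (b - shiftβ -[1+ 0 ] (+ 1))
      (infer (λ a b c → strip a b c ⩓ c ⋖ b ⊖ a) (translated -[1+ 0 ] (+ 1) closed) a b (h , c<b-a)))
    ... | _ | _ | _ | inj₂ c<a-b = shifted tile {a} {b} (+ 1) -[1+ 0 ] (closed⇒reducible (a - shiftα (+ 1) -[1+ 0 ])
        (b - shiftβ (+ 1) -[1+ 0 ])
      (infer (λ a b c → strip a b c ⩓ c ⋖ a ⊖ b) (translated (+ 1) -[1+ 0 ] closed) a b (h , c<a-b)))
    ... | inj₁ b≤c | inj₁ -b≤c | inj₁ b-a≤c | inj₁ a-b≤c =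
      closed⇒reducible a b (proj₁ h , proj₁ (proj₂ h) , b≤c , -b≤c , b-a≤c , a-b≤c)

    -- The vectors 1, ω, ω - 1, -1 cut the upper half-plane into three cones. In the second, i + jω
    -- = (i + j)ω - i(ω - 1), in the third, i + jω = j(ω - 1) - (i + j)(-1). Consecutive vectors
    -- have nonnegative scalar product, as `cone` requires. δ = 0 serves the closed cell, δ > 0 the
    -- interior.
    slack⁺ : ∀ {a b δ} → 0ℚ ≤ δ → a + δ ≤ 1ℚ → - a + δ ≤ 1ℚ → b + δ ≤ c → b - a + δ ≤ c →
      ∀ i j → + 0 ℤ.≤ j → ¬ (i ≡ + 0 × j ≡ + 0) → fromℤ i * a + fromℤ j * b + δ ≤ form (fromℤ i) (fromℤ j)
    slack⁺ {a} {b} {δ} 0≤δ h₁ h₂ h₃ h₄ i j 0≤j ij≢0 with ℤₚ.≤-total (+ 0) i | ℤₚ.≤-total (+ 0) (i ℤ.+ j)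
    ... | inj₁ 0≤i | _ = linℚ 6 (λ a b c δ i j →
          (i ⊗ a ⊕ j ⊗ b ⊕ δ ≦ # 1 ⊗ (i ⊗ i) ⊕ # 1 ⊗ (i ⊗ j) ⊕ c ⊗ (j ⊗ j) ∷ [] ⊢
           i ⊗ a ⊕ j ⊗ b ⊕ δ ≦ i ⊗ i ⊕ # 1 ⊗ (i ⊗ j) ⊕ c ⊗ (j ⊗ j))) a b c δ (fromℤ i) (fromℤ j)
        (cone {1ℚ} {c} {1ℚ} {a} {b} {δ} i j 0≤i 0≤j ij≢0 0≤1 0≤c 0≤1 0≤δ h₁ h₃)
    ... | inj₂ i≤0 | inj₁ 0≤i+j = linℚ 6 (λ a b c δ i j →
          ((i ⊕ j) ⊗ b ⊕ ⊝ i ⊗ (b ⊖ a) ⊕ δ ≦ c ⊗ ((i ⊕ j) ⊗ (i ⊕ j)) ⊕ (# 2 ⊗ c ⊖ # 1) ⊗ ((i ⊕ j) ⊗ ⊝ i) ⊕ c ⊗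
              (⊝ i ⊗ ⊝ i) ∷ [] ⊢
           i ⊗ a ⊕ j ⊗ b ⊕ δ ≦ i ⊗ i ⊕ # 1 ⊗ (i ⊗ j) ⊕ c ⊗ (j ⊗ j))) a b c δ (fromℤ i) (fromℤ j)
        (subst₂ (λ M N → M * b + N * (b - a) + δ ≤ c * (M * M) + (fromℤ (+ 2) * c - 1ℚ) * (M * N) + c * (N * N))
          (fromℤ-+ i j) (fromℤ-neg i)
          (cone {c} {c} {fromℤ (+ 2) * c - 1ℚ} {b} {b - a} {δ} (i ℤ.+ j) (ℤ.- i) 0≤i+j (ℤₚ.neg-mono-≤ i≤0)
            (λ (i+j≡0 , -i≡0) → ij≢0 (ℤₚ.neg-injective -i≡0 ,
              linℤ 2 (λ i j → (i ⊕ j ≐ # 0 ∷ ⊝ i ≐ # 0 ∷ [] ⊢ j ≐ # 0)) i j i+j≡0 -i≡0))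
            0≤c 0≤c (linℚ 1 (λ c → (# 1 ≦ c ∷ [] ⊢ # 0 ≦ # 2 ⊗ c ⊖ # 1)) c 1≤c) 0≤δ h₃ h₄))
    ... | inj₂ i≤0 | inj₂ i+j≤0 = linℚ 6 (λ a b c δ i j →
          (j ⊗ (b ⊖ a) ⊕ ⊝ (i ⊕ j) ⊗ ⊝ a ⊕ δ ≦ c ⊗ (j ⊗ j) ⊕ # 1 ⊗ (j ⊗ ⊝ (i ⊕ j)) ⊕ # 1 ⊗ (⊝ (i ⊕ j) ⊗ ⊝ (i ⊕ j)) ∷
              [] ⊢
           i ⊗ a ⊕ j ⊗ b ⊕ δ ≦ i ⊗ i ⊕ # 1 ⊗ (i ⊗ j) ⊕ c ⊗ (j ⊗ j))) a b c δ (fromℤ i) (fromℤ j)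
        (subst (λ N → fromℤ j * (b - a) + N * - a + δ ≤ c * (fromℤ j * fromℤ j) + 1ℚ * (fromℤ j * N) + 1ℚ * (N * N))
          (trans (fromℤ-neg (i ℤ.+ j)) (cong -_ (fromℤ-+ i j)))
          (cone {c} {1ℚ} {1ℚ} {b - a} { - a} {δ} j (ℤ.- (i ℤ.+ j)) 0≤j (ℤₚ.neg-mono-≤ i+j≤0)
            (λ (j≡0 , -i-j≡0) → ij≢0 (linℤ 2 (λ i j → (j ≐ # 0 ∷ ⊝ (i ⊕ j) ≐ # 0 ∷ [] ⊢ i ≐ # 0)) i j j≡0 -i-j≡0 ,
                j≡0))
            0≤c 0≤1 0≤1 0≤δ h₄ h₂))

    slack : ∀ {a b δ} → 0ℚ ≤ δ → a + δ ≤ 1ℚ → - a + δ ≤ 1ℚ → b + δ ≤ c → - b + δ ≤ c → b - a + δ ≤ c → a - b + δ ≤ c →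
      ∀ i j → ¬ (i ≡ + 0 × j ≡ + 0) → fromℤ i * a + fromℤ j * b + δ ≤ form (fromℤ i) (fromℤ j)
    slack {a} {b} {δ} 0≤δ h₁ h₂ h₃ h₄ h₅ h₆ i j ij≢0 with ℤₚ.≤-total (+ 0) j
    ... | inj₁ 0≤j = slack⁺ 0≤δ h₁ h₂ h₃ h₅ i j 0≤j ij≢0
    ... | inj₂ j≤0 = linℚ 6 (λ a b c δ i j →
          (⊝ i ⊗ ⊝ a ⊕ ⊝ j ⊗ ⊝ b ⊕ δ ≦ ⊝ i ⊗ ⊝ i ⊕ # 1 ⊗ (⊝ i ⊗ ⊝ j) ⊕ c ⊗ (⊝ j ⊗ ⊝ j) ∷ [] ⊢
           i ⊗ a ⊕ j ⊗ b ⊕ δ ≦ i ⊗ i ⊕ # 1 ⊗ (i ⊗ j) ⊕ c ⊗ (j ⊗ j))) a b c δ (fromℤ i) (fromℤ j)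
        (subst₂ (λ I J → I * - a + J * - b + δ ≤ form I J) (fromℤ-neg i) (fromℤ-neg j)
          (slack⁺ { - a} { - b} {δ} 0≤δ h₂
            (linℚ 2 (λ a δ → (a ⊕ δ ≦ # 1 ∷ [] ⊢ ⊝ (⊝ a) ⊕ δ ≦ # 1)) a δ h₁) h₄
            (linℚ 4 (λ a b c δ → (a ⊖ b ⊕ δ ≦ c ∷ [] ⊢ ⊝ b ⊖ ⊝ a ⊕ δ ≦ c)) a b c δ h₆)
            (ℤ.- i) (ℤ.- j) (ℤₚ.neg-mono-≤ j≤0)
            λ (-i≡0 , -j≡0) → ij≢0 (ℤₚ.neg-injective -i≡0 , ℤₚ.neg-injective -j≡0)))

    closed-slack : ∀ a b → ⟪ closed ⟫ a b c → ∀ i j → fromℤ i * a + fromℤ j * b ≤ form (fromℤ i) (fromℤ j)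
    closed-slack a b (h₁ , h₂ , h₃ , h₄ , h₅ , h₆) i j with (i ℤ.≟ + 0) ×-dec (j ℤ.≟ + 0)
    ... | yes (refl , refl) = linℚ 3 (λ a b c → ([] ⊢ halfPlane (+ 0) (+ 0) a b c)) a b c
    ... | no ij≢0 = linℚ 2 (λ x y → (x ⊕ # 0 ≦ y ∷ [] ⊢ x ≦ y)) (fromℤ i * a + fromℤ j * b) (form (fromℤ i) (fromℤ j))
          (slack ℚₚ.≤-refl (+0 h₁) (+0 h₂) (+0 h₃) (+0 h₄) (+0 h₅) (+0 h₆) i j ij≢0)

    -- The least of the six slacks is a δ that works for all (i, j) at once.
    interior-slack : ∀ a b → ⟪ interior ⟫ a b c → ∀ i j → ¬ (i ≡ + 0 × j ≡ + 0) →
      fromℤ i * a + fromℤ j * b < form (fromℤ i) (fromℤ j)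
    interior-slack a b (h₁ , h₂ , h₃ , h₄ , h₅ , h₆) i j ij≢0 =
      let δ₁ , 0<δ₁ , p₁ , p₂ = lowerBound (subtract-< h₁) (subtract-< h₂)
          δ₂ , 0<δ₂ , p₃ , p₄ = lowerBound (subtract-< h₃) (subtract-< h₄)
          δ₃ , 0<δ₃ , p₅ , p₆ = lowerBound (subtract-< h₅) (subtract-< h₆)
          δ₄ , 0<δ₄ , q₁ , q₂ = lowerBound 0<δ₁ 0<δ₂
          δ , 0<δ , q₃ , q₄ = lowerBound 0<δ₃ 0<δ₄
          δ≤δ₁ = ℚₚ.≤-trans q₄ q₁
          δ≤δ₂ = ℚₚ.≤-trans q₄ q₂
      in linℚ 3 (λ x y δ → (x ⊕ δ ≦ y ∷ # 0 ⋖ δ ∷ [] ⊢ x ⋖ y)) (fromℤ i * a + fromℤ j * b) (form (fromℤ i) (fromℤ j)) δ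
        (slack (ℚₚ.<⇒≤ 0<δ) (within a 1ℚ p₁ δ≤δ₁) (within (- a) 1ℚ p₂ δ≤δ₁) (within b c p₃ δ≤δ₂)
            (within (- b) c p₄ δ≤δ₂)
          (within (b - a) c p₅ q₃) (within (a - b) c p₆ q₃) i j ij≢0) 0<δ

    data Corner : Set where
      k₀ k₁ k₂ k₃ k₄ k₅ : Corner

    next : Corner → Corner
    next k₀ = k₁
    next k₁ = k₂
    next k₂ = k₃
    next k₃ = k₄
    next k₄ = k₅
    next k₅ = k₀

    cornerα′ cornerβ′ : ∀ {n} → Corner → Expr n → Expr n
    cornerα′ k₀ c = # 1
    cornerα′ k₁ c = # 0
    cornerα′ k₂ c = ⊝ # 1
    cornerα′ k₃ c = ⊝ # 1
    cornerα′ k₄ c = # 0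
    cornerα′ k₅ c = # 1
    cornerβ′ k₀ c = c
    cornerβ′ k₁ c = c
    cornerβ′ k₂ c = c ⊖ # 1
    cornerβ′ k₃ c = ⊝ c
    cornerβ′ k₄ c = ⊝ c
    cornerβ′ k₅ c = # 1 ⊖ c

    cornerα cornerβ : Corner → ℚ
    cornerα κ = Linear.⟦_⟧ ℚ-orderedRing (cornerα′ κ (var Fin.zero)) (c Vec.∷ Vec.[])
    cornerβ κ = Linear.⟦_⟧ ℚ-orderedRing (cornerβ′ κ (var Fin.zero)) (c Vec.∷ Vec.[])

    -- the lattice point i + jω whose bisector contains the edge from κ to next κ
    normalᵢ normalⱼ : Corner → ℤ
    normalᵢ k₀ = + 0
    normalᵢ k₁ = -[1+ 0 ]
    normalᵢ k₂ = -[1+ 0 ]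
    normalᵢ k₃ = + 0
    normalᵢ k₄ = + 1
    normalᵢ k₅ = + 1
    normalⱼ k₀ = + 1
    normalⱼ k₁ = + 1
    normalⱼ k₂ = + 0
    normalⱼ k₃ = -[1+ 0 ]
    normalⱼ k₄ = -[1+ 0 ]
    normalⱼ k₅ = + 0

    atCorner : Corner → Region
    atCorner κ a b c = a ≐ cornerα′ κ c ⩓ b ≐ cornerβ′ κ c

    corners : Region
    corners a b c = atCorner k₀ a b c ⩔ atCorner k₁ a b c ⩔ atCorner k₂ a b c ⩔ atCorner k₃ a b c ⩔ atCorner k₄ a b c ⩔ atCorner k₅ a b c

    corner∈corners : ∀ κ → ⟪ corners ⟫ (cornerα κ) (cornerβ κ) c
    corner∈corners k₀ = inj₁ (refl , refl)
    corner∈corners k₁ = inj₂ (inj₁ (refl , refl))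
    corner∈corners k₂ = inj₂ (inj₂ (inj₁ (refl , refl)))
    corner∈corners k₃ = inj₂ (inj₂ (inj₂ (inj₁ (refl , refl))))
    corner∈corners k₄ = inj₂ (inj₂ (inj₂ (inj₂ (inj₁ (refl , refl)))))
    corner∈corners k₅ = inj₂ (inj₂ (inj₂ (inj₂ (inj₂ (refl , refl)))))

    Tight : ℚ → ℚ → ℤ → ℤ → Set
    Tight a b i j = fromℤ i * a + fromℤ j * b ≡ form (fromℤ i) (fromℤ j)

    private
      onBisector : ∀ {n} → Corner → Corner → Expr n → Formula n
      onBisector κ λ′ c = bisector (normalᵢ λ′) (normalⱼ λ′) (cornerα′ κ c) (cornerβ′ κ c) c

    -- The normals of the two edges that meet at the corner; they form a basis of the lattice.
    corner-normals : ∀ κ → Σ ℤ λ i → Σ ℤ λ j → Σ ℤ λ i′ → Σ ℤ λ j′ →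
      Tight (cornerα κ) (cornerβ κ) i j × Tight (cornerα κ) (cornerβ κ) i′ j′ × i ℤ.* j′ ℤ.- j ℤ.* i′ ≡ + 1
    corner-normals k₀ = normalᵢ k₅ , normalⱼ k₅ , normalᵢ k₀ , normalⱼ k₀ ,
      linℚ 1 (λ c → ([] ⊢ onBisector k₀ k₅ c)) c , linℚ 1 (λ c → ([] ⊢ onBisector k₀ k₀ c)) c , refl
    corner-normals k₁ = normalᵢ k₀ , normalⱼ k₀ , normalᵢ k₁ , normalⱼ k₁ ,
      linℚ 1 (λ c → ([] ⊢ onBisector k₁ k₀ c)) c , linℚ 1 (λ c → ([] ⊢ onBisector k₁ k₁ c)) c , refl
    corner-normals k₂ = normalᵢ k₁ , normalⱼ k₁ , normalᵢ k₂ , normalⱼ k₂ ,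
      linℚ 1 (λ c → ([] ⊢ onBisector k₂ k₁ c)) c , linℚ 1 (λ c → ([] ⊢ onBisector k₂ k₂ c)) c , refl
    corner-normals k₃ = normalᵢ k₂ , normalⱼ k₂ , normalᵢ k₃ , normalⱼ k₃ ,
      linℚ 1 (λ c → ([] ⊢ onBisector k₃ k₂ c)) c , linℚ 1 (λ c → ([] ⊢ onBisector k₃ k₃ c)) c , refl
    corner-normals k₄ = normalᵢ k₃ , normalⱼ k₃ , normalᵢ k₄ , normalⱼ k₄ ,
      linℚ 1 (λ c → ([] ⊢ onBisector k₄ k₃ c)) c , linℚ 1 (λ c → ([] ⊢ onBisector k₄ k₄ c)) c , refl
    corner-normals k₅ = normalᵢ k₄ , normalⱼ k₄ , normalᵢ k₅ , normalⱼ k₅ ,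
      linℚ 1 (λ c → ([] ⊢ onBisector k₅ k₄ c)) c , linℚ 1 (λ c → ([] ⊢ onBisector k₅ k₅ c)) c , refl

    turning edgeEnds : Corner → Region
    turning κ a b c = corners a b c ⩓
      # 0 ≦ (a ⊖ cornerα′ κ c) ⊗ (cornerβ′ (next κ) c ⊖ cornerβ′ κ c) ⊖ (b ⊖ cornerβ′ κ c) ⊗
          (cornerα′ (next κ) c ⊖ cornerα′ κ c)
    edgeEnds κ a b c = atCorner κ a b c ⩔ atCorner (next κ) a b c

    turn : ∀ κ a b → ⟪ corners ⟫ a b c →
      0ℚ ≤ (a - cornerα κ) * (cornerβ (next κ) - cornerβ κ) - (b - cornerβ κ) * (cornerα (next κ) - cornerα κ) →
      (a ≡ cornerα κ × b ≡ cornerβ κ) ⊎ (a ≡ cornerα (next κ) × b ≡ cornerβ (next κ))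
    turn k₀ a b h t = infer (turning k₀) (edgeEnds k₀) a b (h , t)
    turn k₁ a b h t = infer (turning k₁) (edgeEnds k₁) a b (h , t)
    -- On this edge α is constant and the hypothesis reads (a + 1)(2c - 1) ≤ 0. Linear arithmetic
    -- cannot divide by 2c - 1, so the sign of a + 1 is decided first.
    turn k₂ a b h t with compare a (- 1ℚ)
    ... | inj₁ on  = infer (λ a b c → corners a b c ⩓ a ≦ ⊝ # 1) (edgeEnds k₂) a b (h , on)
    ... | inj₂ off = ⊥-elim (infer (λ a b c → # 0 ⋖ (a ⊖ ⊝ # 1) ⊗ (# 2 ⊗ c ⊖ # 1) ⩓ turning k₂ a b c) (λ _ _ _ →
        ff) a b
      (*-pos (subtract-< off) 0<2c-1 , h , t))
    turn k₃ a b h t = infer (turning k₃) (edgeEnds k₃) a b (h , t)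
    turn k₄ a b h t = infer (turning k₄) (edgeEnds k₄) a b (h , t)
    turn k₅ a b h t with compare 1ℚ a
    ... | inj₁ on  = infer (λ a b c → corners a b c ⩓ # 1 ≦ a) (edgeEnds k₅) a b (h , on)
    ... | inj₂ off = ⊥-elim (infer (λ a b c → # 0 ⋖ (# 1 ⊖ a) ⊗ (# 2 ⊗ c ⊖ # 1) ⩓ turning k₅ a b c) (λ _ _ _ → ff) a b
      (*-pos (subtract-< off) 0<2c-1 , h , t))

    data Axis : Set where
      x₁ x₂ x₃ : Axis

    axisᵢ axisⱼ : Axis → ℤ
    axisᵢ x₁ = + 1
    axisᵢ x₂ = + 0
    axisᵢ x₃ = -[1+ 0 ]
    axisⱼ x₁ = + 0
    axisⱼ x₂ = + 1
    axisⱼ x₃ = + 1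

    onAxis : Axis → Region
    onAxis x₁ a b c = a ≐ # 1 ⩔ ⊝ a ≐ # 1
    onAxis x₂ a b c = b ≐ c ⩔ ⊝ b ≐ c
    onAxis x₃ a b c = b ⊖ a ≐ c ⩔ a ⊖ b ≐ c

    axis : ∀ a b {i j} → Small i j → ¬ (i ≡ + 0 × j ≡ + 0) → Tight a b i j →
      Σ Axis λ x → (Σ ℤ λ k → i ≡ k ℤ.* axisᵢ x × j ≡ k ℤ.* axisⱼ x) × ⟪ onAxis x ⟫ a b c
    axis a b origin ij≢0 _ = ⊥-elim (ij≢0 (refl , refl))
    axis a b f₁ _ t = x₁ , (+ 1 , refl , refl) , infer (bisector (+ 1) (+ 0)) (onAxis x₁) a b t
    axis a b f₂ _ t = x₂ , (+ 1 , refl , refl) , infer (bisector (+ 0) (+ 1)) (onAxis x₂) a b t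
    axis a b f₃ _ t = x₃ , (+ 1 , refl , refl) , infer (bisector -[1+ 0 ] (+ 1)) (onAxis x₃) a b t
    axis a b -f₁ _ t = x₁ , (-[1+ 0 ] , refl , refl) , infer (bisector -[1+ 0 ] (+ 0)) (onAxis x₁) a b t
    axis a b -f₂ _ t = x₂ , (-[1+ 0 ] , refl , refl) , infer (bisector (+ 0) -[1+ 0 ]) (onAxis x₂) a b t
    axis a b -f₃ _ t = x₃ , (-[1+ 0 ] , refl , refl) , infer (bisector (+ 1) -[1+ 0 ]) (onAxis x₃) a b t

    crossing : Axis → Axis → Region
    crossing x x′ a b c = closed a b c ⩓ onAxis x a b c ⩓ onAxis x′ a b c

    two-axes : ∀ a b x x′ → ¬ x ≡ x′ → ⟪ crossing x x′ ⟫ a b c → ⟪ corners ⟫ a b c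
    two-axes a b x₁ x₁ x≢x = ⊥-elim (x≢x refl)
    two-axes a b x₁ x₂ _ = infer (crossing x₁ x₂) corners a b
    two-axes a b x₁ x₃ _ = infer (crossing x₁ x₃) corners a b
    two-axes a b x₂ x₁ _ = infer (crossing x₂ x₁) corners a b
    two-axes a b x₂ x₂ x≢x = ⊥-elim (x≢x refl)
    two-axes a b x₂ x₃ _ = infer (crossing x₂ x₃) corners a b
    two-axes a b x₃ x₁ _ = infer (crossing x₃ x₁) corners a b
    two-axes a b x₃ x₂ _ = infer (crossing x₃ x₂) corners a b
    two-axes a b x₃ x₃ x≢x = ⊥-elim (x≢x refl)

    edgeα′ edgeβ′ : ∀ {n} → Corner → Expr n → Expr n → Expr n
    edgeα′ κ c r = cornerα′ κ c ⊕ r ⊗ (cornerα′ (next κ) c ⊖ cornerα′ κ c)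
    edgeβ′ κ c r = cornerβ′ κ c ⊕ r ⊗ (cornerβ′ (next κ) c ⊖ cornerβ′ κ c)

    edgeα edgeβ : Corner → ℚ → ℚ
    edgeα κ r = cornerα κ + r * (cornerα (next κ) - cornerα κ)
    edgeβ κ r = cornerβ κ + r * (cornerβ (next κ) - cornerβ κ)

    tile-edge : ∀ κ r → 1ℚ < fromℤ (+ 2) * r → r < 1ℚ → ⟪ tile ⟫ (edgeα κ r) (edgeβ κ r) c
    -- The edges from `k₂` and from `k₅` have extent 2c - 1 in β, so r occurs there multiplied by c;
    -- the two products supply what is needed about r c.
    tile-edge κ r 1<2r r<1 = on-edge κ 1≤c 1<2r r<1 (*-pos (subtract-< 1<2r) 0<2c-1) (*-pos (subtract-< r<1) 0<2c-1)
      where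
      sequent : ∀ {n} → Corner → Expr n → Expr n → Sequent n
      sequent κ c r = # 1 ≦ c ∷ # 1 ⋖ # 2 ⊗ r ∷ r ⋖ # 1 ∷ # 0 ⋖ (# 2 ⊗ r ⊖ # 1) ⊗ (# 2 ⊗ c ⊖ # 1) ∷ # 0 ⋖ (# 1 ⊖ r) ⊗
          (# 2 ⊗ c ⊖ # 1) ∷ [] ⊢
        tile (edgeα′ κ c r) (edgeβ′ κ c r) c
      on-edge : ∀ κ → 1ℚ ≤ c → 1ℚ < fromℤ (+ 2) * r → r < 1ℚ → 0ℚ < (fromℤ (+ 2) * r - 1ℚ) * (fromℤ (+ 2) * c - 1ℚ) →
        0ℚ < (1ℚ - r) * (fromℤ (+ 2) * c - 1ℚ) → ⟪ tile ⟫ (edgeα κ r) (edgeβ κ r) c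
      on-edge k₀ = linℚ 2 (sequent k₀) c r
      on-edge k₁ = linℚ 2 (sequent k₁) c r
      on-edge k₂ = linℚ 2 (sequent k₂) c r
      on-edge k₃ = linℚ 2 (sequent k₃) c r
      on-edge k₄ = linℚ 2 (sequent k₄) c r
      on-edge k₅ = linℚ 2 (sequent k₅) c r

    corner : ℕ → Corner
    corner = fold k₀ next

    midpoint : Corner → Region
    midpoint κ a b c = # 2 ⊗ a ≐ cornerα′ κ c ⊕ cornerα′ (next κ) c ⩓ # 2 ⊗ b ≐ cornerβ′ κ c ⊕ cornerβ′ (next κ) c

    tile-mid : ∀ k → suc k ℕ.≤ 3 → ∀ a b → fromℤ (+ 2) * a ≡ cornerα (corner k) + cornerα (corner (suc k)) ×
      fromℤ (+ 2) * b ≡ cornerβ (corner k) + cornerβ (corner (suc k)) → ⟪ tile ⟫ a b c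
    tile-mid 0 _ = infer (midpoint k₀) tile
    tile-mid 1 _ = infer (midpoint k₁) tile
    tile-mid 2 _ = infer (midpoint k₂) tile
    tile-mid (suc (suc (suc _))) (ℕ.s≤s (ℕ.s≤s (ℕ.s≤s ())))

    tile-corner : ∀ k → 1 ℕ.≤ k → k ℕ.≤ 2 → ⟪ tile ⟫ (cornerα (corner k)) (cornerβ (corner k)) c
    tile-corner 1 _ _ = linℚ 1 (λ c → (# 1 ≦ c ∷ [] ⊢ tile (cornerα′ k₁ c) (cornerβ′ k₁ c) c)) c 1≤c
    tile-corner 2 _ _ = linℚ 1 (λ c → (# 1 ≦ c ∷ [] ⊢ tile (cornerα′ k₂ c) (cornerβ′ k₂ c) c)) c 1≤c
    tile-corner (suc (suc (suc _))) _ (ℕ.s≤s (ℕ.s≤s ()))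

    halfEdge : ∀ {n} → Corner → Expr n → Expr n → Expr n → Expr n → Formula n
    halfEdge κ r a b c = # 1 ⋖ # 2 ⊗ r ⩓ r ⋖ # 1 ⩓ a ≐ edgeα′ κ c r ⩓ b ≐ edgeβ′ κ c r

    -- The four edges of extent 1 in α have the parameters 1 - a, -a, a + 1 and a; on the two edges
    -- with constant α the parameter comes from `ratio`.
    tile-cases : ∀ a b → ⟪ tile ⟫ a b c →
      ⟪ interior ⟫ a b c
      ⊎ (Σ ℕ λ k → Σ ℚ λ r → 1ℚ < fromℤ (+ 2) * r × r < 1ℚ × a ≡ edgeα (corner k) r × b ≡ edgeβ (corner k) r)
      ⊎ (Σ ℕ λ k → suc k ℕ.≤ 3 × fromℤ (+ 2) * a ≡ cornerα (corner k) + cornerα (corner (suc k)) ×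
          fromℤ (+ 2) * b ≡ cornerβ (corner k) + cornerβ (corner (suc k)))
      ⊎ (Σ ℕ λ k → 1 ℕ.≤ k × k ℕ.≤ 2 × a ≡ cornerα (corner k) × b ≡ cornerβ (corner k))
    tile-cases a b (inj₁ h) = inj₁ h
    tile-cases a b (inj₂ (inj₁ (b≡c , 0≤a , 2a≤1))) with ≤-split 0≤a | ≤-split 2a≤1
    ... | inj₂ 0≡a | _ = inj₂ (inj₂ (inj₂ (1 , ℕ.s≤s ℕ.z≤n , ℕ.s≤s ℕ.z≤n , infer (λ a b c → b ≐ c ⩓ # 0 ≐ a)
        (atCorner k₁) a b (b≡c , 0≡a))))
    ... | inj₁ 0<a | inj₂ 2a≡1 = inj₂ (inj₂ (inj₁ (0 , ℕ.s≤s ℕ.z≤n , infer (λ a b c → b ≐ c ⩓ # 2 ⊗ a ≐ # 1)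
        (midpoint k₀) a b (b≡c , 2a≡1))))
    ... | inj₁ 0<a | inj₁ 2a<1 = inj₂ (inj₁ (0 , 1ℚ - a , infer (λ a b c → b ≐ c ⩓ # 0 ⋖ a ⩓ # 2 ⊗ a ⋖ # 1)
        (λ a b c → halfEdge k₀ (# 1 ⊖ a) a b c) a b (b≡c , 0<a , 2a<1)))
    tile-cases a b (inj₂ (inj₂ (inj₁ (b-a≡c , -1≤a , 2a≤-1)))) with ≤-split -1≤a | ≤-split 2a≤-1
    ... | inj₂ -1≡a | _ = inj₂ (inj₂ (inj₂ (2 , ℕ.s≤s ℕ.z≤n , ℕ.s≤s (ℕ.s≤s ℕ.z≤n) , infer (λ a b c → b ⊖ a ≐ c ⩓
        ⊝ # 1 ≐ a) (atCorner k₂) a b (b-a≡c , -1≡a))))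
    ... | inj₁ -1<a | inj₂ 2a≡-1 = inj₂ (inj₂ (inj₁ (1 , ℕ.s≤s (ℕ.s≤s ℕ.z≤n) , infer (λ a b c → b ⊖ a ≐ c ⩓
        # 2 ⊗ a ≐ ⊝ # 1) (midpoint k₁) a b (b-a≡c , 2a≡-1))))
    ... | inj₁ -1<a | inj₁ 2a<-1 = inj₂ (inj₁ (1 , - a , infer (λ a b c → b ⊖ a ≐ c ⩓ ⊝ # 1 ⋖ a ⩓ # 2 ⊗ a ⋖ ⊝ # 1)
        (λ a b c → halfEdge k₁ (⊝ a) a b c) a b (b-a≡c , -1<a , 2a<-1)))
    tile-cases a b (inj₂ (inj₂ (inj₂ (inj₁ (a≡-1 , -c<b , 2b≤-1))))) with ≤-split 2b≤-1
    ... | inj₂ 2b≡-1 = inj₂ (inj₂ (inj₁ (2 , ℕ.s≤s (ℕ.s≤s (ℕ.s≤s ℕ.z≤n)) , infer (λ a b c → a ≐ ⊝ # 1 ⩓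
        # 2 ⊗ b ≐ ⊝ # 1) (midpoint k₂) a b (a≡-1 , 2b≡-1))))
    ... | inj₁ 2b<-1 =
      let r , r≡ , 1<2r , r<1 = ratio {c - 1ℚ - b} 0<2c-1 (infer (λ a b c → # 2 ⊗ b ⋖ ⊝ # 1) (λ a b c → # 2 ⊗ c ⊖ # 1 ⋖ # 2 ⊗ (c ⊖ # 1 ⊖ b)) a b 2b<-1) (infer (λ a b c → ⊝ c ⋖ b) (λ a b c → c ⊖ # 1 ⊖ b ⋖ # 2 ⊗ c ⊖ # 1) a b -c<b)
      in inj₂ (inj₁ (2 , r , 1<2r , r<1 ,
        linℚ 4 (λ a b c r → (a ≐ ⊝ # 1 ∷ r ⊗ (# 2 ⊗ c ⊖ # 1) ≐ c ⊖ # 1 ⊖ b ∷ [] ⊢ a ≐ edgeα′ k₂ c r ⩓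
            b ≐ edgeβ′ k₂ c r)) a b c r a≡-1 r≡))
    tile-cases a b (inj₂ (inj₂ (inj₂ (inj₂ (inj₁ h))))) = inj₂ (inj₁ (3 , a + 1ℚ , infer (λ a b c → b ≐ ⊝ c ⩓
        ⊝ # 1 ⋖ # 2 ⊗ a ⩓ a ⋖ # 0) (λ a b c → halfEdge k₃ (a ⊕ # 1) a b c) a b h))
    tile-cases a b (inj₂ (inj₂ (inj₂ (inj₂ (inj₂ (inj₁ h)))))) = inj₂ (inj₁ (4 , a , infer (λ a b c → a ⊖ b ≐ c ⩓
        # 1 ⋖ # 2 ⊗ a ⩓ a ⋖ # 1) (λ a b c → halfEdge k₄ (a) a b c) a b h))
    tile-cases a b (inj₂ (inj₂ (inj₂ (inj₂ (inj₂ (inj₂ (a≡1 , 1<2b , b<c))))))) =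
      let r , r≡ , 1<2r , r<1 = ratio {b + c - 1ℚ} 0<2c-1 (infer (λ a b c → # 1 ⋖ # 2 ⊗ b) (λ a b c → # 2 ⊗ c ⊖ # 1 ⋖ # 2 ⊗ (b ⊕ c ⊖ # 1)) a b 1<2b) (infer (λ a b c → b ⋖ c) (λ a b c → b ⊕ c ⊖ # 1 ⋖ # 2 ⊗ c ⊖ # 1) a b b<c)
      in inj₂ (inj₁ (5 , r , 1<2r , r<1 ,
        linℚ 4 (λ a b c r → (a ≐ # 1 ∷ r ⊗ (# 2 ⊗ c ⊖ # 1) ≐ b ⊕ c ⊖ # 1 ∷ [] ⊢ a ≐ edgeα′ k₅ c r ⩓
            b ≐ edgeβ′ k₅ c r)) a b c r a≡1 r≡))
    returns : ∀ k → 1 ℕ.≤ k → k ℕ.≤ 6 → cornerα (corner k) ≡ 1ℚ → cornerβ (corner k) ≡ c → k ≡ 6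
    returns 1 _ _ ()
    returns 2 _ _ ()
    returns 3 _ _ ()
    returns 4 _ _ ()
    returns 5 _ _ _ β≡c = ⊥-elim (linℚ 1 (λ c → (# 1 ≦ c ∷ # 1 ⊖ c ≐ c ∷ [] ⊢ ff)) c 1≤c β≡c)
    returns 6 _ _ _ _ = refl
    returns (suc (suc (suc (suc (suc (suc (suc _))))))) _ (ℕ.s≤s (ℕ.s≤s (ℕ.s≤s (ℕ.s≤s (ℕ.s≤s (ℕ.s≤s ()))))))

    closed-intro : ∀ a b → (∀ i j → fromℤ i * a + fromℤ j * b ≤ form (fromℤ i) (fromℤ j)) → ⟪ closed ⟫ a b c
    closed-intro a b h = infer (λ a b c → halfPlane (+ 1) (+ 0) a b c ⩓ halfPlane -[1+ 0 ] (+ 0) a b c ⩓ halfPlane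
        (+ 0) (+ 1) a b c ⩓ halfPlane (+ 0) -[1+ 0 ] a b c ⩓ halfPlane -[1+ 0 ] (+ 1) a b c ⩓ halfPlane
        (+ 1) -[1+ 0 ] a b c) closed a b
      (h (+ 1) (+ 0) , h -[1+ 0 ] (+ 0) , h (+ 0) (+ 1) , h (+ 0) -[1+ 0 ] , h -[1+ 0 ] (+ 1) , h (+ 1) -[1+ 0 ])

    interior-intro : ∀ a b → (∀ i j → ¬ (i ≡ + 0 × j ≡ + 0) → fromℤ i * a + fromℤ j * b < form (fromℤ i) (fromℤ j)) →
        ⟪ interior ⟫ a b c
    interior-intro a b h = infer (λ a b c → openHalfPlane (+ 1) (+ 0) a b c ⩓ openHalfPlane -[1+ 0 ] (+ 0) a b c ⩓
        openHalfPlane (+ 0) (+ 1) a b c ⩓ openHalfPlane (+ 0) -[1+ 0 ] a b c ⩓ openHalfPlane -[1+ 0 ] (+ 1) a b c ⩓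
        openHalfPlane (+ 1) -[1+ 0 ] a b c) interior a b
      (h (+ 1) (+ 0) (λ { (() , _) }) , h -[1+ 0 ] (+ 0) (λ { (() , _) }) , h (+ 0) (+ 1) (λ { (_ , ()) }) , h (+ 0) -[1+ 0 ] (λ { (_ , ()) }) , h -[1+ 0 ] (+ 1) (λ { (() , _) }) , h (+ 1) -[1+ 0 ] λ { (() , _) })

    -- ΔN ≤ c² where ΔN = cα² - αβ + β²: for α ≥ 0 because (c - β)(c + β - α) ≥ 0 and α(1 - α) ≥ 0.
    norm-bound : ∀ a b → ⟪ closed ⟫ a b c → let Δ = fromℤ (+ 4) * c - 1ℚ * 1ℚ in
      fromℤ (+ 16) * (c * (a * a) - 1ℚ * (a * b) + b * b) ≤ Δ * (Δ + fromℤ (+ 4))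
    norm-bound a b (a≤1 , -a≤1 , b≤c , -b≤c , b-a≤c , a-b≤c) with ℚₚ.≤-total 0ℚ a
    ... | inj₁ 0≤a = linℚ 3 (λ a b c → (# 1 ≦ c ∷ # 0 ≦ (c ⊖ b) ⊗ (c ⊖ (a ⊖ b)) ∷ # 0 ≦ c ⊗ (a ⊗ (# 1 ⊖ a)) ∷ [] ⊢
          # 16 ⊗ (c ⊗ (a ⊗ a) ⊖ # 1 ⊗ (a ⊗ b) ⊕ b ⊗ b) ≦ (# 4 ⊗ c ⊖ # 1 ⊗ # 1) ⊗ (# 4 ⊗ c ⊖ # 1 ⊗ # 1 ⊕ # 4))) a b c
        1≤c (*-nonNeg (subtract-≤ b≤c) (subtract-≤ a-b≤c)) (*-nonNeg 0≤c (*-nonNeg 0≤a (subtract-≤ a≤1)))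
    ... | inj₂ a≤0 = linℚ 3 (λ a b c → (# 1 ≦ c ∷ # 0 ≦ (c ⊖ ⊝ b) ⊗ (c ⊖ (b ⊖ a)) ∷ # 0 ≦ c ⊗ ((# 0 ⊖ a) ⊗
        (# 1 ⊖ ⊝ a)) ∷ [] ⊢
          # 16 ⊗ (c ⊗ (a ⊗ a) ⊖ # 1 ⊗ (a ⊗ b) ⊕ b ⊗ b) ≦ (# 4 ⊗ c ⊖ # 1 ⊗ # 1) ⊗ (# 4 ⊗ c ⊖ # 1 ⊗ # 1 ⊕ # 4))) a b c
        1≤c (*-nonNeg (subtract-≤ -b≤c) (subtract-≤ b-a≤c)) (*-nonNeg 0≤c (*-nonNeg (subtract-≤ a≤0)
            (subtract-≤ -a≤1)))

    hexagon : Cell (fromℤ (+ 1)) c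
    hexagon = record
      { closed = closed ; interior = interior ; tile = tile ; corners = corners
      ; Corner = Corner ; start = k₀ ; next = next ; cornerα = cornerα ; cornerβ = cornerβ ; sides = 6
      ; Axis = Axis ; axisᵢ = axisᵢ ; axisⱼ = axisⱼ ; onAxis = onAxis
      ; closed-intro = closed-intro ; closed-slack = closed-slack
      ; interior-intro = interior-intro ; interior-slack = interior-slack
      ; interior⇒tile = λ _ _ → inj₁ ; tile⇒closed = infer tile closed ; norm-bound = norm-bound
      ; no-translate = λ a b i j ij≢0 t t′ →
          disjoint (small a b i j (infer tile closed a b t) (infer tile closed (a - shiftα i j)
              (b - shiftβ i j) t′)) ij≢0 a b (t , t′)
      ; reducible = λ a b a≤1 -a≤1 lo hi → strip⇒reducible a b (a≤1 , -a≤1 , lo , hi)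
      ; corner∈corners = corner∈corners ; corners⇒closed = infer corners closed ; corner-normals = corner-normals
      ; direction = λ a b i j ij≢0 h h′ → axis a b (small a b i j h h′) ij≢0
      ; two-axes = λ a b x x′ x≢x′ h on on′ → two-axes a b x x′ x≢x′ (h , on , on′)
      ; turn = turn
      ; first-corner = λ a b h α≡1 above → infer (λ a b c → corners a b c ⩓ a ≐ # 1 ⩓ # 0 ⋖ # 2 ⊗ b ⊖ # 1 ⊗ a)
          (atCorner k₀) a b (h , α≡1 , above)
      ; 1<sides = ℕ.s≤s (ℕ.s≤s ℕ.z≤n) ; returns = returns ; full-turn = refl
      ; tile-edge = tile-edge ; tile-mid = tile-mid ; tile-corner = tile-corner ; tile-cases = tile-cases
      }

  -- The rectangular cell (even p)

  module Rectangle (c : ℚ) (1≤c : 1ℚ ≤ c) where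

    open CellSyntax 0 c 1≤c
    open Translation (fromℤ (+ 0)) c

    -- For m = 4 the midpoints 0, 1 and the vertex 1 belong to the restricted cell; all four corners
    -- are congruent modulo the lattice.
    closed interior tile : Region
    closed a b c = a ≦ # 1 ⩓ ⊝ a ≦ # 1 ⩓ b ≦ c ⩓ ⊝ b ≦ c
    interior a b c = a ⋖ # 1 ⩓ ⊝ a ⋖ # 1 ⩓ b ⋖ c ⩓ ⊝ b ⋖ c
    tile a b c =
      interior a b c
      ⩔ (b ≐ c ⩓ ⊝ # 1 ≦ a ⩓ a ≦ # 0)
      ⩔ (a ≐ ⊝ # 1 ⩓ ⊝ c ⋖ b ⩓ b ≦ # 0)
      ⩔ (b ≐ ⊝ c ⩓ # 0 ⋖ a ⩓ a ⋖ # 1)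
      ⩔ (a ≐ # 1 ⩓ # 0 ⋖ b ⩓ b ⋖ c)

    -- The diagonal vectors are not normals of edges, but the translates of the cell by them touch
    -- it in a corner.
    data Small : ℤ → ℤ → Set where
      origin : Small (+ 0) (+ 0)
      e₁     : Small (+ 1) (+ 0)
      e₂     : Small (+ 0) (+ 1)
      e₃     : Small (+ 1) (+ 1)
      e₄     : Small -[1+ 0 ] (+ 1)
      -e₁    : Small -[1+ 0 ] (+ 0)
      -e₂    : Small (+ 0) -[1+ 0 ]
      -e₃    : Small -[1+ 0 ] -[1+ 0 ]
      -e₄    : Small (+ 1) -[1+ 0 ]

    0<2c : 0ℚ < fromℤ (+ 2) * c
    0<2c = linℚ 1 (λ c → (# 1 ≦ c ∷ [] ⊢ # 0 ⋖ # 2 ⊗ c)) c 1≤c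

    small : ∀ a b i j → ⟪ closed ⟫ a b c → ⟪ closed ⟫ (a - shiftα i j) (b - shiftβ i j) c → Small i j
    small a b i j (a≤1 , -a≤1 , b≤c , -b≤c) (a′≤1 , -a′≤1 , b′≤c , -b′≤c) =
      classify (trit j j> j<) (trit i (proj₁ i-bounds) (proj₂ i-bounds))
      where
      I J : ℚ
      I = fromℤ i
      J = fromℤ j
      j< : J < fromℤ (+ 2)
      j< = ℚₚ.≰⇒> λ 2≤J → linℚ 4 (λ b c i j → (# 1 ≦ c ∷ # 0 ≦ c ⊗ (j ⊖ # 2) ∷ b ≦ c ∷
          ⊝ (b ⊖ (# 0 ⊗ i ⊕ # 2 ⊗ c ⊗ j)) ≦ c ∷ [] ⊢ ff)) b c I J
        1≤c (*-nonNeg 0≤c (subtract-≤ 2≤J)) b≤c -b′≤c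
      j> : fromℤ -[1+ 1 ] < J
      j> = ℚₚ.≰⇒> λ J≤-2 → linℚ 4 (λ b c i j → (# 1 ≦ c ∷ # 0 ≦ c ⊗ (⊝ # 2 ⊖ j) ∷ ⊝ b ≦ c ∷
          (b ⊖ (# 0 ⊗ i ⊕ # 2 ⊗ c ⊗ j)) ≦ c ∷ [] ⊢ ff)) b c I J
        1≤c (*-nonNeg 0≤c (subtract-≤ J≤-2)) -b≤c b′≤c
      i-bounds : (fromℤ -[1+ 1 ] < I) × (I < fromℤ (+ 2))
      i-bounds = linℚ 3 (λ a i j → (a ≦ # 1 ∷ ⊝ a ≦ # 1 ∷ (a ⊖ (# 2 ⊗ i ⊕ # 0 ⊗ j)) ≦ # 1 ∷
          ⊝ (a ⊖ (# 2 ⊗ i ⊕ # 0 ⊗ j)) ≦ # 1 ∷ [] ⊢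
        ⊝ # 2 ⋖ i ⩓ i ⋖ # 2)) a I J a≤1 -a≤1 a′≤1 -a′≤1
      classify : j ≡ + 0 ⊎ j ≡ + 1 ⊎ j ≡ -[1+ 0 ] → i ≡ + 0 ⊎ i ≡ + 1 ⊎ i ≡ -[1+ 0 ] → Small i j
      classify (inj₁ refl) (inj₁ refl) = origin
      classify (inj₁ refl) (inj₂ (inj₁ refl)) = e₁
      classify (inj₁ refl) (inj₂ (inj₂ refl)) = -e₁
      classify (inj₂ (inj₁ refl)) (inj₁ refl) = e₂
      classify (inj₂ (inj₁ refl)) (inj₂ (inj₁ refl)) = e₃
      classify (inj₂ (inj₁ refl)) (inj₂ (inj₂ refl)) = e₄
      classify (inj₂ (inj₂ refl)) (inj₁ refl) = -e₂
      classify (inj₂ (inj₂ refl)) (inj₂ (inj₁ refl)) = -e₄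
      classify (inj₂ (inj₂ refl)) (inj₂ (inj₂ refl)) = -e₃

    disjoint : ∀ {i j} → Small i j → ¬ (i ≡ + 0 × j ≡ + 0) → ∀ a b →
      ⟪ tile ⟫ a b c × ⟪ tile ⟫ (a - shiftα i j) (b - shiftβ i j) c → ⊥
    disjoint origin ij≢0 = ⊥-elim (ij≢0 (refl , refl))
    disjoint e₁ _ = infer (λ a b c → tile a b c ⩓ translated (+ 1) (+ 0) tile a b c) (λ _ _ _ → ff)
    disjoint e₂ _ = infer (λ a b c → tile a b c ⩓ translated (+ 0) (+ 1) tile a b c) (λ _ _ _ → ff)
    disjoint e₃ _ = infer (λ a b c → tile a b c ⩓ translated (+ 1) (+ 1) tile a b c) (λ _ _ _ → ff)
    disjoint e₄ _ = infer (λ a b c → tile a b c ⩓ translated -[1+ 0 ] (+ 1) tile a b c) (λ _ _ _ → ff)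
    disjoint -e₁ _ = infer (λ a b c → tile a b c ⩓ translated -[1+ 0 ] (+ 0) tile a b c) (λ _ _ _ → ff)
    disjoint -e₂ _ = infer (λ a b c → tile a b c ⩓ translated (+ 0) -[1+ 0 ] tile a b c) (λ _ _ _ → ff)
    disjoint -e₃ _ = infer (λ a b c → tile a b c ⩓ translated -[1+ 0 ] -[1+ 0 ] tile a b c) (λ _ _ _ → ff)
    disjoint -e₄ _ = infer (λ a b c → tile a b c ⩓ translated (+ 1) -[1+ 0 ] tile a b c) (λ _ _ _ → ff)

    reducible-edge₀ : ∀ a b → ⟪ (λ a b c → b ≐ c ⩓ closed a b c) ⟫ a b c → Reducible tile a b
    reducible-edge₀ a b (b≡c , h) with compare a 0ℚ | ≤-split (proj₁ h)
    ... | inj₁ a≤0 | _ = + 0 , + 0 , infer (λ a b c → b ≐ c ⩓ closed a b c ⩓ a ≦ # 0) (translated (+ 0)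
        (+ 0) tile) a b (b≡c , h , a≤0)
    ... | inj₂ 0<a | inj₁ a<1 = + 0 , + 1 , infer (λ a b c → b ≐ c ⩓ # 0 ⋖ a ⩓ a ⋖ # 1) (translated (+ 0)
        (+ 1) tile) a b (b≡c , 0<a , a<1)
    ... | inj₂ 0<a | inj₂ a≡1 = + 1 , + 0 , infer (λ a b c → b ≐ c ⩓ a ≐ # 1) (translated (+ 1) (+ 0) tile) a b
        (b≡c , a≡1)

    reducible-edge₁ : ∀ a b → ⟪ (λ a b c → ⊝ a ≐ # 1 ⩓ ⊝ b ⋖ c ⩓ b ⋖ c) ⟫ a b c → Reducible tile a b
    reducible-edge₁ a b h with compare b 0ℚ
    ... | inj₁ b≤0 = + 0 , + 0 , infer (λ a b c → (⊝ a ≐ # 1 ⩓ ⊝ b ⋖ c ⩓ b ⋖ c) ⩓ b ≦ # 0) (translated (+ 0)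
        (+ 0) tile) a b (h , b≤0)
    ... | inj₂ 0<b = -[1+ 0 ] , + 0 , infer (λ a b c → (⊝ a ≐ # 1 ⩓ ⊝ b ⋖ c ⩓ b ⋖ c) ⩓ # 0 ⋖ b) (translated -[1+ 0 ]
        (+ 0) tile) a b (h , 0<b)

    closed⇒reducible : ∀ a b → ⟪ closed ⟫ a b c → Reducible tile a b
    closed⇒reducible a b h@(a≤1 , -a≤1 , b≤c , -b≤c) with ≤-split b≤c | ≤-split -b≤c | ≤-split -a≤1 | ≤-split a≤1
    ... | inj₂ b≡c | _ | _ | _ = reducible-edge₀ a b (b≡c , h)
    ... | inj₁ _ | inj₂ -b≡c | _ | _ = shifted tile {a} {b} (+ 0) -[1+ 0 ] (reducible-edge₀ (a - shiftα
        (+ 0) -[1+ 0 ]) (b - shiftβ (+ 0) -[1+ 0 ])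
      (infer (λ a b c → closed a b c ⩓ ⊝ b ≐ c) (translated (+ 0) -[1+ 0 ] (λ a b c → b ≐ c ⩓ closed a b c)) a b
          (h , -b≡c)))
    ... | inj₁ b<c | inj₁ -b<c | inj₂ -a≡1 | _ = reducible-edge₁ a b (-a≡1 , -b<c , b<c)
    ... | inj₁ b<c | inj₁ -b<c | inj₁ _ | inj₂ a≡1 = shifted tile {a} {b} (+ 1) (+ 0) (reducible-edge₁ (a - shiftα
        (+ 1) (+ 0)) (b - shiftβ (+ 1) (+ 0))
      (infer (λ a b c → a ≐ # 1 ⩓ ⊝ b ⋖ c ⩓ b ⋖ c) (translated (+ 1) (+ 0) (λ a b c → ⊝ a ≐ # 1 ⩓ ⊝ b ⋖ c ⩓
          b ⋖ c)) a b (a≡1 , -b<c , b<c)))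
    ... | inj₁ b<c | inj₁ -b<c | inj₁ -a<1 | inj₁ a<1 = + 0 , + 0 , infer interior (translated (+ 0) (+ 0) tile) a b
        (a<1 , -a<1 , b<c , -b<c)

    -- 1 and ω are orthogonal, so two quadrants suffice and g = 0 in `cone`.
    slack⁺ : ∀ {a b δ} → 0ℚ ≤ δ → a + δ ≤ 1ℚ → - a + δ ≤ 1ℚ → b + δ ≤ c →
      ∀ i j → + 0 ℤ.≤ j → ¬ (i ≡ + 0 × j ≡ + 0) → fromℤ i * a + fromℤ j * b + δ ≤ form (fromℤ i) (fromℤ j)
    slack⁺ {a} {b} {δ} 0≤δ h₁ h₂ h₃ i j 0≤j ij≢0 with ℤₚ.≤-total (+ 0) i
    ... | inj₁ 0≤i = linℚ 6 (λ a b c δ i j →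
          (i ⊗ a ⊕ j ⊗ b ⊕ δ ≦ # 1 ⊗ (i ⊗ i) ⊕ # 0 ⊗ (i ⊗ j) ⊕ c ⊗ (j ⊗ j) ∷ [] ⊢
           i ⊗ a ⊕ j ⊗ b ⊕ δ ≦ i ⊗ i ⊕ # 0 ⊗ (i ⊗ j) ⊕ c ⊗ (j ⊗ j))) a b c δ (fromℤ i) (fromℤ j)
        (cone {1ℚ} {c} {0ℚ} {a} {b} {δ} i j 0≤i 0≤j ij≢0 0≤1 0≤c ℚₚ.≤-refl 0≤δ h₁ h₃)
    ... | inj₂ i≤0 = linℚ 6 (λ a b c δ i j →
          (⊝ i ⊗ ⊝ a ⊕ j ⊗ b ⊕ δ ≦ # 1 ⊗ (⊝ i ⊗ ⊝ i) ⊕ # 0 ⊗ (⊝ i ⊗ j) ⊕ c ⊗ (j ⊗ j) ∷ [] ⊢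
           i ⊗ a ⊕ j ⊗ b ⊕ δ ≦ i ⊗ i ⊕ # 0 ⊗ (i ⊗ j) ⊕ c ⊗ (j ⊗ j))) a b c δ (fromℤ i) (fromℤ j)
        (subst (λ M → M * - a + fromℤ j * b + δ ≤ 1ℚ * (M * M) + 0ℚ * (M * fromℤ j) + c * (fromℤ j * fromℤ j))
            (fromℤ-neg i)
          (cone {1ℚ} {c} {0ℚ} { - a} {b} {δ} (ℤ.- i) j (ℤₚ.neg-mono-≤ i≤0) 0≤j
            (λ (-i≡0 , j≡0) → ij≢0 (ℤₚ.neg-injective -i≡0 , j≡0)) 0≤1 0≤c ℚₚ.≤-refl 0≤δ h₂ h₃))

    slack : ∀ {a b δ} → 0ℚ ≤ δ → a + δ ≤ 1ℚ → - a + δ ≤ 1ℚ → b + δ ≤ c → - b + δ ≤ c →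
      ∀ i j → ¬ (i ≡ + 0 × j ≡ + 0) → fromℤ i * a + fromℤ j * b + δ ≤ form (fromℤ i) (fromℤ j)
    slack {a} {b} {δ} 0≤δ h₁ h₂ h₃ h₄ i j ij≢0 with ℤₚ.≤-total (+ 0) j
    ... | inj₁ 0≤j = slack⁺ 0≤δ h₁ h₂ h₃ i j 0≤j ij≢0
    ... | inj₂ j≤0 = linℚ 6 (λ a b c δ i j →
          (⊝ i ⊗ ⊝ a ⊕ ⊝ j ⊗ ⊝ b ⊕ δ ≦ ⊝ i ⊗ ⊝ i ⊕ # 0 ⊗ (⊝ i ⊗ ⊝ j) ⊕ c ⊗ (⊝ j ⊗ ⊝ j) ∷ [] ⊢
           i ⊗ a ⊕ j ⊗ b ⊕ δ ≦ i ⊗ i ⊕ # 0 ⊗ (i ⊗ j) ⊕ c ⊗ (j ⊗ j))) a b c δ (fromℤ i) (fromℤ j)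
        (subst₂ (λ I J → I * - a + J * - b + δ ≤ form I J) (fromℤ-neg i) (fromℤ-neg j)
          (slack⁺ { - a} { - b} {δ} 0≤δ h₂
            (linℚ 2 (λ a δ → (a ⊕ δ ≦ # 1 ∷ [] ⊢ ⊝ (⊝ a) ⊕ δ ≦ # 1)) a δ h₁) h₄
            (ℤ.- i) (ℤ.- j) (ℤₚ.neg-mono-≤ j≤0)
            λ (-i≡0 , -j≡0) → ij≢0 (ℤₚ.neg-injective -i≡0 , ℤₚ.neg-injective -j≡0)))

    closed-slack : ∀ a b → ⟪ closed ⟫ a b c → ∀ i j → fromℤ i * a + fromℤ j * b ≤ form (fromℤ i) (fromℤ j)
    closed-slack a b (h₁ , h₂ , h₃ , h₄) i j with (i ℤ.≟ + 0) ×-dec (j ℤ.≟ + 0)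
    ... | yes (refl , refl) = linℚ 3 (λ a b c → ([] ⊢ halfPlane (+ 0) (+ 0) a b c)) a b c
    ... | no ij≢0 = linℚ 2 (λ x y → (x ⊕ # 0 ≦ y ∷ [] ⊢ x ≦ y)) (fromℤ i * a + fromℤ j * b) (form (fromℤ i) (fromℤ j))
          (slack ℚₚ.≤-refl (+0 h₁) (+0 h₂) (+0 h₃) (+0 h₄) i j ij≢0)

    interior-slack : ∀ a b → ⟪ interior ⟫ a b c → ∀ i j → ¬ (i ≡ + 0 × j ≡ + 0) →
      fromℤ i * a + fromℤ j * b < form (fromℤ i) (fromℤ j)
    interior-slack a b (h₁ , h₂ , h₃ , h₄) i j ij≢0 =
      let δ₁ , 0<δ₁ , p₁ , p₂ = lowerBound (subtract-< h₁) (subtract-< h₂)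
          δ₂ , 0<δ₂ , p₃ , p₄ = lowerBound (subtract-< h₃) (subtract-< h₄)
          δ , 0<δ , q₁ , q₂ = lowerBound 0<δ₁ 0<δ₂
      in linℚ 3 (λ x y δ → (x ⊕ δ ≦ y ∷ # 0 ⋖ δ ∷ [] ⊢ x ⋖ y)) (fromℤ i * a + fromℤ j * b) (form (fromℤ i) (fromℤ j)) δ
        (slack (ℚₚ.<⇒≤ 0<δ) (within a 1ℚ p₁ q₁) (within (- a) 1ℚ p₂ q₁) (within b c p₃ q₂)
            (within (- b) c p₄ q₂) i j ij≢0) 0<δ

    data Corner : Set where
      k₀ k₁ k₂ k₃ : Corner

    next : Corner → Corner
    next k₀ = k₁
    next k₁ = k₂
    next k₂ = k₃
    next k₃ = k₀

    cornerα′ cornerβ′ : ∀ {n} → Corner → Expr n → Expr n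
    cornerα′ k₀ c = # 1
    cornerα′ k₁ c = ⊝ # 1
    cornerα′ k₂ c = ⊝ # 1
    cornerα′ k₃ c = # 1
    cornerβ′ k₀ c = c
    cornerβ′ k₁ c = c
    cornerβ′ k₂ c = ⊝ c
    cornerβ′ k₃ c = ⊝ c

    cornerα cornerβ : Corner → ℚ
    cornerα κ = Linear.⟦_⟧ ℚ-orderedRing (cornerα′ κ (var Fin.zero)) (c Vec.∷ Vec.[])
    cornerβ κ = Linear.⟦_⟧ ℚ-orderedRing (cornerβ′ κ (var Fin.zero)) (c Vec.∷ Vec.[])

    normalᵢ normalⱼ : Corner → ℤ
    normalᵢ k₀ = + 0
    normalᵢ k₁ = -[1+ 0 ]
    normalᵢ k₂ = + 0
    normalᵢ k₃ = + 1
    normalⱼ k₀ = + 1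
    normalⱼ k₁ = + 0
    normalⱼ k₂ = -[1+ 0 ]
    normalⱼ k₃ = + 0

    atCorner : Corner → Region
    atCorner κ a b c = a ≐ cornerα′ κ c ⩓ b ≐ cornerβ′ κ c

    corners : Region
    corners a b c = atCorner k₀ a b c ⩔ atCorner k₁ a b c ⩔ atCorner k₂ a b c ⩔ atCorner k₃ a b c

    corner∈corners : ∀ κ → ⟪ corners ⟫ (cornerα κ) (cornerβ κ) c
    corner∈corners k₀ = inj₁ (refl , refl)
    corner∈corners k₁ = inj₂ (inj₁ (refl , refl))
    corner∈corners k₂ = inj₂ (inj₂ (inj₁ (refl , refl)))
    corner∈corners k₃ = inj₂ (inj₂ (inj₂ (refl , refl)))

    Tight : ℚ → ℚ → ℤ → ℤ → Set
    Tight a b i j = fromℤ i * a + fromℤ j * b ≡ form (fromℤ i) (fromℤ j)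

    private
      onBisector : ∀ {n} → Corner → Corner → Expr n → Formula n
      onBisector κ λ′ c = bisector (normalᵢ λ′) (normalⱼ λ′) (cornerα′ κ c) (cornerβ′ κ c) c

    corner-normals : ∀ κ → Σ ℤ λ i → Σ ℤ λ j → Σ ℤ λ i′ → Σ ℤ λ j′ →
      Tight (cornerα κ) (cornerβ κ) i j × Tight (cornerα κ) (cornerβ κ) i′ j′ × i ℤ.* j′ ℤ.- j ℤ.* i′ ≡ + 1
    corner-normals k₀ = normalᵢ k₃ , normalⱼ k₃ , normalᵢ k₀ , normalⱼ k₀ ,
      linℚ 1 (λ c → ([] ⊢ onBisector k₀ k₃ c)) c , linℚ 1 (λ c → ([] ⊢ onBisector k₀ k₀ c)) c , refl
    corner-normals k₁ = normalᵢ k₀ , normalⱼ k₀ , normalᵢ k₁ , normalⱼ k₁ ,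
      linℚ 1 (λ c → ([] ⊢ onBisector k₁ k₀ c)) c , linℚ 1 (λ c → ([] ⊢ onBisector k₁ k₁ c)) c , refl
    corner-normals k₂ = normalᵢ k₁ , normalⱼ k₁ , normalᵢ k₂ , normalⱼ k₂ ,
      linℚ 1 (λ c → ([] ⊢ onBisector k₂ k₁ c)) c , linℚ 1 (λ c → ([] ⊢ onBisector k₂ k₂ c)) c , refl
    corner-normals k₃ = normalᵢ k₂ , normalⱼ k₂ , normalᵢ k₃ , normalⱼ k₃ ,
      linℚ 1 (λ c → ([] ⊢ onBisector k₃ k₂ c)) c , linℚ 1 (λ c → ([] ⊢ onBisector k₃ k₃ c)) c , refl

    turning edgeEnds : Corner → Region
    turning κ a b c = corners a b c ⩓
      # 0 ≦ (a ⊖ cornerα′ κ c) ⊗ (cornerβ′ (next κ) c ⊖ cornerβ′ κ c) ⊖ (b ⊖ cornerβ′ κ c) ⊗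
          (cornerα′ (next κ) c ⊖ cornerα′ κ c)
    edgeEnds κ a b c = atCorner κ a b c ⩔ atCorner (next κ) a b c

    turn : ∀ κ a b → ⟪ corners ⟫ a b c →
      0ℚ ≤ (a - cornerα κ) * (cornerβ (next κ) - cornerβ κ) - (b - cornerβ κ) * (cornerα (next κ) - cornerα κ) →
      (a ≡ cornerα κ × b ≡ cornerβ κ) ⊎ (a ≡ cornerα (next κ) × b ≡ cornerβ (next κ))
    turn k₀ a b h t = infer (turning k₀) (edgeEnds k₀) a b (h , t)
    turn k₁ a b h t with compare a (- 1ℚ)
    ... | inj₁ on  = infer (λ a b c → corners a b c ⩓ a ≦ ⊝ # 1) (edgeEnds k₁) a b (h , on)
    ... | inj₂ off = ⊥-elim (infer (λ a b c → # 0 ⋖ (a ⊖ ⊝ # 1) ⊗ (# 2 ⊗ c) ⩓ turning k₁ a b c) (λ _ _ _ → ff) a b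
      (*-pos (subtract-< off) 0<2c , h , t))
    turn k₂ a b h t = infer (turning k₂) (edgeEnds k₂) a b (h , t)
    turn k₃ a b h t with compare 1ℚ a
    ... | inj₁ on  = infer (λ a b c → corners a b c ⩓ # 1 ≦ a) (edgeEnds k₃) a b (h , on)
    ... | inj₂ off = ⊥-elim (infer (λ a b c → # 0 ⋖ (# 1 ⊖ a) ⊗ (# 2 ⊗ c) ⩓ turning k₃ a b c) (λ _ _ _ → ff) a b
      (*-pos (subtract-< off) 0<2c , h , t))

    -- The diagonals `x₃`, `x₄` are included because `IsVertex` admits any two independent tying
    -- vectors, and at a corner a diagonal vector ties with 0 as well.
    data Axis : Set where
      x₁ x₂ x₃ x₄ : Axis

    axisᵢ axisⱼ : Axis → ℤ
    axisᵢ x₁ = + 1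
    axisᵢ x₂ = + 0
    axisᵢ x₃ = + 1
    axisᵢ x₄ = -[1+ 0 ]
    axisⱼ x₁ = + 0
    axisⱼ x₂ = + 1
    axisⱼ x₃ = + 1
    axisⱼ x₄ = + 1

    onAxis : Axis → Region
    onAxis x₁ a b c = a ≐ # 1 ⩔ ⊝ a ≐ # 1
    onAxis x₂ a b c = b ≐ c ⩔ ⊝ b ≐ c
    onAxis x₃ a b c = a ⊕ b ≐ # 1 ⊕ c ⩔ ⊝ a ⊖ b ≐ # 1 ⊕ c
    onAxis x₄ a b c = b ⊖ a ≐ # 1 ⊕ c ⩔ a ⊖ b ≐ # 1 ⊕ c

    axis : ∀ a b {i j} → Small i j → ¬ (i ≡ + 0 × j ≡ + 0) → Tight a b i j →
      Σ Axis λ x → (Σ ℤ λ k → i ≡ k ℤ.* axisᵢ x × j ≡ k ℤ.* axisⱼ x) × ⟪ onAxis x ⟫ a b c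
    axis a b origin ij≢0 _ = ⊥-elim (ij≢0 (refl , refl))
    axis a b e₁ _ t = x₁ , (+ 1 , refl , refl) , infer (bisector (+ 1) (+ 0)) (onAxis x₁) a b t
    axis a b e₂ _ t = x₂ , (+ 1 , refl , refl) , infer (bisector (+ 0) (+ 1)) (onAxis x₂) a b t
    axis a b e₃ _ t = x₃ , (+ 1 , refl , refl) , infer (bisector (+ 1) (+ 1)) (onAxis x₃) a b t
    axis a b e₄ _ t = x₄ , (+ 1 , refl , refl) , infer (bisector -[1+ 0 ] (+ 1)) (onAxis x₄) a b t
    axis a b -e₁ _ t = x₁ , (-[1+ 0 ] , refl , refl) , infer (bisector -[1+ 0 ] (+ 0)) (onAxis x₁) a b t
    axis a b -e₂ _ t = x₂ , (-[1+ 0 ] , refl , refl) , infer (bisector (+ 0) -[1+ 0 ]) (onAxis x₂) a b t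
    axis a b -e₃ _ t = x₃ , (-[1+ 0 ] , refl , refl) , infer (bisector -[1+ 0 ] -[1+ 0 ]) (onAxis x₃) a b t
    axis a b -e₄ _ t = x₄ , (-[1+ 0 ] , refl , refl) , infer (bisector (+ 1) -[1+ 0 ]) (onAxis x₄) a b t

    crossing : Axis → Axis → Region
    crossing x x′ a b c = closed a b c ⩓ onAxis x a b c ⩓ onAxis x′ a b c

    two-axes : ∀ a b x x′ → ¬ x ≡ x′ → ⟪ crossing x x′ ⟫ a b c → ⟪ corners ⟫ a b c
    two-axes a b x₁ x₁ x≢x = ⊥-elim (x≢x refl)
    two-axes a b x₁ x₂ _ = infer (crossing x₁ x₂) corners a b
    two-axes a b x₁ x₃ _ = infer (crossing x₁ x₃) corners a b
    two-axes a b x₁ x₄ _ = infer (crossing x₁ x₄) corners a b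
    two-axes a b x₂ x₁ _ = infer (crossing x₂ x₁) corners a b
    two-axes a b x₂ x₂ x≢x = ⊥-elim (x≢x refl)
    two-axes a b x₂ x₃ _ = infer (crossing x₂ x₃) corners a b
    two-axes a b x₂ x₄ _ = infer (crossing x₂ x₄) corners a b
    two-axes a b x₃ x₁ _ = infer (crossing x₃ x₁) corners a b
    two-axes a b x₃ x₂ _ = infer (crossing x₃ x₂) corners a b
    two-axes a b x₃ x₃ x≢x = ⊥-elim (x≢x refl)
    two-axes a b x₃ x₄ _ = infer (crossing x₃ x₄) corners a b
    two-axes a b x₄ x₁ _ = infer (crossing x₄ x₁) corners a b
    two-axes a b x₄ x₂ _ = infer (crossing x₄ x₂) corners a b
    two-axes a b x₄ x₃ _ = infer (crossing x₄ x₃) corners a b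
    two-axes a b x₄ x₄ x≢x = ⊥-elim (x≢x refl)

    edgeα′ edgeβ′ : ∀ {n} → Corner → Expr n → Expr n → Expr n
    edgeα′ κ c r = cornerα′ κ c ⊕ r ⊗ (cornerα′ (next κ) c ⊖ cornerα′ κ c)
    edgeβ′ κ c r = cornerβ′ κ c ⊕ r ⊗ (cornerβ′ (next κ) c ⊖ cornerβ′ κ c)

    edgeα edgeβ : Corner → ℚ → ℚ
    edgeα κ r = cornerα κ + r * (cornerα (next κ) - cornerα κ)
    edgeβ κ r = cornerβ κ + r * (cornerβ (next κ) - cornerβ κ)

    tile-edge : ∀ κ r → 1ℚ < fromℤ (+ 2) * r → r < 1ℚ → ⟪ tile ⟫ (edgeα κ r) (edgeβ κ r) c
    tile-edge κ r 1<2r r<1 = on-edge κ 1≤c 1<2r r<1 (*-pos (subtract-< 1<2r) 0<2c) (*-pos (subtract-< r<1) 0<2c)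
      where
      sequent : ∀ {n} → Corner → Expr n → Expr n → Sequent n
      sequent κ c r = # 1 ≦ c ∷ # 1 ⋖ # 2 ⊗ r ∷ r ⋖ # 1 ∷ # 0 ⋖ (# 2 ⊗ r ⊖ # 1) ⊗ (# 2 ⊗ c) ∷ # 0 ⋖ (# 1 ⊖ r) ⊗
          (# 2 ⊗ c) ∷ [] ⊢
        tile (edgeα′ κ c r) (edgeβ′ κ c r) c
      on-edge : ∀ κ → 1ℚ ≤ c → 1ℚ < fromℤ (+ 2) * r → r < 1ℚ → 0ℚ < (fromℤ (+ 2) * r - 1ℚ) * (fromℤ (+ 2) * c) →
        0ℚ < (1ℚ - r) * (fromℤ (+ 2) * c) → ⟪ tile ⟫ (edgeα κ r) (edgeβ κ r) c
      on-edge k₀ = linℚ 2 (sequent k₀) c r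
      on-edge k₁ = linℚ 2 (sequent k₁) c r
      on-edge k₂ = linℚ 2 (sequent k₂) c r
      on-edge k₃ = linℚ 2 (sequent k₃) c r

    corner : ℕ → Corner
    corner = fold k₀ next

    midpoint : Corner → Region
    midpoint κ a b c = # 2 ⊗ a ≐ cornerα′ κ c ⊕ cornerα′ (next κ) c ⩓ # 2 ⊗ b ≐ cornerβ′ κ c ⊕ cornerβ′ (next κ) c

    tile-mid : ∀ k → suc k ℕ.≤ 2 → ∀ a b → fromℤ (+ 2) * a ≡ cornerα (corner k) + cornerα (corner (suc k)) ×
      fromℤ (+ 2) * b ≡ cornerβ (corner k) + cornerβ (corner (suc k)) → ⟪ tile ⟫ a b c
    tile-mid 0 _ = infer (midpoint k₀) tile
    tile-mid 1 _ = infer (midpoint k₁) tile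
    tile-mid (suc (suc _)) (ℕ.s≤s (ℕ.s≤s ()))

    tile-corner : ∀ k → 1 ℕ.≤ k → k ℕ.≤ 1 → ⟪ tile ⟫ (cornerα (corner k)) (cornerβ (corner k)) c
    tile-corner 1 _ _ = linℚ 1 (λ c → (# 1 ≦ c ∷ [] ⊢ tile (cornerα′ k₁ c) (cornerβ′ k₁ c) c)) c 1≤c
    tile-corner (suc (suc _)) _ (ℕ.s≤s ())

    halfEdge : ∀ {n} → Corner → Expr n → Expr n → Expr n → Expr n → Formula n
    halfEdge κ r a b c = # 1 ⋖ # 2 ⊗ r ⩓ r ⋖ # 1 ⩓ a ≐ edgeα′ κ c r ⩓ b ≐ edgeβ′ κ c r

    tile-cases : ∀ a b → ⟪ tile ⟫ a b c →
      ⟪ interior ⟫ a b c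
      ⊎ (Σ ℕ λ k → Σ ℚ λ r → 1ℚ < fromℤ (+ 2) * r × r < 1ℚ × a ≡ edgeα (corner k) r × b ≡ edgeβ (corner k) r)
      ⊎ (Σ ℕ λ k → suc k ℕ.≤ 2 × fromℤ (+ 2) * a ≡ cornerα (corner k) + cornerα (corner (suc k)) ×
          fromℤ (+ 2) * b ≡ cornerβ (corner k) + cornerβ (corner (suc k)))
      ⊎ (Σ ℕ λ k → 1 ℕ.≤ k × k ℕ.≤ 1 × a ≡ cornerα (corner k) × b ≡ cornerβ (corner k))
    tile-cases a b (inj₁ h) = inj₁ h
    tile-cases a b (inj₂ (inj₁ (b≡c , -1≤a , a≤0))) with ≤-split -1≤a | ≤-split a≤0
    ... | inj₂ -1≡a | _ = inj₂ (inj₂ (inj₂ (1 , ℕ.s≤s ℕ.z≤n , ℕ.s≤s ℕ.z≤n , infer (λ a b c → b ≐ c ⩓ ⊝ # 1 ≐ a)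
        (atCorner k₁) a b (b≡c , -1≡a))))
    ... | inj₁ -1<a | inj₂ a≡0 = inj₂ (inj₂ (inj₁ (0 , ℕ.s≤s ℕ.z≤n , infer (λ a b c → b ≐ c ⩓ a ≐ # 0)
        (midpoint k₀) a b (b≡c , a≡0))))
    ... | inj₁ -1<a | inj₁ a<0 =
      let r , r≡ , 1<2r , r<1 = ratio {1ℚ - a} 0<2 (infer (λ a b c → a ⋖ # 0) (λ a b c → # 2 ⋖ # 2 ⊗ (# 1 ⊖ a)) a b a<0) (infer (λ a b c → ⊝ # 1 ⋖ a) (λ a b c → # 1 ⊖ a ⋖ # 2) a b -1<a)
      in inj₂ (inj₁ (0 , r , 1<2r , r<1 ,
        linℚ 4 (λ a b c r → (b ≐ c ∷ r ⊗ (# 2) ≐ # 1 ⊖ a ∷ [] ⊢ a ≐ edgeα′ k₀ c r ⩓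
            b ≐ edgeβ′ k₀ c r)) a b c r b≡c r≡))
    tile-cases a b (inj₂ (inj₂ (inj₁ (a≡-1 , -c<b , b≤0)))) with ≤-split b≤0
    ... | inj₂ b≡0 = inj₂ (inj₂ (inj₁ (1 , ℕ.s≤s (ℕ.s≤s ℕ.z≤n) , infer (λ a b c → a ≐ ⊝ # 1 ⩓ b ≐ # 0)
        (midpoint k₁) a b (a≡-1 , b≡0))))
    ... | inj₁ b<0 =
      let r , r≡ , 1<2r , r<1 = ratio {c - b} 0<2c (infer (λ a b c → b ⋖ # 0) (λ a b c → # 2 ⊗ c ⋖ # 2 ⊗ (c ⊖ b)) a b b<0) (infer (λ a b c → ⊝ c ⋖ b) (λ a b c → c ⊖ b ⋖ # 2 ⊗ c) a b -c<b)
      in inj₂ (inj₁ (1 , r , 1<2r , r<1 ,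
        linℚ 4 (λ a b c r → (a ≐ ⊝ # 1 ∷ r ⊗ (# 2 ⊗ c) ≐ c ⊖ b ∷ [] ⊢ a ≐ edgeα′ k₁ c r ⩓
            b ≐ edgeβ′ k₁ c r)) a b c r a≡-1 r≡))
    tile-cases a b (inj₂ (inj₂ (inj₂ (inj₁ (b≡-c , 0<a , a<1))))) =
      let r , r≡ , 1<2r , r<1 = ratio {1ℚ + a} 0<2 (infer (λ a b c → # 0 ⋖ a) (λ a b c → # 2 ⋖ # 2 ⊗ (# 1 ⊕ a)) a b 0<a) (infer (λ a b c → a ⋖ # 1) (λ a b c → # 1 ⊕ a ⋖ # 2) a b a<1)
      in inj₂ (inj₁ (2 , r , 1<2r , r<1 ,
        linℚ 4 (λ a b c r → (b ≐ ⊝ c ∷ r ⊗ (# 2) ≐ # 1 ⊕ a ∷ [] ⊢ a ≐ edgeα′ k₂ c r ⩓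
            b ≐ edgeβ′ k₂ c r)) a b c r b≡-c r≡))
    tile-cases a b (inj₂ (inj₂ (inj₂ (inj₂ (a≡1 , 0<b , b<c))))) =
      let r , r≡ , 1<2r , r<1 = ratio {b + c} 0<2c (infer (λ a b c → # 0 ⋖ b) (λ a b c → # 2 ⊗ c ⋖ # 2 ⊗ (b ⊕ c)) a b 0<b) (infer (λ a b c → b ⋖ c) (λ a b c → b ⊕ c ⋖ # 2 ⊗ c) a b b<c)
      in inj₂ (inj₁ (3 , r , 1<2r , r<1 ,
        linℚ 4 (λ a b c r → (a ≐ # 1 ∷ r ⊗ (# 2 ⊗ c) ≐ b ⊕ c ∷ [] ⊢ a ≐ edgeα′ k₃ c r ⩓
            b ≐ edgeβ′ k₃ c r)) a b c r a≡1 r≡))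
    returns : ∀ k → 1 ℕ.≤ k → k ℕ.≤ 4 → cornerα (corner k) ≡ 1ℚ → cornerβ (corner k) ≡ c → k ≡ 4
    returns 1 _ _ ()
    returns 2 _ _ ()
    returns 3 _ _ _ β≡c = ⊥-elim (linℚ 1 (λ c → (# 1 ≦ c ∷ ⊝ c ≐ c ∷ [] ⊢ ff)) c 1≤c β≡c)
    returns 4 _ _ _ _ = refl
    returns (suc (suc (suc (suc (suc _))))) _ (ℕ.s≤s (ℕ.s≤s (ℕ.s≤s (ℕ.s≤s ()))))

    closed-intro : ∀ a b → (∀ i j → fromℤ i * a + fromℤ j * b ≤ form (fromℤ i) (fromℤ j)) → ⟪ closed ⟫ a b c
    closed-intro a b h = infer (λ a b c → halfPlane (+ 1) (+ 0) a b c ⩓ halfPlane -[1+ 0 ] (+ 0) a b c ⩓ halfPlane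
        (+ 0) (+ 1) a b c ⩓ halfPlane (+ 0) -[1+ 0 ] a b c) closed a b
      (h (+ 1) (+ 0) , h -[1+ 0 ] (+ 0) , h (+ 0) (+ 1) , h (+ 0) -[1+ 0 ])

    interior-intro : ∀ a b → (∀ i j → ¬ (i ≡ + 0 × j ≡ + 0) → fromℤ i * a + fromℤ j * b < form (fromℤ i) (fromℤ j)) →
        ⟪ interior ⟫ a b c
    interior-intro a b h = infer (λ a b c → openHalfPlane (+ 1) (+ 0) a b c ⩓ openHalfPlane -[1+ 0 ] (+ 0) a b c ⩓
        openHalfPlane (+ 0) (+ 1) a b c ⩓ openHalfPlane (+ 0) -[1+ 0 ] a b c) interior a b
      (h (+ 1) (+ 0) (λ { (() , _) }) , h -[1+ 0 ] (+ 0) (λ { (() , _) }) , h (+ 0) (+ 1) (λ { (_ , ()) }) , h (+ 0) -[1+ 0 ] λ { (_ , ()) })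

    norm-bound : ∀ a b → ⟪ closed ⟫ a b c → let Δ = fromℤ (+ 4) * c - 0ℚ * 0ℚ in
      fromℤ (+ 16) * (c * (a * a) - 0ℚ * (a * b) + b * b) ≤ Δ * (Δ + fromℤ (+ 4))
    norm-bound a b (a≤1 , -a≤1 , b≤c , -b≤c) =
      linℚ 3 (λ a b c → (# 0 ≦ c ⊗ ((# 1 ⊖ a) ⊗ (# 1 ⊖ ⊝ a)) ∷ # 0 ≦ (c ⊖ b) ⊗ (c ⊖ ⊝ b) ∷ [] ⊢
          # 16 ⊗ (c ⊗ (a ⊗ a) ⊖ # 0 ⊗ (a ⊗ b) ⊕ b ⊗ b) ≦ (# 4 ⊗ c ⊖ # 0 ⊗ # 0) ⊗ (# 4 ⊗ c ⊖ # 0 ⊗ # 0 ⊕ # 4))) a b c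
        (*-nonNeg 0≤c (*-nonNeg (subtract-≤ a≤1) (subtract-≤ -a≤1))) (*-nonNeg (subtract-≤ b≤c) (subtract-≤ -b≤c))

    rectangle : Cell (fromℤ (+ 0)) c
    rectangle = record
      { closed = closed ; interior = interior ; tile = tile ; corners = corners
      ; Corner = Corner ; start = k₀ ; next = next ; cornerα = cornerα ; cornerβ = cornerβ ; sides = 4
      ; Axis = Axis ; axisᵢ = axisᵢ ; axisⱼ = axisⱼ ; onAxis = onAxis
      ; closed-intro = closed-intro ; closed-slack = closed-slack
      ; interior-intro = interior-intro ; interior-slack = interior-slack
      ; interior⇒tile = λ _ _ → inj₁ ; tile⇒closed = infer tile closed ; norm-bound = norm-bound
      ; no-translate = λ a b i j ij≢0 t t′ →
          disjoint (small a b i j (infer tile closed a b t) (infer tile closed (a - shiftα i j)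
              (b - shiftβ i j) t′)) ij≢0 a b (t , t′)
      -- For even p the rectangle of the hypotheses is the cell itself.
      ; reducible = λ a b a≤1 -a≤1 lo hi → closed⇒reducible a b (infer (λ a b c → a ≦ # 1 ⩓ ⊝ a ≦ # 1 ⩓
          # 2 ⊗ (# 2 ⊗ b ⊖ # 0 ⊗ a) ≦ # 4 ⊗ c ⊖ # 0 ⊗ # 0 ⩓ ⊝
              (# 2 ⊗ (# 2 ⊗ b ⊖ # 0 ⊗ a)) ≦ # 4 ⊗ c ⊖ # 0 ⊗ # 0) closed a b (a≤1 , -a≤1 , lo , hi))
      ; corner∈corners = corner∈corners ; corners⇒closed = infer corners closed ; corner-normals = corner-normals
      ; direction = λ a b i j ij≢0 h h′ → axis a b (small a b i j h h′) ij≢0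
      ; two-axes = λ a b x x′ x≢x′ h on on′ → two-axes a b x x′ x≢x′ (h , on , on′)
      ; turn = turn
      ; first-corner = λ a b h α≡1 above → infer (λ a b c → corners a b c ⩓ a ≐ # 1 ⩓ # 0 ⋖ # 2 ⊗ b ⊖ # 0 ⊗ a)
          (atCorner k₀) a b (h , α≡1 , above)
      ; 1<sides = ℕ.s≤s (ℕ.s≤s ℕ.z≤n) ; returns = returns ; full-turn = refl
      ; tile-edge = tile-edge ; tile-mid = tile-mid ; tile-corner = tile-corner ; tile-cases = tile-cases
      }

  -- Rounding, and the interface of the tiling

  abstract
    floor : ∀ x → Σ ℤ λ n → fromℤ n ≤ x × x < fromℤ n + 1ℚ
    floor x@(ℚ.mkℚ k d _) = n , lower , subst (x <_) (fromℤ-+ n (+ 1)) upper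
      where
      n : ℤ
      n = k ℤ./ℕ suc d
      lower : fromℤ n ≤ x
      lower = ℚₚ.toℚᵘ-cancel-≤ $ ℚᵘₚ.≤-respˡ-≃ (ℚᵘₚ.≃-sym (toℚᵘ-fromℤ n)) $
        ℚᵘ.*≤* (subst (n ℤ.* + suc d ℤ.≤_) (sym (ℤₚ.*-identityʳ k)) (ℤ.[n/ℕd]*d≤n k (suc d)))
      upper : x < fromℤ (n ℤ.+ + 1)
      upper = ℚₚ.toℚᵘ-cancel-< $ ℚᵘₚ.<-respʳ-≃ (ℚᵘₚ.≃-sym (toℚᵘ-fromℤ (n ℤ.+ + 1))) $
        ℚᵘ.*<* (subst₂ ℤ._<_ (sym (ℤₚ.*-identityʳ k)) (cong (ℤ._* + suc d) (ℤₚ.+-comm (+ 1) n)) (ℤ.n<s[n/ℕd]*d k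
            (suc d)))

  round : ∀ x → Σ ℤ λ n → fromℤ (+ 2) * (x - fromℤ n) ≤ 1ℚ × - (fromℤ (+ 2) * (x - fromℤ n)) ≤ 1ℚ
  round x with n , n≤ , <n+1 ← floor (x + ½) =
    n ,
    linℚ 3 (λ x n ½ → (½ ⊕ ½ ≐ # 1 ∷ x ⊕ ½ ⋖ n ⊕ # 1 ∷ [] ⊢ # 2 ⊗ (x ⊖ n) ≦ # 1)) x (fromℤ n) ½ refl <n+1 ,
    linℚ 3 (λ x n ½ → (½ ⊕ ½ ≐ # 1 ∷ n ≦ x ⊕ ½ ∷ [] ⊢ ⊝ (# 2 ⊗ (x ⊖ n)) ≦ # 1)) x (fromℤ n) ½ refl n≤

  %-injective : ∀ d k m .{{_ : ℕ.NonZero m}} → (d ℕ.+ k) ℕ.% m ≡ k ℕ.% m → m ℕ.∣ d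
  %-injective d k m eq = ℕ.∣m+n∣m⇒∣n
    (subst (m ℕ.∣_) (trans (sym quotients) (ℕₚ.+-comm d (k ℕ./ m ℕ.* m))) (ℕ.n∣m*n ((d ℕ.+ k) ℕ./ m)))
    (ℕ.n∣m*n (k ℕ./ m))
    where
    quotients : d ℕ.+ k ℕ./ m ℕ.* m ≡ (d ℕ.+ k) ℕ./ m ℕ.* m
    quotients = ℕₚ.+-cancelˡ-≡ (k ℕ.% m) _ _ $ begin
      k ℕ.% m ℕ.+ (d ℕ.+ k ℕ./ m ℕ.* m)              ≡⟨ ℕₚ.+-assoc (k ℕ.% m) d _ ⟨
      k ℕ.% m ℕ.+ d ℕ.+ k ℕ./ m ℕ.* m                ≡⟨ cong (ℕ._+ k ℕ./ m ℕ.* m) (ℕₚ.+-comm (k ℕ.% m) d) ⟩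
      d ℕ.+ k ℕ.% m ℕ.+ k ℕ./ m ℕ.* m                ≡⟨ ℕₚ.+-assoc d (k ℕ.% m) _ ⟩
      d ℕ.+ (k ℕ.% m ℕ.+ k ℕ./ m ℕ.* m)              ≡⟨ cong (d ℕ.+_) (ℕ.m≡m%n+[m/n]*n k m) ⟨
      d ℕ.+ k                                        ≡⟨ ℕ.m≡m%n+[m/n]*n (d ℕ.+ k) m ⟩
      (d ℕ.+ k) ℕ.% m ℕ.+ (d ℕ.+ k) ℕ./ m ℕ.* m      ≡⟨ cong (ℕ._+ (d ℕ.+ k) ℕ./ m ℕ.* m) eq ⟩
      k ℕ.% m ℕ.+ (d ℕ.+ k) ℕ./ m ℕ.* m              ∎
      where open ≡-Reasoning

  -- What the number-theoretic part uses about the restricted cell. `bound` is |u|² ≤ (Δ + 4)/16,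
  -- the squared circumradius of the rectangle; the hexagon satisfies it with room to spare.
  record Tiling (p q : ℤ) (σ : Sign) (L : Setup.Labelling p q σ) : Set where
    open Setup p q σ hiding (fromℤ)
    field
      exists : ∀ z → Σ ZT λ y → InṼ L (z -Q embed y)
      unique : ∀ z y → InṼ L z → InṼ L (z -Q embed y) → y ≡ 0Z
      bound  : ∀ z → InṼ L z → fromℤ (+ 16) * normQ z ≤ fromℤ (+ 4) * qQ - pQ * pQ + fromℤ (+ 4)

  -- From the cell in coordinates to the labelled Voronoi cell

  module _ (p q : ℤ) (σ : Sign) (h : ℤ) (e : ℕ) (c : ℤ)
    (sp≡2h+e : sgnℤ σ ℤ.* p ≡ + 2 ℤ.* h ℤ.+ + e) (q≡ : q ≡ c ℤ.+ h ℤ.* h ℤ.+ + e ℤ.* h)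
    (cell : Cell (fromℤ (+ e)) (fromℤ c))
    (Δ>0 : 0ℚ < fromℤ (+ 4) * fromℤ c - fromℤ (+ e) * fromℤ (+ e))
    (L : Setup.Labelling p q σ) where

    open Setup p q σ hiding (fromℤ)
    open Frame p q σ h e c sp≡2h+e q≡ hiding (form; Tight)
    open Labelling L
    open Cell cell hiding (Δ; unique)
    open Translation eQ cQ

    Closed Tile Corners : QT → Set
    Closed z = ⟪ closed ⟫ (α z) (β z) cQ
    Tile z = ⟪ tile ⟫ (α z) (β z) cQ
    Corners z = ⟪ corners ⟫ (α z) (β z) cQ

    InV⇒Closed : ∀ z → InV z → Closed z
    InV⇒Closed z inV = closed-intro (α z) (β z) (InV-elim z inV)

    Closed⇒InV : ∀ z → Closed z → InV z
    Closed⇒InV z h = InV-intro z (closed-slack (α z) (β z) h)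

    translate : (R : Region) → ∀ z y → ⟪ R ⟫ (α (z -Q embed y)) (β (z -Q embed y)) cQ →
      ⟪ R ⟫ (α z - shiftα (iZ y) (jZ y)) (β z - shiftβ (iZ y) (jZ y)) cQ
    translate R z y = subst₂ (λ a b → ⟪ R ⟫ a b cQ) (α-translate z y) (β-translate z y)

    untranslate : (R : Region) → ∀ z y → ⟪ R ⟫ (α z - shiftα (iZ y) (jZ y)) (β z - shiftβ (iZ y) (jZ y)) cQ →
      ⟪ R ⟫ (α (z -Q embed y)) (β (z -Q embed y)) cQ
    untranslate R z y = subst₂ (λ a b → ⟪ R ⟫ a b cQ) (sym (α-translate z y)) (sym (β-translate z y))

    fromℤ-det : ∀ i j i′ j′ → fromℤ (i ℤ.* j′ ℤ.- j ℤ.* i′) ≡ fromℤ i * fromℤ j′ - fromℤ j * fromℤ i′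
    fromℤ-det i j i′ j′ = trans (fromℤ-minus (i ℤ.* j′) (j ℤ.* i′)) (cong₂ _-_ (fromℤ-* i j′) (fromℤ-* j i′))

    unsigned : ∀ {s} → IsUnit s → ∀ x → s * x ≡ 0ℚ → x ≡ 0ℚ
    unsigned (inj₁ refl) = linℚ 1 (λ x → (# 1 ⊗ x ≐ # 0 ∷ [] ⊢ x ≐ # 0))
    unsigned (inj₂ refl) = linℚ 1 (λ x → (⊝ # 1 ⊗ x ≐ # 0 ∷ [] ⊢ x ≐ # 0))

    abstract
      vertex⇒Corners : ∀ z → IsVertex z → Corners z
      vertex⇒Corners z (inV , y₁ , y₂ , _ , _ , det≢0 , tight₁ , tight₂) = two-normals (α z) (β z)
        (iZ y₁) (jZ y₁) (iZ y₂) (jZ y₂) (InV⇒Closed z inV)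
        (translate closed z y₁ (InV⇒Closed (z -Q embed y₁) (InV-translate z y₁ inV tight₁)))
        (translate closed z y₂ (InV⇒Closed (z -Q embed y₂) (InV-translate z y₂ inV tight₂)))
        (Tight-elim z y₁ tight₁) (Tight-elim z y₂ tight₂)
        (λ det≡0 → det≢0 (unsigned s-unit (detQ (embed y₁) (embed y₂))
          (trans (detQ-embed y₁ y₂) (trans (sym (fromℤ-det (iZ y₁) (jZ y₁) (iZ y₂) (jZ y₂))) (cong fromℤ det≡0)))))

    At : QT → Corner → Set
    At z κ = α z ≡ cornerα κ × β z ≡ cornerβ κ

    abstract
      fromIJ-det : ∀ i j i′ j′ → i ℤ.* j′ ℤ.- j ℤ.* i′ ≡ + 1 → s * detQ (embed (fromIJ i j))
          (embed (fromIJ i′ j′)) ≡ 1ℚ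
      fromIJ-det i j i′ j′ det≡1 = begin
        s * detQ (embed (fromIJ i j)) (embed (fromIJ i′ j′))           ≡⟨ detQ-embed (fromIJ i j) (fromIJ i′ j′) ⟩
        iQ (fromIJ i j) * jQ (fromIJ i′ j′) - jQ (fromIJ i j) * iQ (fromIJ i′ j′)
          ≡⟨ cong₂ _-_ (cong₂ _*_ (cong fromℤ (fromIJ-i i j)) (cong fromℤ (fromIJ-j i′ j′)))
                       (cong₂ _*_ (cong fromℤ (fromIJ-j i j)) (cong fromℤ (fromIJ-i i′ j′))) ⟩
        fromℤ i * fromℤ j′ - fromℤ j * fromℤ i′                        ≡⟨ fromℤ-det i j i′ j′ ⟨
        fromℤ (i ℤ.* j′ ℤ.- j ℤ.* i′)                                  ≡⟨ cong fromℤ det≡1 ⟩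
        1ℚ                                                             ∎
        where open ≡-Reasoning

      corner⇒vertex : ∀ z κ → At z κ → IsVertex z
      corner⇒vertex z κ (αz≡ , βz≡) = build (corner-normals κ)
        where
        1≢0 : ¬ 1ℚ ≡ 0ℚ
        1≢0 ()
        independent : ∀ y y′ → s * detQ (embed y) (embed y′) ≡ 1ℚ → ¬ y ≡ 0Z × ¬ y′ ≡ 0Z × ¬ detQ (embed y)
            (embed y′) ≡ 0ℚ
        independent y@(l , m) y′@(l′ , m′) det≡1 =
          (λ { refl → 1≢0 (trans (sym det≡1)
            (linℚ 3 (λ s l m → ([] ⊢ s ⊗ (# 0 ⊗ m ⊖ # 0 ⊗ l) ≐ # 0)) s (fromℤ l′) (fromℤ m′))) }) ,
          (λ { refl → 1≢0 (trans (sym det≡1)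
            (linℚ 3 (λ s l m → ([] ⊢ s ⊗ (l ⊗ # 0 ⊖ m ⊗ # 0) ≐ # 0)) s (fromℤ l) (fromℤ m))) }) ,
          (λ det≡0 → 1≢0 (trans (sym det≡1) (trans (cong (s *_) det≡0) (ℚₚ.*-zeroʳ s))))
        build : (Σ ℤ λ i → Σ ℤ λ j → Σ ℤ λ i′ → Σ ℤ λ j′ →
          Cell.Tight cell (cornerα κ) (cornerβ κ) i j × Cell.Tight cell (cornerα κ) (cornerβ κ) i′ j′ ×
          i ℤ.* j′ ℤ.- j ℤ.* i′ ≡ + 1) → IsVertex z
        build (i , j , i′ , j′ , t , t′ , det≡1) =
          let y≢0 , y′≢0 , det≢0 = independent (fromIJ i j) (fromIJ i′ j′) (fromIJ-det i j i′ j′ det≡1) in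
          Closed⇒InV z (corners⇒closed (α z) (β z) (subst₂ (λ a b → ⟪ corners ⟫ a b cQ) (sym αz≡) (sym βz≡)
              (corner∈corners κ))) ,
          fromIJ i j , fromIJ i′ j′ , y≢0 , y′≢0 , det≢0 ,
          Tight-intro z i j (subst₂ (λ a b → Cell.Tight cell a b i j) (sym αz≡) (sym βz≡) t) ,
          Tight-intro z i′ j′ (subst₂ (λ a b → Cell.Tight cell a b i′ j′) (sym αz≡) (sym βz≡) t′)

      At-injective : ∀ u v κ → At u κ → At v κ → u ≡ v
      At-injective u v κ (αu≡ , βu≡) (αv≡ , βv≡) = αβ-injective Δ>0 u v (trans αu≡ (sym αv≡)) (trans βu≡ (sym βv≡))

      -- `vtx-all` speaks about points that are vertices, so the corner is first realised as a point
      -- of ℚ(τ).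
      indexed : ∀ κ → Σ (Fin.Fin m) λ i → At (vtx i) κ
      indexed κ = label (point Δ>0 (cornerα κ) (cornerβ κ))
        where
        relabel : ∀ {z} → At z κ → Σ (Fin.Fin m) (λ i → vtx i ≡ z) → Σ (Fin.Fin m) λ i → At (vtx i) κ
        relabel at (i , refl) = i , at
        label : Σ QT (λ z → At z κ) → Σ (Fin.Fin m) λ i → At (vtx i) κ
        label (z , at) = relabel at (vtx-all z (corner⇒vertex z κ at))

      toℕ-mod : ∀ k → Fin.toℕ (k ℕ.mod m) ≡ k ℕ.% m
      toℕ-mod k = Finₚ.toℕ-fromℕ< (ℕ.m%n<n k m)

      v≡⇒∣ : ∀ d k → v (d ℕ.+ k) ≡ v k → m ℕ.∣ d
      v≡⇒∣ d k eq = %-injective d k m (trans (sym (toℕ-mod (d ℕ.+ k))) (trans (cong Fin.toℕ (vtx-inj _ _ eq))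
          (toℕ-mod k)))

      -- With a single label the corners 0 and 1 would coincide, against `returns`.
      m≢1 : ¬ m ≡ 1
      m≢1 m≡1 = absurd (indexed (corner 0)) (indexed (corner 1))
        where
        singleton : ∀ {n} → n ≡ 1 → (i j : Fin.Fin n) → i ≡ j
        singleton refl Fin.zero Fin.zero = refl
        absurd : Σ (Fin.Fin m) (λ i → At (vtx i) (corner 0)) → Σ (Fin.Fin m) (λ i → At (vtx i) (corner 1)) → ⊥
        absurd (i , αᵢ , βᵢ) (j , αⱼ , βⱼ) = ℕₚ.<-irrefl (returns 1 (ℕ.s≤s ℕ.z≤n) (ℕₚ.<⇒≤ 1<sides)
          (trans (sym αⱼ) (trans (cong (λ k → α (vtx k)) (singleton m≡1 j i)) αᵢ))
          (trans (sym βⱼ) (trans (cong (λ k → β (vtx k)) (singleton m≡1 j i)) βᵢ))) 1<sides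

      left : ∀ k i → 0ℚ ≤ (α (v (suc k)) - α (v k)) * (β (vtx i) - β (v k)) - (β (v (suc k)) - β (v k)) *
          (α (vtx i) - α (v k))
      left k i = subst (0ℚ ≤_) (trans (Δ*detQ (v (suc k) -Q v k) (vtx i -Q v k))
          (cong₂ _-_ (cong₂ _*_ (α-minus (v (suc k)) (v k)) (β-minus (vtx i) (v k))) (cong₂ _*_ (β-minus (v (suc k))
              (v k)) (α-minus (vtx i) (v k)))))
        (*-nonNeg (ℚₚ.<⇒≤ Δ>0) (ccw k i))

      -- For the label of the corner `next κ`, `ccw` puts this corner to the left of or on the line
      -- from `v k` to `v (suc k)`, so `turn` leaves only κ and `next κ`. The former is excluded by
      -- injectivity of the labels and m ≠ 1.
      at-next : ∀ k κ → At (v k) κ → At (v (suc k)) (next κ)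
      at-next k κ at@(αk , βk) = decide (turn κ (α (v (suc k))) (β (v (suc k))) (vertex⇒Corners (v (suc k))
          (vtx-vertex (suc k ℕ.mod m)))
          (turn-left (indexed (next κ))))
        where
        turn-left : Σ (Fin.Fin m) (λ i → At (vtx i) (next κ)) →
          0ℚ ≤ (α (v (suc k)) - cornerα κ) * (cornerβ (next κ) - cornerβ κ) - (β (v (suc k)) - cornerβ κ) *
              (cornerα (next κ) - cornerα κ)
        turn-left (i , αᵢ , βᵢ) = subst (0ℚ ≤_)
          (cong₂ _-_ (cong₂ _*_ (cong (λ x → α (v (suc k)) - x) αk) (cong₂ _-_ βᵢ βk))
                     (cong₂ _*_ (cong (λ x → β (v (suc k)) - x) βk) (cong₂ _-_ αᵢ αk)))
          (left k i)
        decide : (At (v (suc k)) κ) ⊎ (At (v (suc k)) (next κ)) → At (v (suc k)) (next κ)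
        decide (inj₁ at′) = ⊥-elim (m≢1 (ℕ.∣1⇒≡1 (v≡⇒∣ 1 k (At-injective (v (suc k)) (v k) κ at′ at))))
        decide (inj₂ at′) = at′

      at-corner : ∀ k → At (v k) (corner k)
      at-corner zero = first-corner (α (v 0)) (β (v 0)) (vertex⇒Corners (v 0) (vtx-vertex (0 ℕ.mod m))) α≡1 above
        where
        α≡1 : α (v 0) ≡ 1ℚ
        -- The procedure has integer coefficients only; ½ is a variable here and the facts about it
        -- are passed as hypotheses.
        α≡1 = linℚ 5 (λ a b p ½ r → (a ⊕ b ⊗ (p ⊗ ½) ≐ ½ ∷ ½ ⊕ ½ ≐ # 1 ∷ b ⊗ p ⊗ (½ ⊕ ½) ≐ b ⊗ p ⊗ # 1 ∷ [] ⊢ a ⊕ a ⊕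
            p ⊗ b ≐ # 1))
          (proj₁ (v 0)) (proj₂ (v 0)) pQ ½ ½ v₀-re refl refl
        above : 0ℚ < fromℤ (+ 2) * β (v 0) - eQ * α (v 0)
        above = subst (0ℚ <_) (Δ*height (v 0)) (*-pos Δ>0 v₀-im)
      at-corner (suc k) = at-next k (corner k) (at-corner k)

      -- `v` agrees at `sides` and 0, so m divides `sides` by injectivity of the labels. It also
      -- agrees at m and 0, and `returns` excludes a return before `sides`.
      m≡sides : m ≡ sides
      m≡sides = returns m (ℕ.s≤s ℕ.z≤n) (ℕ.∣⇒≤ {{ℕ.>-nonZero (ℕₚ.<-trans (ℕ.s≤s ℕ.z≤n) 1<sides)}} m∣sides)
          (trans (sym (proj₁ (at-corner m))) (trans (cong α vm≡v0) (proj₁ (at-corner 0))))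
          (trans (sym (proj₂ (at-corner m))) (trans (cong β vm≡v0) (proj₂ (at-corner 0))))
        where
        m∣sides : m ℕ.∣ sides
        m∣sides = v≡⇒∣ sides 0 (At-injective (v (sides ℕ.+ 0)) (v 0) start (subst (λ n → At (v n) start)
            (sym (ℕₚ.+-identityʳ sides))
          (subst (At (v sides)) full-turn (at-corner sides))) (at-corner 0))
        vm≡v0 : v m ≡ v 0
        vm≡v0 = cong vtx (Finₚ.toℕ-injective (trans (toℕ-mod m) (trans (ℕ.n%n≡0 m) (sym (toℕ-mod 0)))))

    double-½ : ∀ x → fromℤ (+ 2) * (½ * x) ≡ x
    double-½ x = trans (linℚ 2 (λ ½ x → ([] ⊢ # 2 ⊗ (½ ⊗ x) ≐ # 2 ⊗ ½ ⊗ x)) ½ x) (ℚₚ.*-identityˡ x)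

    mid-α : ∀ k → fromℤ (+ 2) * α (mid k) ≡ cornerα (corner k) + cornerα (corner (suc k))
    mid-α k = trans (cong (fromℤ (+ 2) *_) (α-· ½ (v k +Q v (suc k)))) (trans (double-½ (α (v k +Q v (suc k))))
      (trans (α-+ (v k) (v (suc k))) (cong₂ _+_ (proj₁ (at-corner k)) (proj₁ (at-corner (suc k))))))

    mid-β : ∀ k → fromℤ (+ 2) * β (mid k) ≡ cornerβ (corner k) + cornerβ (corner (suc k))
    mid-β k = trans (cong (fromℤ (+ 2) *_) (β-· ½ (v k +Q v (suc k)))) (trans (double-½ (β (v k +Q v (suc k))))
      (trans (β-+ (v k) (v (suc k))) (cong₂ _+_ (proj₂ (at-corner k)) (proj₂ (at-corner (suc k))))))

    halfEdge : ℕ → ℚ → QT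
    halfEdge k t = mid k +Q (t ·Q (v (suc k) -Q mid k))

    -- The parameter t on the half edge from the midpoint corresponds to r = (1 + t)/2 on the whole edge.
    private
      parameter-change : ∀ x y M t r → fromℤ (+ 2) * M ≡ x + y → fromℤ (+ 2) * r ≡ 1ℚ + t → M + t * (y - M) ≡ x + r *
          (y - x)
      parameter-change x y M t r 2M≡ 2r≡ = linℚ 5 (λ x y M t r →
        (# 2 ⊗ M ≐ x ⊕ y ∷ t ⊗ (# 2 ⊗ M) ≐ t ⊗ (x ⊕ y) ∷ (y ⊖ x) ⊗ (# 2 ⊗ r) ≐ (y ⊖ x) ⊗ (# 1 ⊕ t) ∷ [] ⊢
         M ⊕ t ⊗ (y ⊖ M) ≐ x ⊕ r ⊗ (y ⊖ x))) x y M t r 2M≡ (cong (t *_) 2M≡) (cong ((y - x) *_) 2r≡)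

    halfEdge-α : ∀ k t r → fromℤ (+ 2) * r ≡ 1ℚ + t → α (halfEdge k t) ≡ edgeα (corner k) r
    halfEdge-α k t r 2r≡ = trans (trans (α-+ (mid k) (t ·Q (v (suc k) -Q mid k)))
        (cong (λ x → α (mid k) + x) (trans (α-· t (v (suc k) -Q mid k)) (cong (t *_) (trans (α-minus (v (suc k))
            (mid k))
          (cong (_- α (mid k)) (proj₁ (at-corner (suc k)))))))))
      (parameter-change (cornerα (corner k)) (cornerα (corner (suc k))) (α (mid k)) t r (mid-α k) 2r≡)

    halfEdge-β : ∀ k t r → fromℤ (+ 2) * r ≡ 1ℚ + t → β (halfEdge k t) ≡ edgeβ (corner k) r
    halfEdge-β k t r 2r≡ = trans (trans (β-+ (mid k) (t ·Q (v (suc k) -Q mid k)))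
        (cong (λ x → β (mid k) + x) (trans (β-· t (v (suc k) -Q mid k)) (cong (t *_) (trans (β-minus (v (suc k))
            (mid k))
          (cong (_- β (mid k)) (proj₂ (at-corner (suc k)))))))))
      (parameter-change (cornerβ (corner k)) (cornerβ (corner (suc k))) (β (mid k)) t r (mid-β k) 2r≡)

    private
      halve : ∀ x y w → fromℤ (+ 2) * x ≡ w → fromℤ (+ 2) * y ≡ w → x ≡ y
      halve = linℚ 3 (λ x y w → (# 2 ⊗ x ≐ w ∷ # 2 ⊗ y ≐ w ∷ [] ⊢ x ≐ y))

    TileCases⇒InṼ : ∀ z → TileCases (α z) (β z) → InṼ L z
    TileCases⇒InṼ z (inj₁ int) = inj₁ (InteriorV-intro z (interior-slack (α z) (β z) int))
    TileCases⇒InṼ z (inj₂ (inj₁ (k , r , 1<2r , r<1 , αz≡ , βz≡))) =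
      inj₂ (inj₁ (k , t , subtract-< 1<2r , linℚ 1 (λ r → (r ⋖ # 1 ∷ [] ⊢ # 2 ⊗ r ⊖ # 1 ⋖ # 1)) r r<1 ,
        αβ-injective Δ>0 z (halfEdge k t) (trans αz≡ (sym (halfEdge-α k t r 2r≡)))
            (trans βz≡ (sym (halfEdge-β k t r 2r≡)))))
      where
      t : ℚ
      t = fromℤ (+ 2) * r - 1ℚ
      2r≡ : fromℤ (+ 2) * r ≡ 1ℚ + t
      2r≡ = linℚ 1 (λ r → ([] ⊢ # 2 ⊗ r ≐ # 1 ⊕ (# 2 ⊗ r ⊖ # 1))) r
    TileCases⇒InṼ z (inj₂ (inj₂ (inj₁ (k , k< , 2α≡ , 2β≡)))) =
      inj₂ (inj₂ (inj₁ (k , subst (λ n → suc k ℕ.≤ n ℕ./ 2) (sym m≡sides) k< ,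
        αβ-injective Δ>0 z (mid k) (halve (α z) (α (mid k)) _ 2α≡ (mid-α k)) (halve (β z) (β (mid k)) _ 2β≡
            (mid-β k)))))
    TileCases⇒InṼ z (inj₂ (inj₂ (inj₂ (k , 1≤k , k≤ , αz≡ , βz≡)))) =
      inj₂ (inj₂ (inj₂ (k , 1≤k , subst (λ n → k ℕ.≤ n ℕ./ 3) (sym m≡sides) k≤ , At-injective z (v k) (corner k)
          (αz≡ , βz≡) (at-corner k))))

    Tile⇒InṼ : ∀ z → Tile z → InṼ L z
    Tile⇒InṼ z t = TileCases⇒InṼ z (tile-cases (α z) (β z) t)

    InṼ⇒Tile : ∀ z → InṼ L z → Tile z
    InṼ⇒Tile z (inj₁ int) = interior⇒tile (α z) (β z) (interior-intro (α z) (β z) (InteriorV-elim z int))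
    InṼ⇒Tile z (inj₂ (inj₁ (k , t , 0<t , t<1 , z≡))) =
      subst₂ (λ a b → ⟪ tile ⟫ a b cQ) (trans (sym (halfEdge-α k t r 2r≡)) (cong α (sym z≡)))
          (trans (sym (halfEdge-β k t r 2r≡)) (cong β (sym z≡)))
        (tile-edge (corner k) r
          (linℚ 2 (λ r t → (# 2 ⊗ r ≐ # 1 ⊕ t ∷ # 0 ⋖ t ∷ [] ⊢ # 1 ⋖ # 2 ⊗ r)) r t 2r≡ 0<t)
          (linℚ 2 (λ r t → (# 2 ⊗ r ≐ # 1 ⊕ t ∷ t ⋖ # 1 ∷ [] ⊢ r ⋖ # 1)) r t 2r≡ t<1))
      where
      r : ℚ
      r = ½ * (1ℚ + t)
      2r≡ : fromℤ (+ 2) * r ≡ 1ℚ + t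
      2r≡ = double-½ (1ℚ + t)
    InṼ⇒Tile z (inj₂ (inj₂ (inj₁ (k , k< , z≡)))) =
      tile-mid k (subst (λ n → suc k ℕ.≤ n ℕ./ 2) m≡sides k<) (α z) (β z)
        (trans (cong (λ u → fromℤ (+ 2) * α u) z≡) (mid-α k) , trans (cong (λ u → fromℤ (+ 2) * β u) z≡) (mid-β k))
    InṼ⇒Tile z (inj₂ (inj₂ (inj₂ (k , 1≤k , k≤ , z≡)))) =
      subst₂ (λ a b → ⟪ tile ⟫ a b cQ) (trans (sym (proj₁ (at-corner k))) (cong α (sym z≡)))
          (trans (sym (proj₂ (at-corner k))) (cong β (sym z≡)))
        (tile-corner k 1≤k (subst (λ n → k ℕ.≤ n ℕ./ 3) m≡sides k≤))

    private
      height-bound : ∀ {s} → IsUnit s → ∀ d b x → 0ℚ < d → d * (s * b) ≡ x → fromℤ (+ 2) * b ≤ 1ℚ →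
          - (fromℤ (+ 2) * b) ≤ 1ℚ →
        fromℤ (+ 2) * x ≤ d × - (fromℤ (+ 2) * x) ≤ d
      height-bound (inj₁ refl) d b x 0<d eq h h′ = linℚ 3 (λ d b x →
        (d ⊗ (# 1 ⊗ b) ≐ x ∷ # 0 ≦ d ⊗ (# 1 ⊖ # 2 ⊗ b) ∷ # 0 ≦ d ⊗ (# 1 ⊖ ⊝ (# 2 ⊗ b)) ∷ [] ⊢ # 2 ⊗ x ≦ d ⩓
            ⊝ (# 2 ⊗ x) ≦ d)) d b x
        eq (*-nonNeg (ℚₚ.<⇒≤ 0<d) (subtract-≤ h)) (*-nonNeg (ℚₚ.<⇒≤ 0<d) (subtract-≤ h′))
      height-bound (inj₂ refl) d b x 0<d eq h h′ = linℚ 3 (λ d b x →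
        (d ⊗ (⊝ # 1 ⊗ b) ≐ x ∷ # 0 ≦ d ⊗ (# 1 ⊖ # 2 ⊗ b) ∷ # 0 ≦ d ⊗ (# 1 ⊖ ⊝ (# 2 ⊗ b)) ∷ [] ⊢ # 2 ⊗ x ≦ d ⩓
            ⊝ (# 2 ⊗ x) ≦ d)) d b x
        eq (*-nonNeg (ℚₚ.<⇒≤ 0<d) (subtract-≤ h)) (*-nonNeg (ℚₚ.<⇒≤ 0<d) (subtract-≤ h′))

    abstract
      exists-near : ∀ z → α z ≤ 1ℚ → - α z ≤ 1ℚ → fromℤ (+ 2) * proj₂ z ≤ 1ℚ → - (fromℤ (+ 2) * proj₂ z) ≤ 1ℚ →
        Σ ZT λ y → InṼ L (z -Q embed y)
      exists-near z h₁ h₂ h₃ h₄ = result (reducible (α z) (β z) h₁ h₂ (proj₁ bounds) (proj₂ bounds))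
        where
        bounds : fromℤ (+ 2) * (fromℤ (+ 2) * β z - eQ * α z) ≤ Δ × - (fromℤ (+ 2) *
            (fromℤ (+ 2) * β z - eQ * α z)) ≤ Δ
        bounds = height-bound s-unit Δ (proj₂ z) (fromℤ (+ 2) * β z - eQ * α z) Δ>0 (Δ*height z) h₃ h₄
        result : Reducible tile (α z) (β z) → Σ ZT λ y → InṼ L (z -Q embed y)
        result (i , j , t) = fromIJ i j , Tile⇒InṼ (z -Q embed (fromIJ i j)) (untranslate tile z (fromIJ i j)
          (subst₂ (λ i j → ⟪ tile ⟫ (α z - shiftα i j) (β z - shiftβ i j) cQ) (sym (fromIJ-i i j))
              (sym (fromIJ-j i j)) t))

      -- An integer translation brings first b and then the real part within 1/2 of 0, in this order
      -- because the real part depends on b.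
      tiling-exists : ∀ z → Σ ZT λ y → InṼ L (z -Q embed y)
      tiling-exists z@(a , b) = first (round b)
        where
        second : ∀ j → fromℤ (+ 2) * (b - fromℤ j) ≤ 1ℚ → - (fromℤ (+ 2) * (b - fromℤ j)) ≤ 1ℚ →
          (Σ ℤ λ i → fromℤ (+ 2) * (½ * (a + a + pQ * (b - fromℤ j)) - fromℤ i) ≤ 1ℚ ×
                     - (fromℤ (+ 2) * (½ * (a + a + pQ * (b - fromℤ j)) - fromℤ i)) ≤ 1ℚ) → Σ ZT λ y → InṼ L
                         (z -Q embed y)
        second j j₁ j₂ (i , i₁ , i₂) = result (exists-near (z -Q embed (i , j)) (subst (_≤ 1ℚ) α≡ i₁)
            (subst (λ x → - x ≤ 1ℚ) α≡ i₂) j₁ j₂)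
          where
          α≡ : fromℤ (+ 2) * (½ * (a + a + pQ * (b - fromℤ j)) - fromℤ i) ≡ α (z -Q embed (i , j))
          α≡ = linℚ 5 (λ a i w ½ x → (# 2 ⊗ (½ ⊗ (a ⊕ a ⊕ w)) ≐ a ⊕ a ⊕ w ∷ [] ⊢
            # 2 ⊗ (½ ⊗ (a ⊕ a ⊕ w) ⊖ i) ≐ (a ⊖ i) ⊕ (a ⊖ i) ⊕ w)) a (fromℤ i) (pQ * (b - fromℤ j)) ½ ½
                (double-½ (a + a + pQ * (b - fromℤ j)))
          result : (Σ ZT λ y → InṼ L ((z -Q embed (i , j)) -Q embed y)) → Σ ZT λ y → InṼ L (z -Q embed y)
          result (y , t) = (i , j) +Z y , subst (InṼ L)
            (sym (trans (cong (z -Q_) (embed-+ (i , j) y)) (minus-+Q z (embed (i , j)) (embed y)))) t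
        first : (Σ ℤ λ j → fromℤ (+ 2) * (b - fromℤ j) ≤ 1ℚ × - (fromℤ (+ 2) * (b - fromℤ j)) ≤ 1ℚ) → Σ ZT λ y →
            InṼ L (z -Q embed y)
        first (j , j₁ , j₂) = second j j₁ j₂ (round (½ * (a + a + pQ * (b - fromℤ j))))

      tiling-unique : ∀ z y → InṼ L z → InṼ L (z -Q embed y) → y ≡ 0Z
      tiling-unique z y t t′ =
        let i≡0 , j≡0 = Cell.unique cell (α z) (β z) (iZ y) (jZ y) (InṼ⇒Tile z t) (translate tile z y (InṼ⇒Tile (z -Q embed y) t′))
        in trans (sym (fromIJ-iZ-jZ y)) (trans (cong₂ fromIJ i≡0 j≡0) fromIJ-0)

      tiling-bound : ∀ z → InṼ L z → fromℤ (+ 16) * normQ z ≤ fromℤ (+ 4) * qQ - pQ * pQ + fromℤ (+ 4)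
      tiling-bound z t = subst (λ d → fromℤ (+ 16) * normQ z ≤ d + fromℤ (+ 4)) Δ≡4q-p² (ℚₚ.≮⇒≥ λ lt →
        linℚ 3 (λ d n x → (d ⊗ n ≐ x ∷ # 16 ⊗ x ≦ d ⊗ (d ⊕ # 4) ∷ # 0 ⋖ d ⊗ (# 16 ⊗ n ⊖ (d ⊕ # 4)) ∷ [] ⊢ ff))
          Δ (normQ z) (cQ * (α z * α z) - eQ * (α z * β z) + β z * β z) (normQ-αβ z)
          (norm-bound (α z) (β z) (tile⇒closed (α z) (β z) (InṼ⇒Tile z t))) (*-pos Δ>0 (subtract-< lt)))

    tiling : Tiling p q σ L
    tiling = record { exists = tiling-exists ; unique = tiling-unique ; bound = tiling-bound }

open PlaneGeometry

*-nonNegℤ : ∀ {x y} → + 0 ℤ.≤ x → + 0 ℤ.≤ y → + 0 ℤ.≤ x ℤ.* y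
*-nonNegℤ {x} {y} 0≤x 0≤y = subst (ℤ._≤ x ℤ.* y) (ℤₚ.*-zeroʳ x) (ℤₚ.*-monoˡ-≤-nonNeg x {{ℤ.nonNegative 0≤x}} 0≤y)

square≥0ℤ : ∀ x → + 0 ℤ.≤ x ℤ.* x
square≥0ℤ (+ 0)     = ℤₚ.≤-refl
square≥0ℤ (+ suc _) = ℤ.+≤+ ℕ.z≤n
square≥0ℤ -[1+ _ ]  = ℤ.+≤+ ℕ.z≤n

square≡0ℤ : ∀ x → x ℤ.* x ℤ.≤ + 0 → x ≡ + 0
square≡0ℤ (+ 0) _ = refl
square≡0ℤ (+ suc _) (ℤ.+≤+ ())
square≡0ℤ -[1+ _ ] (ℤ.+≤+ ())

parity : ∀ k → Σ ℤ λ h → (k ≡ + 2 ℤ.* h ℤ.+ + 0) ⊎ (k ≡ + 2 ℤ.* h ℤ.+ + 1)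
parity k = k ℤ./ℕ 2 , cases (k ℤ.%ℕ 2) (ℤ.n%ℕd<d k 2) (ℤ.a≡a%ℕn+[a/ℕn]*n k 2)
  where
  cases : ∀ r → r ℕ.< 2 → k ≡ + r ℤ.+ k ℤ./ℕ 2 ℤ.* + 2 → (k ≡ + 2 ℤ.* (k ℤ./ℕ 2) ℤ.+ + 0) ⊎ (k ≡ + 2 ℤ.*
      (k ℤ./ℕ 2) ℤ.+ + 1)
  cases 0 _ eq = inj₁ (linℤ 2 (λ k h → (k ≐ # 0 ⊕ h ⊗ # 2 ∷ [] ⊢ k ≐ # 2 ⊗ h ⊕ # 0)) k (k ℤ./ℕ 2) eq)
  cases 1 _ eq = inj₂ (linℤ 2 (λ k h → (k ≐ # 1 ⊕ h ⊗ # 2 ∷ [] ⊢ k ≐ # 2 ⊗ h ⊕ # 1)) k (k ℤ./ℕ 2) eq)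
  cases (suc (suc _)) (ℕ.s≤s (ℕ.s≤s ())) _

positive : ∀ c → + 0 ℤ.< + 4 ℤ.* c → + 1 ℤ.≤ c
positive c 0<4c = ℤₚ.i<j⇒suc[i]≤j (linℤ 1 (λ c → (# 0 ⋖ # 4 ⊗ c ∷ [] ⊢ # 0 ⋖ c)) c 0<4c)

module _ (p q : ℤ) (0<4q-p² : + 0 ℤ.< + 4 ℤ.* q ℤ.- p ℤ.* p) (σ : Sign) (L : Setup.Labelling p q σ) where

  private
    p² : sgnℤ σ ℤ.* p ℤ.* (sgnℤ σ ℤ.* p) ≡ p ℤ.* p
    p² = square σ
      where
      square : ∀ σ → sgnℤ σ ℤ.* p ℤ.* (sgnℤ σ ℤ.* p) ≡ p ℤ.* p
      square Sign.+ = linℤ 1 (λ p → ([] ⊢ # 1 ⊗ p ⊗ (# 1 ⊗ p) ≐ p ⊗ p)) p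
      square Sign.- = linℤ 1 (λ p → ([] ⊢ ⊝ # 1 ⊗ p ⊗ (⊝ # 1 ⊗ p) ≐ p ⊗ p)) p

    square-of : ∀ {x} → sgnℤ σ ℤ.* p ≡ x → x ℤ.* x ≡ p ℤ.* p
    square-of eq = trans (cong₂ ℤ._*_ (sym eq) (sym eq)) p²

  -- Writing sp = 2h + e with e the parity of sp and c = q - h² - eh gives 4c - e² = 4q - p² > 0, so
  -- the integer c is at least 1, as both cells require.
  voronoi-tiling : Tiling p q σ L
  voronoi-tiling with parity (sgnℤ σ ℤ.* p)
  ... | h , inj₁ sp≡ = tiling p q σ h 0 c sp≡
        (linℤ 2 (λ q h → ([] ⊢ q ≐ q ⊖ h ⊗ h ⊖ # 0 ⊗ h ⊕ h ⊗ h ⊕ # 0 ⊗ h)) q h)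
        (Rectangle.rectangle (fromℤ c) 1≤c) (linℚ 1 (λ c → (# 1 ≦ c ∷ [] ⊢ # 0 ⋖ # 4 ⊗ c ⊖ # 0 ⊗ # 0))
            (fromℤ c) 1≤c) L
    where
    c : ℤ
    c = q ℤ.- h ℤ.* h ℤ.- + 0 ℤ.* h
    1≤c : 1ℚ ℚ.≤ fromℤ c
    1≤c = fromℤ-mono-≤ (positive c (linℤ 3 (λ p q h → (# 0 ⋖ # 4 ⊗ q ⊖ p ⊗ p ∷ (# 2 ⊗ h ⊕ # 0) ⊗ (# 2 ⊗ h ⊕
        # 0) ≐ p ⊗ p ∷ [] ⊢
      # 0 ⋖ # 4 ⊗ (q ⊖ h ⊗ h ⊖ # 0 ⊗ h))) p q h 0<4q-p² (square-of sp≡)))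
  ... | h , inj₂ sp≡ = tiling p q σ h 1 c sp≡
        (linℤ 2 (λ q h → ([] ⊢ q ≐ q ⊖ h ⊗ h ⊖ # 1 ⊗ h ⊕ h ⊗ h ⊕ # 1 ⊗ h)) q h)
        (Hexagon.hexagon (fromℤ c) 1≤c) (linℚ 1 (λ c → (# 1 ≦ c ∷ [] ⊢ # 0 ⋖ # 4 ⊗ c ⊖ # 1 ⊗ # 1)) (fromℤ c) 1≤c) L
    where
    c : ℤ
    c = q ℤ.- h ℤ.* h ℤ.- + 1 ℤ.* h
    1≤c : 1ℚ ℚ.≤ fromℤ c
    1≤c = fromℤ-mono-≤ (positive c (linℤ 3 (λ p q h → (# 0 ⋖ # 4 ⊗ q ⊖ p ⊗ p ∷ (# 2 ⊗ h ⊕ # 1) ⊗ (# 2 ⊗ h ⊕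
        # 1) ≐ p ⊗ p ∷ [] ⊢
      # 0 ⋖ # 4 ⊗ (q ⊖ h ⊗ h ⊖ # 1 ⊗ h))) p q h 0<4q-p² (square-of sp≡)))

-- The ring ℤ[τ] and its norm

module QuadraticRing (p q : ℤ) (σ : Sign) where
  open Setup p q σ hiding (fromℤ)

  1Z : ZT
  1Z = (+ 1 , + 0)

  *Z-assoc : ∀ x y z → (x *Z y) *Z z ≡ x *Z (y *Z z)
  *Z-assoc (a , b) (c , d) (e , f) = cong₂ _,_
    (linℤ 8 (λ p q a b c d e f → ([] ⊢
      (a ⊗ c ⊖ q ⊗ (b ⊗ d)) ⊗ e ⊖ q ⊗ ((a ⊗ d ⊕ b ⊗ c ⊕ p ⊗ (b ⊗ d)) ⊗ f) ≐
      a ⊗ (c ⊗ e ⊖ q ⊗ (d ⊗ f)) ⊖ q ⊗ (b ⊗ (c ⊗ f ⊕ d ⊗ e ⊕ p ⊗ (d ⊗ f))))) p q a b c d e f)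
    (linℤ 8 (λ p q a b c d e f → ([] ⊢
      (a ⊗ c ⊖ q ⊗ (b ⊗ d)) ⊗ f ⊕ (a ⊗ d ⊕ b ⊗ c ⊕ p ⊗ (b ⊗ d)) ⊗ e ⊕ p ⊗ ((a ⊗ d ⊕ b ⊗ c ⊕ p ⊗ (b ⊗ d)) ⊗ f) ≐
      a ⊗ (c ⊗ f ⊕ d ⊗ e ⊕ p ⊗ (d ⊗ f)) ⊕ b ⊗ (c ⊗ e ⊖ q ⊗ (d ⊗ f)) ⊕ p ⊗ (b ⊗ (c ⊗ f ⊕ d ⊗ e ⊕ p ⊗
          (d ⊗ f))))) p q a b c d e f)

  *Z-comm : ∀ x y → x *Z y ≡ y *Z x
  *Z-comm (a , b) (c , d) = cong₂ _,_
    (linℤ 5 (λ q a b c d → ([] ⊢ a ⊗ c ⊖ q ⊗ (b ⊗ d) ≐ c ⊗ a ⊖ q ⊗ (d ⊗ b))) q a b c d)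
    (linℤ 5 (λ p a b c d → ([] ⊢ a ⊗ d ⊕ b ⊗ c ⊕ p ⊗ (b ⊗ d) ≐ c ⊗ b ⊕ d ⊗ a ⊕ p ⊗ (d ⊗ b))) p a b c d)

  *Z-distribˡ-+Z : ∀ x y z → x *Z (y +Z z) ≡ (x *Z y) +Z (x *Z z)
  *Z-distribˡ-+Z (a , b) (c , d) (e , f) = cong₂ _,_
    (linℤ 7 (λ q a b c d e f → ([] ⊢
      a ⊗ (c ⊕ e) ⊖ q ⊗ (b ⊗ (d ⊕ f)) ≐ a ⊗ c ⊖ q ⊗ (b ⊗ d) ⊕ (a ⊗ e ⊖ q ⊗ (b ⊗ f)))) q a b c d e f)
    (linℤ 7 (λ p a b c d e f → ([] ⊢
      a ⊗ (d ⊕ f) ⊕ b ⊗ (c ⊕ e) ⊕ p ⊗ (b ⊗ (d ⊕ f)) ≐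
      a ⊗ d ⊕ b ⊗ c ⊕ p ⊗ (b ⊗ d) ⊕ (a ⊗ f ⊕ b ⊗ e ⊕ p ⊗ (b ⊗ f)))) p a b c d e f)

  *Z-distribˡ-minus : ∀ x y z → x *Z (y -Z z) ≡ (x *Z y) -Z (x *Z z)
  *Z-distribˡ-minus (a , b) (c , d) (e , f) = cong₂ _,_
    (linℤ 7 (λ q a b c d e f → ([] ⊢
      a ⊗ (c ⊖ e) ⊖ q ⊗ (b ⊗ (d ⊖ f)) ≐ a ⊗ c ⊖ q ⊗ (b ⊗ d) ⊖ (a ⊗ e ⊖ q ⊗ (b ⊗ f)))) q a b c d e f)
    (linℤ 7 (λ p a b c d e f → ([] ⊢
      a ⊗ (d ⊖ f) ⊕ b ⊗ (c ⊖ e) ⊕ p ⊗ (b ⊗ (d ⊖ f)) ≐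
      a ⊗ d ⊕ b ⊗ c ⊕ p ⊗ (b ⊗ d) ⊖ (a ⊗ f ⊕ b ⊗ e ⊕ p ⊗ (b ⊗ f)))) p a b c d e f)

  *Z-zeroʳ : ∀ x → x *Z 0Z ≡ 0Z
  *Z-zeroʳ (a , b) = cong₂ _,_
    (linℤ 3 (λ q a b → ([] ⊢ a ⊗ # 0 ⊖ q ⊗ (b ⊗ # 0) ≐ # 0)) q a b)
    (linℤ 3 (λ p a b → ([] ⊢ a ⊗ # 0 ⊕ b ⊗ # 0 ⊕ p ⊗ (b ⊗ # 0) ≐ # 0)) p a b)

  *Z-identityʳ : ∀ x → x *Z 1Z ≡ x
  *Z-identityʳ (a , b) = cong₂ _,_
    (linℤ 3 (λ q a b → ([] ⊢ a ⊗ # 1 ⊖ q ⊗ (b ⊗ # 0) ≐ a)) q a b)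
    (linℤ 3 (λ p a b → ([] ⊢ a ⊗ # 0 ⊕ b ⊗ # 1 ⊕ p ⊗ (b ⊗ # 0) ≐ b)) p a b)

  private
    pairwise : ∀ {a b c d : ℤ} → a ≡ c → b ≡ d → (a , b) ≡ (c , d)
    pairwise = cong₂ _,_

  +Z-assoc : ∀ x y z → (x +Z y) +Z z ≡ x +Z (y +Z z)
  +Z-assoc (a , b) (c , d) (e , f) = pairwise (ℤₚ.+-assoc a c e) (ℤₚ.+-assoc b d f)

  +Z-identityˡ : ∀ x → 0Z +Z x ≡ x
  +Z-identityˡ (a , b) = pairwise (ℤₚ.+-identityˡ a) (ℤₚ.+-identityˡ b)

  +Z-identityʳ : ∀ x → x +Z 0Z ≡ x
  +Z-identityʳ (a , b) = pairwise (ℤₚ.+-identityʳ a) (ℤₚ.+-identityʳ b)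

  -Z≡0⇒≡ : ∀ x y → x -Z y ≡ 0Z → x ≡ y
  -Z≡0⇒≡ (a , b) (c , d) eq = pairwise (ℤₚ.i-j≡0⇒i≡j a c (cong proj₁ eq)) (ℤₚ.i-j≡0⇒i≡j b d (cong proj₂ eq))

  x-Zx≡0 : ∀ x → x -Z x ≡ 0Z
  x-Zx≡0 (a , b) = pairwise (ℤₚ.+-inverseʳ a) (ℤₚ.+-inverseʳ b)

  -Z-+Z : ∀ x y → (x -Z y) +Z y ≡ x
  -Z-+Z (a , b) (c , d) = pairwise (regroup a c) (regroup b d)
    where
    regroup : ∀ a c → a ℤ.- c ℤ.+ c ≡ a
    regroup = linℤ 2 (λ a c → ([] ⊢ a ⊖ c ⊕ c ≐ a))

  -Z-swap : ∀ x y → 0Z -Z (x -Z y) ≡ y -Z x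
  -Z-swap (a , b) (c , d) = pairwise (swap a c) (swap b d)
    where
    swap : ∀ a c → + 0 ℤ.- (a ℤ.- c) ≡ c ℤ.- a
    swap = linℤ 2 (λ a c → ([] ⊢ # 0 ⊖ (a ⊖ c) ≐ c ⊖ a))

  normZ-* : ∀ x y → normZ (x *Z y) ≡ normZ x ℤ.* normZ y
  normZ-* (a , b) (c , d) = linℤ 6 (λ p q a b c d →
    let x = a ⊗ c ⊖ q ⊗ (b ⊗ d) ; y = a ⊗ d ⊕ b ⊗ c ⊕ p ⊗ (b ⊗ d) in
    ([] ⊢ x ⊗ x ⊕ p ⊗ (x ⊗ y) ⊕ q ⊗ (y ⊗ y) ≐
      (a ⊗ a ⊕ p ⊗ (a ⊗ b) ⊕ q ⊗ (b ⊗ b)) ⊗ (c ⊗ c ⊕ p ⊗ (c ⊗ d) ⊕ q ⊗ (d ⊗ d)))) p q a b c d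

  normZ-τ : normZ τZ ≡ q
  normZ-τ = linℤ 2 (λ p q → ([] ⊢ # 0 ⊗ # 0 ⊕ p ⊗ (# 0 ⊗ # 1) ⊕ q ⊗ (# 1 ⊗ # 1) ≐ q)) p q

  normZ-1 : normZ 1Z ≡ + 1
  normZ-1 = linℤ 2 (λ p q → ([] ⊢ # 1 ⊗ # 1 ⊕ p ⊗ (# 1 ⊗ # 0) ⊕ q ⊗ (# 0 ⊗ # 0) ≐ # 1)) p q

  normZ-0 : normZ 0Z ≡ + 0
  normZ-0 = linℤ 2 (λ p q → ([] ⊢ # 0 ⊗ # 0 ⊕ p ⊗ (# 0 ⊗ # 0) ⊕ q ⊗ (# 0 ⊗ # 0) ≐ # 0)) p q

  parallelogram : ∀ x y → normZ (x -Z y) ℤ.+ normZ (x +Z y) ≡ + 2 ℤ.* normZ x ℤ.+ + 2 ℤ.* normZ y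
  parallelogram (a , b) (c , d) = linℤ 6 (λ p q a b c d →
    let n = λ x y → x ⊗ x ⊕ p ⊗ (x ⊗ y) ⊕ q ⊗ (y ⊗ y) in
    ([] ⊢ n (a ⊖ c) (b ⊖ d) ⊕ n (a ⊕ c) (b ⊕ d) ≐ # 2 ⊗ n a b ⊕ # 2 ⊗ n c d)) p q a b c d

  normZ-double : ∀ x → normZ (x +Z x) ≡ + 4 ℤ.* normZ x
  normZ-double (a , b) = linℤ 4 (λ p q a b → let n = λ x y → x ⊗ x ⊕ p ⊗ (x ⊗ y) ⊕ q ⊗ (y ⊗ y) in
    ([] ⊢ n (a ⊕ a) (b ⊕ b) ≐ # 4 ⊗ n a b)) p q a b

  x-Z[x-Zy]≡y : ∀ x y → x -Z (x -Z y) ≡ y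
  x-Z[x-Zy]≡y (a , b) (c , d) = pairwise (regroup a c) (regroup b d)
    where
    regroup : ∀ a c → a ℤ.- (a ℤ.- c) ≡ c
    regroup = linℤ 2 (λ a c → ([] ⊢ a ⊖ (a ⊖ c) ≐ c))

  -- τ(p - τ) = q, so τ divides a + bτ exactly when q divides a; for a = kq the quotient is b + k(p
  -- - τ).
  divisible? : ∀ x → + 1 ℤ.< q → Dec (τZ ∣Z x)
  divisible? (a , b) 1<q = map′ to from (q ℤ.∣? a)
    where
    to : q ℤ.∣ a → τZ ∣Z (a , b)
    to (ℤ.divides k a≡kq) = (b ℤ.+ p ℤ.* k , ℤ.- k) , pairwise
      (linℤ 5 (λ p q a b k → (a ≐ k ⊗ q ∷ [] ⊢ a ≐ # 0 ⊗ (b ⊕ p ⊗ k) ⊖ q ⊗ (# 1 ⊗ ⊝ k))) p q a b k a≡kq)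
      (linℤ 4 (λ p q b k → ([] ⊢ b ≐ # 0 ⊗ ⊝ k ⊕ # 1 ⊗ (b ⊕ p ⊗ k) ⊕ p ⊗ (# 1 ⊗ ⊝ k))) p q b k)
    from : τZ ∣Z (a , b) → q ℤ.∣ a
    from ((c , d) , eq) = ℤ.divides (ℤ.- d) (linℤ 4 (λ q a c d → (a ≐ # 0 ⊗ c ⊖ q ⊗ (# 1 ⊗ d) ∷ [] ⊢
        a ≐ ⊝ d ⊗ q)) q a c d (cong proj₁ eq))

  module Definite (0<4q-p² : + 0 ℤ.< + 4 ℤ.* q ℤ.- p ℤ.* p) where

    -- 4|a + bτ|² = (2a + pb)² + (4q - p²)b².
    normZ≥0 : ∀ x → + 0 ℤ.≤ normZ x
    normZ≥0 (a , b) = linℤ 4 (λ p q a b →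
      (# 0 ≦ (# 2 ⊗ a ⊕ p ⊗ b) ⊗ (# 2 ⊗ a ⊕ p ⊗ b) ∷ # 0 ≦ (# 4 ⊗ q ⊖ p ⊗ p) ⊗ (b ⊗ b) ∷ [] ⊢
       # 0 ≦ a ⊗ a ⊕ p ⊗ (a ⊗ b) ⊕ q ⊗ (b ⊗ b))) p q a b
      (square≥0ℤ (+ 2 ℤ.* a ℤ.+ p ℤ.* b)) (*-nonNegℤ (ℤₚ.<⇒≤ 0<4q-p²) (square≥0ℤ b))

    normZ≡0⇒≡0 : ∀ x → normZ x ℤ.≤ + 0 → x ≡ 0Z
    normZ≡0⇒≡0 (a , b) N≤0 = cong₂ _,_ a≡0 b≡0
      where
      d : ℤ
      d = + 4 ℤ.* q ℤ.- p ℤ.* p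
      1≤d : + 1 ℤ.≤ d
      1≤d = ℤₚ.i<j⇒suc[i]≤j 0<4q-p²
      b≡0 : b ≡ + 0
      b≡0 = square≡0ℤ b (linℤ 4 (λ p q a b →
        (# 0 ≦ (# 2 ⊗ a ⊕ p ⊗ b) ⊗ (# 2 ⊗ a ⊕ p ⊗ b) ∷ # 0 ≦ (# 4 ⊗ q ⊖ p ⊗ p ⊖ # 1) ⊗ (b ⊗ b) ∷
         a ⊗ a ⊕ p ⊗ (a ⊗ b) ⊕ q ⊗ (b ⊗ b) ≦ # 0 ∷ [] ⊢ b ⊗ b ≦ # 0)) p q a b
        (square≥0ℤ (+ 2 ℤ.* a ℤ.+ p ℤ.* b)) (*-nonNegℤ (ℤₚ.i≤j⇒0≤j-i 1≤d) (square≥0ℤ b)) N≤0)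
      a≡0 : a ≡ + 0
      a≡0 = square≡0ℤ a (subst (ℤ._≤ + 0) (trans (cong (λ b → normZ (a , b)) b≡0)
        (linℤ 3 (λ p q a → ([] ⊢ a ⊗ a ⊕ p ⊗ (a ⊗ # 0) ⊕ q ⊗ (# 0 ⊗ # 0) ≐ a ⊗ a)) p q a)) N≤0)

    normZ>0 : ∀ {x} → ¬ x ≡ 0Z → + 1 ℤ.≤ normZ x
    normZ>0 {x} x≢0 = ℤₚ.i<j⇒suc[i]≤j (ℤₚ.≰⇒> λ N≤0 → x≢0 (normZ≡0⇒≡0 x N≤0))

    -- The norm is multiplicative and positive definite, so the norm of x - y vanishes.
    cancelˡ : ∀ t x y → + 1 ℤ.≤ normZ t → t *Z x ≡ t *Z y → x ≡ y
    cancelˡ t x y 1≤t eq = -Z≡0⇒≡ x y (normZ≡0⇒≡0 (x -Z y) (linℤ 2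
      (λ t n → (t ⊗ n ≐ # 0 ∷ # 0 ≦ (t ⊖ # 1) ⊗ n ∷ [] ⊢ n ≦ # 0)) (normZ t) (normZ (x -Z y))
      (trans (sym (normZ-* t (x -Z y))) (trans (cong normZ (trans (*Z-distribˡ-minus t x y)
          (trans (cong (_-Z (t *Z y)) eq) (x-Zx≡0 (t *Z y))))) normZ-0))
      (*-nonNegℤ (ℤₚ.i≤j⇒0≤j-i 1≤t) (normZ≥0 (x -Z y)))))

-- Division in ℚ(τ)

module NumberField where

  open import Data.Rational using (_+_; _*_; _-_; -_; _≤_; _<_)

  square≥0 : ∀ x → 0ℚ ≤ x * x
  square≥0 x with ℚₚ.≤-total 0ℚ x
  ... | inj₁ 0≤x = *-nonNeg 0≤x 0≤x
  ... | inj₂ x≤0 = linℚ 1 (λ x → (# 0 ≦ (# 0 ⊖ x) ⊗ (# 0 ⊖ x) ∷ [] ⊢ # 0 ≦ x ⊗ x)) x (*-nonNeg (subtract-≤ x≤0)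
      (subtract-≤ x≤0))

  square≡0 : ∀ x → x * x ≤ 0ℚ → x ≡ 0ℚ
  square≡0 x x²≤0 with ℚₚ.<-cmp x 0ℚ
  ... | tri≈ _ x≡0 _ = x≡0
  ... | tri> _ _ 0<x = ⊥-elim (ℚₚ.<-irrefl refl (ℚₚ.<-≤-trans (*-pos 0<x 0<x) x²≤0))
  ... | tri< x<0 _ _ = ⊥-elim (linℚ 1 (λ x → (# 0 ⋖ (# 0 ⊖ x) ⊗ (# 0 ⊖ x) ∷ x ⊗ x ≦ # 0 ∷ [] ⊢ ff)) x
          (*-pos (subtract-< x<0) (subtract-< x<0)) x²≤0)

  module QuadraticField (p q : ℤ) (σ : Sign) (0<4q-p² : + 0 ℤ.< + 4 ℤ.* q ℤ.- p ℤ.* p) where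
    open Setup p q σ hiding (fromℤ)
    open QuadraticRing p q σ
    open Definite 0<4q-p²

    embed-minus : ∀ x y → embed (x -Z y) ≡ embed x -Q embed y
    embed-minus (a , b) (c , d) = cong₂ _,_ (fromℤ-minus a c) (fromℤ-minus b d)

    embed-* : ∀ x y → embed (x *Z y) ≡ embed x *Q embed y
    embed-* (a , b) (c , d) = cong₂ _,_
      (trans (fromℤ-minus (a ℤ.* c) (q ℤ.* (b ℤ.* d)))
        (cong₂ _-_ (fromℤ-* a c) (trans (fromℤ-* q (b ℤ.* d)) (cong (qQ *_) (fromℤ-* b d)))))
      (trans (fromℤ-+ (a ℤ.* d ℤ.+ b ℤ.* c) (p ℤ.* (b ℤ.* d)))
        (cong₂ _+_ (trans (fromℤ-+ (a ℤ.* d) (b ℤ.* c)) (cong₂ _+_ (fromℤ-* a d) (fromℤ-* b c)))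
          (trans (fromℤ-* p (b ℤ.* d)) (cong (pQ *_) (fromℤ-* b d)))))

    embed-injective : ∀ x y → embed x ≡ embed y → x ≡ y
    embed-injective (a , b) (c , d) eq = cong₂ _,_ (fromℤ-injective (cong proj₁ eq)) (fromℤ-injective (cong proj₂ eq))

    normQ-embed : ∀ x → normQ (embed x) ≡ fromℤ (normZ x)
    normQ-embed (a , b) = sym (trans (fromℤ-+ (a ℤ.* a ℤ.+ p ℤ.* (a ℤ.* b)) (q ℤ.* (b ℤ.* b)))
      (cong₂ _+_ (trans (fromℤ-+ (a ℤ.* a) (p ℤ.* (a ℤ.* b)))
          (cong₂ _+_ (fromℤ-* a a) (trans (fromℤ-* p (a ℤ.* b)) (cong (pQ *_) (fromℤ-* a b)))))
        (trans (fromℤ-* q (b ℤ.* b)) (cong (qQ *_) (fromℤ-* b b)))))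

    normQ-* : ∀ u v → normQ (u *Q v) ≡ normQ u * normQ v
    normQ-* (a , b) (c , d) = linℚ 6 (λ p q a b c d →
      let x = a ⊗ c ⊖ q ⊗ (b ⊗ d) ; y = a ⊗ d ⊕ b ⊗ c ⊕ p ⊗ (b ⊗ d) in
      ([] ⊢ x ⊗ x ⊕ p ⊗ (x ⊗ y) ⊕ q ⊗ (y ⊗ y) ≐
        (a ⊗ a ⊕ p ⊗ (a ⊗ b) ⊕ q ⊗ (b ⊗ b)) ⊗ (c ⊗ c ⊕ p ⊗ (c ⊗ d) ⊕ q ⊗ (d ⊗ d)))) pQ qQ a b c d

    normQ-quotient : ∀ t y u → embed t *Q u ≡ embed y → fromℤ (normZ t) * normQ u ≡ fromℤ (normZ y)
    normQ-quotient t y u eq = trans (cong (_* normQ u) (sym (normQ-embed t)))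
      (trans (sym (normQ-* (embed t) u)) (trans (cong normQ eq) (normQ-embed y)))

    *Q-distribˡ-minus : ∀ x y z → x *Q (y -Q z) ≡ (x *Q y) -Q (x *Q z)
    *Q-distribˡ-minus (a , b) (c , d) (e , f) = cong₂ _,_
      (linℚ 7 (λ q a b c d e f → ([] ⊢
        a ⊗ (c ⊖ e) ⊖ q ⊗ (b ⊗ (d ⊖ f)) ≐ a ⊗ c ⊖ q ⊗ (b ⊗ d) ⊖ (a ⊗ e ⊖ q ⊗ (b ⊗ f)))) qQ a b c d e f)
      (linℚ 7 (λ p a b c d e f → ([] ⊢
        a ⊗ (d ⊖ f) ⊕ b ⊗ (c ⊖ e) ⊕ p ⊗ (b ⊗ (d ⊖ f)) ≐
        a ⊗ d ⊕ b ⊗ c ⊕ p ⊗ (b ⊗ d) ⊖ (a ⊗ f ⊕ b ⊗ e ⊕ p ⊗ (b ⊗ f)))) pQ a b c d e f)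

    private
      0<norm : ∀ t → + 1 ℤ.≤ normZ t → 0ℚ < normQ (embed t)
      0<norm t 1≤t = subst (0ℚ <_) (sym (normQ-embed t)) (fromℤ-mono-< (ℤₚ.<-≤-trans (ℤ.+<+ ℕ.z<s) 1≤t))

    abstract
      quotient : ∀ t y → + 1 ℤ.≤ normZ t → Σ QT λ u → embed t *Q u ≡ embed y
      quotient t@(a , b) y@(l , m) 1≤t = divide (reciprocal (0<norm t 1≤t))
        where
        A B X Y : ℚ
        A = fromℤ a
        B = fromℤ b
        X = fromℤ l
        Y = fromℤ m
        divide : (Σ ℚ λ r → 0ℚ < r × normQ (embed t) * r ≡ 1ℚ) → Σ QT λ u → embed t *Q u ≡ embed y
        divide (r , _ , Nr≡1) =
          -- The conjugate of t = A + Bτ is A + pB - Bτ; the quotient is this conjugate times y,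
          -- divided by |t|².
          (r * ((A + pQ * B) * X + qQ * (B * Y)) , r * (A * Y - B * X)) ,
          cong₂ _,_
            (trans (linℚ 7 (λ p q A B X Y r → ([] ⊢
              A ⊗ (r ⊗ ((A ⊕ p ⊗ B) ⊗ X ⊕ q ⊗ (B ⊗ Y))) ⊖ q ⊗ (B ⊗ (r ⊗ (A ⊗ Y ⊖ B ⊗ X))) ≐
              (A ⊗ A ⊕ p ⊗ (A ⊗ B) ⊕ q ⊗ (B ⊗ B)) ⊗ r ⊗ X)) pQ qQ A B X Y r)
              (trans (cong (_* X) Nr≡1) (ℚₚ.*-identityˡ X)))
            (trans (linℚ 7 (λ p q A B X Y r → ([] ⊢
              A ⊗ (r ⊗ (A ⊗ Y ⊖ B ⊗ X)) ⊕ B ⊗ (r ⊗ ((A ⊕ p ⊗ B) ⊗ X ⊕ q ⊗ (B ⊗ Y))) ⊕ p ⊗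
                  (B ⊗ (r ⊗ (A ⊗ Y ⊖ B ⊗ X))) ≐
              (A ⊗ A ⊕ p ⊗ (A ⊗ B) ⊕ q ⊗ (B ⊗ B)) ⊗ r ⊗ Y)) pQ qQ A B X Y r)
              (trans (cong (_* Y) Nr≡1) (ℚₚ.*-identityˡ Y)))

      -- Multiplying by the conjugate of t leaves |t|² times the difference in each component.
      *Q-cancelˡ : ∀ t u v → + 1 ℤ.≤ normZ t → embed t *Q u ≡ embed t *Q v → u ≡ v
      *Q-cancelˡ t@(a , b) u@(x , y) v@(x′ , y′) 1≤t eq = cong₂ _,_
        (difference x x′ (cancel-zero (0<norm t 1≤t) first)) (difference y y′ (cancel-zero (0<norm t 1≤t) second))
        where
        A B f₁ f₂ : ℚ
        A = fromℤ a
        B = fromℤ b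
        f₁ = A * x′ - qQ * (B * y′)
        f₂ = A * y′ + B * x′ + pQ * (B * y′)
        difference : ∀ x y → x - y ≡ 0ℚ → x ≡ y
        difference = linℚ 2 (λ x y → (x ⊖ y ≐ # 0 ∷ [] ⊢ x ≐ y))
        first : normQ (embed t) * (x - x′) ≡ 0ℚ
        first = trans (linℚ 8 (λ p q A B x y x′ y′ → ([] ⊢
            (A ⊗ A ⊕ p ⊗ (A ⊗ B) ⊕ q ⊗ (B ⊗ B)) ⊗ (x ⊖ x′) ≐
            (A ⊕ p ⊗ B) ⊗ ((A ⊗ x ⊖ q ⊗ (B ⊗ y)) ⊖ (A ⊗ x′ ⊖ q ⊗ (B ⊗ y′))) ⊕
            q ⊗ B ⊗ ((A ⊗ y ⊕ B ⊗ x ⊕ p ⊗ (B ⊗ y)) ⊖ (A ⊗ y′ ⊕ B ⊗ x′ ⊕ p ⊗ (B ⊗ y′))))) pQ qQ A B x y x′ y′)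
          (trans (cong₂ (λ k l → (A + pQ * B) * (k - f₁) + qQ * B * (l - f₂)) (cong proj₁ eq) (cong proj₂ eq))
            (linℚ 6 (λ p q A B f g → ([] ⊢ (A ⊕ p ⊗ B) ⊗ (f ⊖ f) ⊕ q ⊗ B ⊗ (g ⊖ g) ≐ # 0)) pQ qQ A B f₁ f₂))
        second : normQ (embed t) * (y - y′) ≡ 0ℚ
        second = trans (linℚ 8 (λ p q A B x y x′ y′ → ([] ⊢
            (A ⊗ A ⊕ p ⊗ (A ⊗ B) ⊕ q ⊗ (B ⊗ B)) ⊗ (y ⊖ y′) ≐
            A ⊗ ((A ⊗ y ⊕ B ⊗ x ⊕ p ⊗ (B ⊗ y)) ⊖ (A ⊗ y′ ⊕ B ⊗ x′ ⊕ p ⊗ (B ⊗ y′))) ⊖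
            B ⊗ ((A ⊗ x ⊖ q ⊗ (B ⊗ y)) ⊖ (A ⊗ x′ ⊖ q ⊗ (B ⊗ y′))))) pQ qQ A B x y x′ y′)
          (trans (cong₂ (λ k l → A * (l - f₂) - B * (k - f₁)) (cong proj₁ eq) (cong proj₂ eq))
            (linℚ 4 (λ A B f g → ([] ⊢ A ⊗ (g ⊖ g) ⊖ B ⊗ (f ⊖ f) ≐ # 0)) A B f₁ f₂))

    normQ≤0⇒≡0 : ∀ u → normQ u ≤ 0ℚ → u ≡ (0ℚ , 0ℚ)
    normQ≤0⇒≡0 (a , b) N≤0 = cong₂ _,_ a≡0 b≡0
      where
      1≤Δ : 1ℚ ≤ fromℤ (+ 4) * qQ - pQ * pQ
      1≤Δ = subst (1ℚ ≤_) (trans (fromℤ-minus (+ 4 ℤ.* q) (p ℤ.* p)) (cong₂ _-_ (fromℤ-* (+ 4) q) (fromℤ-* p p)))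
        (fromℤ-mono-≤ (ℤₚ.i<j⇒suc[i]≤j 0<4q-p²))
      b≡0 : b ≡ 0ℚ
      b≡0 = square≡0 b (linℚ 4 (λ p q a b →
        (# 0 ≦ (# 2 ⊗ a ⊕ p ⊗ b) ⊗ (# 2 ⊗ a ⊕ p ⊗ b) ∷ # 0 ≦ (# 4 ⊗ q ⊖ p ⊗ p ⊖ # 1) ⊗ (b ⊗ b) ∷
         a ⊗ a ⊕ p ⊗ (a ⊗ b) ⊕ q ⊗ (b ⊗ b) ≦ # 0 ∷ [] ⊢ b ⊗ b ≦ # 0)) pQ qQ a b
        (square≥0 (fromℤ (+ 2) * a + pQ * b)) (*-nonNeg (subtract-≤ 1≤Δ) (square≥0 b)) N≤0)
      a≡0 : a ≡ 0ℚ
      a≡0 = square≡0 a (subst (_≤ 0ℚ) (trans (cong (λ b → normQ (a , b)) b≡0)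
        (linℚ 3 (λ p q a → ([] ⊢ a ⊗ a ⊕ p ⊗ (a ⊗ # 0) ⊕ q ⊗ (# 0 ⊗ # 0) ≐ a ⊗ a)) pQ qQ a)) N≤0)

    parallelogramQ : ∀ u v → normQ ((u +Q u) -Q v) + normQ v ≡ fromℤ (+ 2) * normQ u + fromℤ (+ 2) * normQ (u -Q v)
    parallelogramQ (a , b) (c , d) = linℚ 6 (λ p q a b c d →
      let n = λ x y → x ⊗ x ⊕ p ⊗ (x ⊗ y) ⊕ q ⊗ (y ⊗ y) in
      ([] ⊢ n (a ⊕ a ⊖ c) (b ⊕ b ⊖ d) ⊕ n c d ≐ # 2 ⊗ n a b ⊕ # 2 ⊗ n (a ⊖ c) (b ⊖ d))) pQ qQ a b c d

    -- As all nonzero lattice points have norm at least 1, the parallelogram law shows that a point u with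
    -- 4|u|² ≤ 1 is in the interior of V unless 2u is a lattice point.
    interior : ∀ u → fromℤ (+ 4) * normQ u ≤ 1ℚ → (∀ y → ¬ u +Q u ≡ embed y) → InteriorV u
    interior u 4N≤1 2u∉ y y≢0 = ℚₚ.≰⇒> λ closer → 2u∉ y (equal (normQ≤0⇒≡0 ((u +Q u) -Q embed y)
      (linℚ 4 (λ n₂ ny n n′ → (n₂ ⊕ ny ≐ # 2 ⊗ n ⊕ # 2 ⊗ n′ ∷ # 1 ≦ ny ∷ # 4 ⊗ n ≦ # 1 ∷ n′ ≦ n ∷ [] ⊢ n₂ ≦ # 0))
        (normQ ((u +Q u) -Q embed y)) (normQ (embed y)) (normQ u) (normQ (u -Q embed y))
        (parallelogramQ u (embed y)) (subst (1ℚ ≤_) (sym (normQ-embed y)) (fromℤ-mono-≤ (normZ>0 y≢0))) 4N≤1 closer)))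
      where
      equal : (u +Q u) -Q embed y ≡ (0ℚ , 0ℚ) → u +Q u ≡ embed y
      equal eq = cong₂ _,_ (difference (proj₁ u + proj₁ u) (proj₁ (embed y)) (cong proj₁ eq)) (difference
          (proj₂ u + proj₂ u) (proj₂ (embed y)) (cong proj₂ eq))
        where
        difference : ∀ x y → x - y ≡ 0ℚ → x ≡ y
        difference = linℚ 2 (λ x y → (x ⊖ y ≐ # 0 ∷ [] ⊢ x ≐ y))

    -- `interior` for u = y/t with denominators cleared: 2u = x for a lattice point x means tx = 2y.
    interior-quotient : ∀ t y u → + 1 ℤ.≤ normZ t → embed t *Q u ≡ embed y → + 4 ℤ.* normZ y ℤ.≤ normZ t →
      (∀ x → ¬ t *Z x ≡ y +Z y) → InteriorV u
    interior-quotient t y u 1≤t tu≡y 4y≤t 2y∉ = interior u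
      (ℚₚ.≮⇒≥ λ 1<4N → linℚ 3 (λ t n y → (t ⊗ n ≐ y ∷ # 4 ⊗ y ≦ t ∷ # 0 ⋖ t ⊗ (# 4 ⊗ n ⊖ # 1) ∷ [] ⊢ ff))
          (fromℤ (normZ t)) (normQ u) (fromℤ (normZ y))
        (normQ-quotient t y u tu≡y) (subst (_≤ fromℤ (normZ t)) (fromℤ-* (+ 4) (normZ y)) (fromℤ-mono-≤ 4y≤t))
        (*-pos (fromℤ-mono-< (ℤₚ.<-≤-trans (ℤ.+<+ ℕ.z<s) 1≤t)) (subtract-< 1<4N)))
      λ x 2u≡x → 2y∉ x (embed-injective (t *Z x) (y +Z y) (trans (embed-* t x) (trans (cong (embed t *Q_) (sym 2u≡x))
        (trans (double (embed t) u) (trans (cong₂ _+Q_ tu≡y tu≡y) (sym (double-embed y)))))))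
      where
      double : ∀ t u → t *Q (u +Q u) ≡ (t *Q u) +Q (t *Q u)
      double (a , b) (x , y) = cong₂ _,_
        (linℚ 5 (λ q a b x y → ([] ⊢ a ⊗ (x ⊕ x) ⊖ q ⊗ (b ⊗ (y ⊕ y)) ≐ a ⊗ x ⊖ q ⊗ (b ⊗ y) ⊕
            (a ⊗ x ⊖ q ⊗ (b ⊗ y)))) qQ a b x y)
        (linℚ 5 (λ p a b x y → ([] ⊢ a ⊗ (y ⊕ y) ⊕ b ⊗ (x ⊕ x) ⊕ p ⊗ (b ⊗ (y ⊕ y)) ≐
          a ⊗ y ⊕ b ⊗ x ⊕ p ⊗ (b ⊗ y) ⊕ (a ⊗ y ⊕ b ⊗ x ⊕ p ⊗ (b ⊗ y)))) pQ a b x y)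
      double-embed : ∀ y → embed (y +Z y) ≡ embed y +Q embed y
      double-embed (a , b) = cong₂ _,_ (fromℤ-+ a a) (fromℤ-+ b b)

open NumberField

-- Digits, and division by τʷ with a digit as remainder

module Digits (p q : ℤ) (0<4q-p² : + 0 ℤ.< + 4 ℤ.* q ℤ.- p ℤ.* p) (σ : Sign) (1<q : + 1 ℤ.< q)
  (L : Setup.Labelling p q σ) (T : Tiling p q σ L) (k : ℕ) where

  open Setup p q σ hiding (fromℤ)
  open QuadraticRing p q σ
  open Definite 0<4q-p²
  open QuadraticField p q σ 0<4q-p²

  w : ℕ
  w = suc (suc k)

  open Setup.Width p q σ L w public

  t : ZT
  t = τZ ^Z w

  2≤q : + 2 ℤ.≤ q
  2≤q = ℤₚ.i<j⇒suc[i]≤j 1<q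

  1≤norm-τ^ : ∀ n → + 1 ℤ.≤ normZ (τZ ^Z n)
  1≤norm-τ^ zero = ℤₚ.≤-reflexive (sym normZ-1)
  1≤norm-τ^ (suc n) = subst (+ 1 ℤ.≤_) (sym (trans (normZ-* τZ (τZ ^Z n)) (cong (ℤ._* normZ (τZ ^Z n)) normZ-τ)))
    (linℤ 2 (λ q m → (# 2 ≦ q ∷ # 1 ≦ m ∷ # 0 ≦ (q ⊖ # 2) ⊗ m ∷ [] ⊢ # 1 ≦ q ⊗ m)) q (normZ (τZ ^Z n)) 2≤q
        (1≤norm-τ^ n)
      (*-nonNegℤ (ℤₚ.i≤j⇒0≤j-i 2≤q) (normZ≥0 (τZ ^Z n))))

  1≤t : + 1 ℤ.≤ normZ t
  1≤t = 1≤norm-τ^ w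

  _≟Z_ : (x y : ZT) → Dec (x ≡ y)
  _≟Z_ = ≡-dec ℤ._≟_ ℤ._≟_

  τ∣-+Z : ∀ x y → τZ ∣Z x → τZ ∣Z y → τZ ∣Z (x +Z y)
  τ∣-+Z x y (c , x≡) (d , y≡) = c +Z d , trans (cong₂ _+Z_ x≡ y≡) (sym (*Z-distribˡ-+Z τZ c d))

  τ∣t* : ∀ x → τZ ∣Z (t *Z x)
  τ∣t* x = (τZ ^Z suc k) *Z x , *Z-assoc τZ (τZ ^Z suc k) x

  τ∣-difference : ∀ d y x → y -Z d ≡ t *Z x → τZ ∣Z d → τZ ∣Z y
  τ∣-difference d y x y-d≡ τ∣d = subst (τZ ∣Z_) (-Z-+Z y d) (τ∣-+Z (y -Z d) d (subst (τZ ∣Z_) (sym y-d≡)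
      (τ∣t* x)) τ∣d)

  abstract
    -- The quotients of d and d′ by τʷ both lie in Ṽ and differ by a lattice point, which is 0
    -- because the tiles are disjoint.
    digit-unique : ∀ d d′ → InτʷṼ d → InτʷṼ d′ → d′ ≡ d [modZ t ] → d′ ≡ d
    digit-unique d d′ (u , u∈ , tu≡d) (u′ , u′∈ , tu′≡d′) (x , d′-d≡) =
      -Z≡0⇒≡ d′ d (trans d′-d≡ (trans (cong (t *Z_) x≡0) (*Z-zeroʳ t)))
      where
      u≡ : u ≡ u′ -Q embed x
      u≡ = *Q-cancelˡ t u (u′ -Q embed x) 1≤t (sym (begin
        embed t *Q (u′ -Q embed x)                   ≡⟨ *Q-distribˡ-minus (embed t) u′ (embed x) ⟩
        (embed t *Q u′) -Q (embed t *Q embed x)      ≡⟨ cong₂ _-Q_ tu′≡d′ (trans (sym (embed-* t x)) (cong embed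
            (sym d′-d≡))) ⟩
        embed d′ -Q embed (d′ -Z d)                  ≡⟨ embed-minus d′ (d′ -Z d) ⟨
        embed (d′ -Z (d′ -Z d))                      ≡⟨ cong embed (x-Z[x-Zy]≡y d′ d) ⟩
        embed d                                      ≡⟨ tu≡d ⟨
        embed t *Q u                                 ∎))
        where
        open ≡-Reasoning
      x≡0 : x ≡ 0Z
      x≡0 = Tiling.unique T u′ x u′∈ (subst (InṼ L) u≡ u∈)

    -- The lattice point x that moves y/τʷ into Ṽ gives d = y - τʷx.
    digit-exists : ∀ y → Σ ZT λ d → Σ ZT λ x → InτʷṼ d × y -Z d ≡ t *Z x
    digit-exists y = from (quotient t y 1≤t)
      where
      from : (Σ QT λ u → embed t *Q u ≡ embed y) → Σ ZT λ d → Σ ZT λ x → InτʷṼ d × y -Z d ≡ t *Z x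
      from (u , tu≡y) = reduce (Tiling.exists T u)
        where
        reduce : (Σ ZT λ x → InṼ L (u -Q embed x)) → Σ ZT λ d → Σ ZT λ x → InτʷṼ d × y -Z d ≡ t *Z x
        reduce (x , u-x∈) = y -Z (t *Z x) , x ,
          (u -Q embed x , u-x∈ , trans (*Q-distribˡ-minus (embed t) u (embed x))
            (trans (cong₂ _-Q_ tu≡y (sym (embed-* t x))) (sym (embed-minus y (t *Z x))))) ,
          x-Z[x-Zy]≡y y (t *Z x)

    digit-bound : ∀ d → InτʷṼ d → + 16 ℤ.* normZ d ℤ.≤ (+ 4 ℤ.* q ℤ.- p ℤ.* p ℤ.+ + 4) ℤ.* normZ t
    digit-bound d (u , u∈ , tu≡d) = fromℤ-cancel-≤ (subst₂ ℚ._≤_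
      (trans (cong (fromℤ (+ 16) ℚ.*_) (normQ-quotient t d u tu≡d)) (sym (fromℤ-* (+ 16) (normZ d))))
      (sym bound≡)
      (linℚ 3 (λ m n b → (# 0 ≦ m ⊗ (b ⊖ # 16 ⊗ n) ∷ [] ⊢ # 16 ⊗ (m ⊗ n) ≦ b ⊗ m)) (fromℤ (normZ t)) (normQ u)
        (fromℤ (+ 4) ℚ.* qQ ℚ.- pQ ℚ.* pQ ℚ.+ fromℤ (+ 4))
        (*-nonNeg (fromℤ-mono-≤ (normZ≥0 t)) (subtract-≤ (Tiling.bound T u u∈)))))
      where
      bound≡ : fromℤ ((+ 4 ℤ.* q ℤ.- p ℤ.* p ℤ.+ + 4) ℤ.* normZ t) ≡ (fromℤ (+ 4) ℚ.* qQ ℚ.- pQ ℚ.* pQ ℚ.+ fromℤ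
          (+ 4)) ℚ.* fromℤ (normZ t)
      bound≡ = trans (fromℤ-* (+ 4 ℤ.* q ℤ.- p ℤ.* p ℤ.+ + 4) (normZ t)) (cong (ℚ._* fromℤ (normZ t))
        (trans (fromℤ-+ (+ 4 ℤ.* q ℤ.- p ℤ.* p) (+ 4)) (cong (ℚ._+ fromℤ (+ 4))
          (trans (fromℤ-minus (+ 4 ℤ.* q) (p ℤ.* p)) (cong₂ ℚ._-_ (fromℤ-* (+ 4) q) (fromℤ-* p p))))))

    interior⇒InτʷṼ : ∀ y → + 4 ℤ.* normZ y ℤ.≤ normZ t → (∀ x → ¬ t *Z x ≡ y +Z y) → InτʷṼ y
    interior⇒InτʷṼ y 4y≤t 2y∉ = from (quotient t y 1≤t)
      where
      from : (Σ QT λ u → embed t *Q u ≡ embed y) → InτʷṼ y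
      from (u , tu≡y) = u , inj₁ (interior-quotient t y u 1≤t tu≡y 4y≤t 2y∉) , tu≡y

  InD-intro : ∀ d → ¬ τZ ∣Z d → InτʷṼ d → InD d
  InD-intro d τ∤d d∈ = inj₂ (τ∤d , d∈ , λ d′ d′≡d d′∈ → digit-unique d d′ d∈ d′∈ d′≡d)

  congruent : ∀ d y x → y -Z d ≡ t *Z x → d ≡ y [modZ t ]
  congruent d y x eq = 0Z -Z x , trans (sym (-Z-swap y d)) (trans (cong (0Z -Z_) eq)
    (sym (trans (*Z-distribˡ-minus t 0Z x) (cong (_-Z (t *Z x)) (*Z-zeroʳ t)))))

  Terminates : ZT → Set
  Terminates y = Σ (List ZT) (Alg y)

  τ≢0* : ∀ n {y} → ¬ y ≡ 0Z → ¬ (τZ ^Z n) *Z y ≡ 0Z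
  τ≢0* n {y} y≢0 eq = y≢0 (cancelˡ (τZ ^Z n) y 0Z (1≤norm-τ^ n) (trans eq (sym (*Z-zeroʳ (τZ ^Z n)))))

  -- A nonzero digit leaves τ^(w-1)x, so w - 1 zeros come before the digits of x. This lets the
  -- termination proof pass from y to x directly; x = 0 is separate, since the algorithm then stops
  -- at once.
  pad : ∀ n {y} → ¬ y ≡ 0Z → Terminates y → Terminates ((τZ ^Z n) *Z y)
  pad zero {y} y≢0 run = subst Terminates (sym (trans (*Z-comm 1Z y) (*Z-identityʳ y))) run
  pad (suc n) {y} y≢0 run with ds , alg ← pad n y≢0 run =
    0Z ∷ ds , step0 (τ≢0* (suc n) y≢0) ((τZ ^Z n) *Z y , *Z-assoc τZ (τZ ^Z n) y) (*Z-assoc τZ (τZ ^Z n) y) alg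

  step : ∀ y d x → ¬ y ≡ 0Z → ¬ τZ ∣Z y → InD d → y -Z d ≡ t *Z x → Terminates x → Terminates y
  step y d x y≢0 τ∤y d∈ y-d≡ run with x ≟Z 0Z
  ... | yes refl = d ∷ [] , stepD y≢0 τ∤y d∈ (congruent d y 0Z y-d≡) (trans y-d≡ (trans (*Z-zeroʳ t)
      (sym (*Z-zeroʳ τZ)))) done
  ... | no x≢0 with ds , alg ← pad (suc k) x≢0 run =
    d ∷ ds , stepD y≢0 τ∤y d∈ (congruent d y x y-d≡) (trans y-d≡ (*Z-assoc τZ (τZ ^Z suc k) x)) alg

  record Division (y : ZT) : Set where
    field
      d x    : ZT
      d∈     : InτʷṼ d
      τ∤d    : ¬ τZ ∣Z d
      y-d≡tx : y -Z d ≡ t *Z x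

    -- The defect is |2y + d|². Compared with `exact` the weight is shifted from |d|² to |y|²,
    -- because the bound on |d| is larger than the least |y| to be considered.
    weighted : + 2 ℤ.* (normZ t ℤ.* normZ x) ℤ.≤ + 6 ℤ.* normZ y ℤ.+ + 3 ℤ.* normZ d
    weighted = subst (λ n → + 2 ℤ.* n ℤ.≤ + 6 ℤ.* normZ y ℤ.+ + 3 ℤ.* normZ d) (trans (cong normZ y-d≡tx)
        (normZ-* t x)) (bound y d)
      where
      bound : ∀ y d → + 2 ℤ.* normZ (y -Z d) ℤ.≤ + 6 ℤ.* normZ y ℤ.+ + 3 ℤ.* normZ d
      bound y@(a , b) d@(c , e) = linℤ 6 (λ p q a b c e → let n = λ x y → x ⊗ x ⊕ p ⊗ (x ⊗ y) ⊕ q ⊗ (y ⊗ y) in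
        (# 0 ≦ n (a ⊕ a ⊕ c) (b ⊕ b ⊕ e) ∷ [] ⊢ # 2 ⊗ n (a ⊖ c) (b ⊖ e) ≦ # 6 ⊗ n a b ⊕ # 3 ⊗ n c e)) p q a b c e
        (normZ≥0 ((y +Z y) +Z d))

    -- The parallelogram law, kept as an equation because for q = w = 2 the argument consists in
    -- showing |y + d|² ≤ 0.
    exact : normZ t ℤ.* normZ x ℤ.+ normZ (y +Z d) ≡ + 2 ℤ.* normZ y ℤ.+ + 2 ℤ.* normZ d
    exact = trans (cong (ℤ._+ normZ (y +Z d)) (sym (trans (cong normZ y-d≡tx) (normZ-* t x)))) (parallelogram y d)

  divide : ∀ y → ¬ τZ ∣Z y → Division y
  divide y τ∤y with d , x , d∈ , y-d≡tx ← digit-exists y = record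
    { d = d ; x = x ; d∈ = d∈ ; τ∤d = λ τ∣d → τ∤y (τ∣-difference d y x y-d≡tx τ∣d) ; y-d≡tx = y-d≡tx }

  InτʷṼ⇒x≡0 : ∀ {y} (D : Division y) → InτʷṼ y → Division.x D ≡ 0Z
  InτʷṼ⇒x≡0 {y} D y∈ = cancelˡ t x 0Z 1≤t (trans (sym y-d≡tx) (trans (cong (_-Z d) y≡d) (trans (x-Zx≡0 d)
      (sym (*Z-zeroʳ t)))))
    where
    open Division D
    y≡d : y ≡ d
    y≡d = digit-unique d y d∈ y∈ (x , y-d≡tx)

  -- If τʷx = 2y, then |τʷ|²|x|² = 4|y|² < |τʷ|² forces x = 0 and then y = 0; so 2y/τʷ is not a
  -- lattice point.
  small⇒InτʷṼ : ∀ y → ¬ y ≡ 0Z → + 4 ℤ.* normZ y ℤ.< normZ t → InτʷṼ y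
  small⇒InτʷṼ y y≢0 4y<t = interior⇒InτʷṼ y (ℤₚ.<⇒≤ 4y<t) λ x tx≡2y → y≢0 (normZ≡0⇒≡0 y
    (linℤ 3 (λ t x y → (t ⊗ x ≐ # 4 ⊗ y ∷ # 4 ⊗ y ⋖ t ∷ x ≦ # 0 ∷ # 0 ≦ t ⊗ (# 0 ⊖ x) ∷ [] ⊢ y ≦ # 0)) (normZ t)
        (normZ x) (normZ y)
      (product x tx≡2y) 4y<t (x≤0 x tx≡2y) (*-nonNegℤ (normZ≥0 t) (ℤₚ.i≤j⇒0≤j-i (x≤0 x tx≡2y)))))
    where
    product : ∀ x → t *Z x ≡ y +Z y → normZ t ℤ.* normZ x ≡ + 4 ℤ.* normZ y
    product x eq = trans (sym (normZ-* t x)) (trans (cong normZ eq) (normZ-double y))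
    x≤0 : ∀ x → t *Z x ≡ y +Z y → normZ x ℤ.≤ + 0
    x≤0 x eq = ℤₚ.≮⇒≥ λ 0<x → linℤ 3 (λ t x y → (t ⊗ x ≐ # 4 ⊗ y ∷ # 4 ⊗ y ⋖ t ∷ # 0 ≦ t ⊗ (x ⊖ # 1) ∷ [] ⊢ ff))
        (normZ t) (normZ x) (normZ y)
      (product x eq) 4y<t (*-nonNegℤ (normZ≥0 t) (ℤₚ.i≤j⇒0≤j-i (ℤₚ.i<j⇒suc[i]≤j 0<x)))

-- Identities special to q = 2

module Exceptional (p q : ℤ) (σ : Sign) where
  open Setup p q σ hiding (fromℤ)
  open QuadraticRing p q σ

  -- For q = 2 and p = 2ε one has τ² = 2η.
  η : ℤ → ZT
  η ε = (-[1+ 0 ] , ε)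

  τ²≡2η : ∀ ε → q ≡ + 2 → p ≡ ε ℤ.+ ε → ∀ x → τZ *Z (τZ *Z x) ≡ (η ε *Z x) +Z (η ε *Z x)
  τ²≡2η ε refl refl (a , b) = cong₂ _,_
    (linℤ 3 (λ ε a b → let u = # 0 ⊗ a ⊖ # 2 ⊗ (# 1 ⊗ b) ; v = # 0 ⊗ b ⊕ # 1 ⊗ a ⊕ (ε ⊕ ε) ⊗ (# 1 ⊗ b)
                           m = ⊝ # 1 ⊗ a ⊖ # 2 ⊗ (ε ⊗ b) in
      ([] ⊢ # 0 ⊗ u ⊖ # 2 ⊗ (# 1 ⊗ v) ≐ m ⊕ m)) ε a b)
    (linℤ 3 (λ ε a b → let u = # 0 ⊗ a ⊖ # 2 ⊗ (# 1 ⊗ b) ; v = # 0 ⊗ b ⊕ # 1 ⊗ a ⊕ (ε ⊕ ε) ⊗ (# 1 ⊗ b)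
                           m = ⊝ # 1 ⊗ b ⊕ ε ⊗ a ⊕ (ε ⊕ ε) ⊗ (ε ⊗ b) in
      ([] ⊢ # 0 ⊗ v ⊕ # 1 ⊗ u ⊕ (ε ⊕ ε) ⊗ (# 1 ⊗ v) ≐ m ⊕ m)) ε a b)

  -- |y - 2m|² = |y|² - 2(2⟨y,m⟩) + 4|m|², and 2⟨y,m⟩ is even because p and q are.
  norm-mod-4 : ∀ ε → q ≡ + 2 → p ≡ ε ℤ.+ ε → ∀ y d m → y -Z d ≡ m +Z m → Σ ℤ λ z → normZ d ≡ normZ y ℤ.+ + 4 ℤ.* z
  norm-mod-4 ε refl refl y@(a , b) d@(c , e) (m , n) eq =
    m ℤ.* m ℤ.- a ℤ.* m ℤ.+ ε ℤ.* (+ 2 ℤ.* (m ℤ.* n) ℤ.- a ℤ.* n ℤ.- m ℤ.* b) ℤ.+ + 2 ℤ.* (n ℤ.* n ℤ.- b ℤ.* n) ,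
    trans (cong normZ {d} {(a ℤ.- (m ℤ.+ m) , b ℤ.- (n ℤ.+ n))} (cong₂ _,_ (solve a c m (cong proj₁ eq)) (solve b e n
        (cong proj₂ eq))))
      (linℤ 5 (λ ε a b m n → let N = λ x y → x ⊗ x ⊕ (ε ⊕ ε) ⊗ (x ⊗ y) ⊕ # 2 ⊗ (y ⊗ y) in ([] ⊢
        N (a ⊖ (m ⊕ m)) (b ⊖ (n ⊕ n)) ≐ N a b ⊕ # 4 ⊗ (m ⊗ m ⊖ a ⊗ m ⊕ ε ⊗ (# 2 ⊗ (m ⊗ n) ⊖ a ⊗ n ⊖ m ⊗ b) ⊕ # 2 ⊗
            (n ⊗ n ⊖ b ⊗ n)))) ε a b m n)
    where
    solve : ∀ a c m → a ℤ.- c ≡ m ℤ.+ m → c ≡ a ℤ.- (m ℤ.+ m)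
    solve = linℤ 3 (λ a c m → (a ⊖ c ≐ m ⊕ m ∷ [] ⊢ c ≐ a ⊖ (m ⊕ m)))

  -- For p = 2 the roots are 1 ± i, for p = -2 they are -1 ± i, and η is i or -i.
  η²≡-1 : ∀ ε → q ≡ + 2 → p ≡ ε ℤ.+ ε → ε ≡ + 1 ⊎ ε ≡ -[1+ 0 ] → ∀ x → η ε *Z (η ε *Z x) ≡ 0Z -Z x
  η²≡-1 _ refl refl (inj₁ refl) (a , b) = cong₂ _,_
    (linℤ 2 (λ a b → let u = ⊝ # 1 ⊗ a ⊖ # 2 ⊗ (# 1 ⊗ b) ; v = ⊝ # 1 ⊗ b ⊕ # 1 ⊗ a ⊕ # 2 ⊗ (# 1 ⊗ b) in
      ([] ⊢ ⊝ # 1 ⊗ u ⊖ # 2 ⊗ (# 1 ⊗ v) ≐ # 0 ⊖ a)) a b)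
    (linℤ 2 (λ a b → let u = ⊝ # 1 ⊗ a ⊖ # 2 ⊗ (# 1 ⊗ b) ; v = ⊝ # 1 ⊗ b ⊕ # 1 ⊗ a ⊕ # 2 ⊗ (# 1 ⊗ b) in
      ([] ⊢ ⊝ # 1 ⊗ v ⊕ # 1 ⊗ u ⊕ # 2 ⊗ (# 1 ⊗ v) ≐ # 0 ⊖ b)) a b)
  η²≡-1 _ refl refl (inj₂ refl) (a , b) = cong₂ _,_
    (linℤ 2 (λ a b → let u = ⊝ # 1 ⊗ a ⊖ # 2 ⊗ (⊝ # 1 ⊗ b) ; v = ⊝ # 1 ⊗ b ⊕ ⊝ # 1 ⊗ a ⊕ ⊝ # 2 ⊗ (⊝ # 1 ⊗ b) in
      ([] ⊢ ⊝ # 1 ⊗ u ⊖ # 2 ⊗ (⊝ # 1 ⊗ v) ≐ # 0 ⊖ a)) a b)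
    (linℤ 2 (λ a b → let u = ⊝ # 1 ⊗ a ⊖ # 2 ⊗ (⊝ # 1 ⊗ b) ; v = ⊝ # 1 ⊗ b ⊕ ⊝ # 1 ⊗ a ⊕ ⊝ # 2 ⊗ (⊝ # 1 ⊗ b) in
      ([] ⊢ ⊝ # 1 ⊗ v ⊕ ⊝ # 1 ⊗ u ⊕ ⊝ # 2 ⊗ (⊝ # 1 ⊗ v) ≐ # 0 ⊖ b)) a b)

  η≡-1 : ∀ x → η (+ 0) *Z x ≡ 0Z -Z x
  η≡-1 (a , b) = cong₂ _,_
    (linℤ 3 (λ q a b → ([] ⊢ ⊝ # 1 ⊗ a ⊖ q ⊗ (# 0 ⊗ b) ≐ # 0 ⊖ a)) q a b)
    (linℤ 3 (λ p a b → ([] ⊢ ⊝ # 1 ⊗ b ⊕ # 0 ⊗ a ⊕ p ⊗ (# 0 ⊗ b) ≐ # 0 ⊖ b)) p a b)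

  -- 2 = τ(p - τ), so τ²x = 2y cancels to τx = (p - τ)y, that is py = τ(x + y), where p = ±1.
  odd⇒τ∣y : q ≡ + 2 → p ≡ + 1 ⊎ p ≡ -[1+ 0 ] → ∀ x y → τZ *Z (τZ *Z x) ≡ y +Z y → τZ ∣Z y
  odd⇒τ∣y refl (inj₁ refl) (c , e) (a , b) eq = (c ℤ.+ a , e ℤ.+ b) , cong₂ _,_
    (linℤ 4 (λ a b c e → let u = # 0 ⊗ c ⊖ # 2 ⊗ (# 1 ⊗ e) ; v = # 0 ⊗ e ⊕ # 1 ⊗ c ⊕ # 1 ⊗ (# 1 ⊗ e) in
      (# 0 ⊗ u ⊖ # 2 ⊗ (# 1 ⊗ v) ≐ a ⊕ a ∷ # 0 ⊗ v ⊕ # 1 ⊗ u ⊕ # 1 ⊗ (# 1 ⊗ v) ≐ b ⊕ b ∷ [] ⊢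
       a ≐ # 0 ⊗ (c ⊕ a) ⊖ # 2 ⊗ (# 1 ⊗ (e ⊕ b)))) a b c e (cong proj₁ eq) (cong proj₂ eq))
    (linℤ 4 (λ a b c e → let u = # 0 ⊗ c ⊖ # 2 ⊗ (# 1 ⊗ e) ; v = # 0 ⊗ e ⊕ # 1 ⊗ c ⊕ # 1 ⊗ (# 1 ⊗ e) in
      (# 0 ⊗ u ⊖ # 2 ⊗ (# 1 ⊗ v) ≐ a ⊕ a ∷ # 0 ⊗ v ⊕ # 1 ⊗ u ⊕ # 1 ⊗ (# 1 ⊗ v) ≐ b ⊕ b ∷ [] ⊢
       b ≐ # 0 ⊗ (e ⊕ b) ⊕ # 1 ⊗ (c ⊕ a) ⊕ # 1 ⊗ (# 1 ⊗ (e ⊕ b)))) a b c e (cong proj₁ eq) (cong proj₂ eq))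
  odd⇒τ∣y refl (inj₂ refl) (c , e) (a , b) eq = (ℤ.- (c ℤ.+ a) , ℤ.- (e ℤ.+ b)) , cong₂ _,_
    (linℤ 4 (λ a b c e → let u = # 0 ⊗ c ⊖ # 2 ⊗ (# 1 ⊗ e) ; v = # 0 ⊗ e ⊕ # 1 ⊗ c ⊕ ⊝ # 1 ⊗ (# 1 ⊗ e) in
      (# 0 ⊗ u ⊖ # 2 ⊗ (# 1 ⊗ v) ≐ a ⊕ a ∷ # 0 ⊗ v ⊕ # 1 ⊗ u ⊕ ⊝ # 1 ⊗ (# 1 ⊗ v) ≐ b ⊕ b ∷ [] ⊢
       a ≐ # 0 ⊗ ⊝ (c ⊕ a) ⊖ # 2 ⊗ (# 1 ⊗ ⊝ (e ⊕ b)))) a b c e (cong proj₁ eq) (cong proj₂ eq))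
    (linℤ 4 (λ a b c e → let u = # 0 ⊗ c ⊖ # 2 ⊗ (# 1 ⊗ e) ; v = # 0 ⊗ e ⊕ # 1 ⊗ c ⊕ ⊝ # 1 ⊗ (# 1 ⊗ e) in
      (# 0 ⊗ u ⊖ # 2 ⊗ (# 1 ⊗ v) ≐ a ⊕ a ∷ # 0 ⊗ v ⊕ # 1 ⊗ u ⊕ ⊝ # 1 ⊗ (# 1 ⊗ v) ≐ b ⊕ b ∷ [] ⊢
       b ≐ # 0 ⊗ ⊝ (e ⊕ b) ⊕ # 1 ⊗ ⊝ (c ⊕ a) ⊕ ⊝ # 1 ⊗ (# 1 ⊗ ⊝ (e ⊕ b)))) a b c e (cong proj₁ eq) (cong proj₂ eq))

  halve : ∀ x y → x +Z x ≡ y +Z y → x ≡ y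
  halve (a , b) (c , d) eq = cong₂ _,_ (half a c (cong proj₁ eq)) (half b d (cong proj₂ eq))
    where
    half : ∀ a c → a ℤ.+ a ≡ c ℤ.+ c → a ≡ c
    half = linℤ 2 (λ a c → (a ⊕ a ≐ c ⊕ c ∷ [] ⊢ a ≐ c))

  data Parameter : Set where
    even : ∀ ε → p ≡ ε ℤ.+ ε → ε ≡ + 0 ⊎ (ε ≡ + 1 ⊎ ε ≡ -[1+ 0 ]) → Parameter
    odd  : p ≡ + 1 ⊎ p ≡ -[1+ 0 ] → Parameter

  parameter : q ≡ + 2 → + 0 ℤ.< + 4 ℤ.* q ℤ.- p ℤ.* p → Parameter
  parameter refl 0<8-p² = go p refl (ℤₚ.≰⇒> upper) (ℤₚ.≰⇒> lower)
    where
    upper : ¬ + 3 ℤ.≤ p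
    upper 3≤p = linℤ 1 (λ p → (# 3 ≦ p ∷ # 0 ⋖ # 4 ⊗ # 2 ⊖ p ⊗ p ∷ # 0 ≦ (p ⊖ # 3) ⊗ (p ⊖ # 3) ∷ [] ⊢
        ff)) p 3≤p 0<8-p²
      (*-nonNegℤ (ℤₚ.i≤j⇒0≤j-i 3≤p) (ℤₚ.i≤j⇒0≤j-i 3≤p))
    lower : ¬ p ℤ.≤ -[1+ 2 ]
    lower p≤-3 = linℤ 1 (λ p → (p ≦ ⊝ # 3 ∷ # 0 ⋖ # 4 ⊗ # 2 ⊖ p ⊗ p ∷ # 0 ≦ (⊝ # 3 ⊖ p) ⊗ (⊝ # 3 ⊖ p) ∷ [] ⊢
        ff)) p p≤-3 0<8-p²
      (*-nonNegℤ (ℤₚ.i≤j⇒0≤j-i p≤-3) (ℤₚ.i≤j⇒0≤j-i p≤-3))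
    go : ∀ r → p ≡ r → r ℤ.< + 3 → -[1+ 2 ] ℤ.< r → Parameter
    go (+ 0) p≡ _ _ = even (+ 0) p≡ (inj₁ refl)
    go (+ 1) p≡ _ _ = odd (inj₁ p≡)
    go (+ 2) p≡ _ _ = even (+ 1) p≡ (inj₂ (inj₁ refl))
    go (+ suc (suc (suc _))) _ (ℤ.+<+ (ℕ.s≤s (ℕ.s≤s (ℕ.s≤s ())))) _
    go -[1+ 0 ] p≡ _ _ = odd (inj₂ p≡)
    go -[1+ 1 ] p≡ _ _ = even -[1+ 0 ] p≡ (inj₂ (inj₂ refl))
    go -[1+ suc (suc _) ] _ _ (ℤ.-<- (ℕ.s≤s (ℕ.s≤s ())))

-- Termination of the algorithm

module Termination (p q : ℤ) (0<4q-p² : + 0 ℤ.< + 4 ℤ.* q ℤ.- p ℤ.* p) (σ : Sign) (1<q : + 1 ℤ.< q)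
  (L : Setup.Labelling p q σ) (T : Tiling p q σ L) (k : ℕ) where

  open Setup p q σ hiding (fromℤ)
  open QuadraticRing p q σ
  open Definite 0<4q-p²
  open Digits p q 0<4q-p² σ 1<q L T k

  private
    M : ℤ
    M = normZ t

  M≡ : M ≡ q ℤ.* (q ℤ.* normZ (τZ ^Z k))
  M≡ = trans (normZ-* τZ (τZ ^Z suc k)) (cong₂ ℤ._*_ normZ-τ (trans (normZ-* τZ (τZ ^Z k))
      (cong (ℤ._* normZ (τZ ^Z k)) normZ-τ)))

  -- |x| ≥ |y| and 4|y|² ≥ M would give 2M ≤ 3q + 9, which `large` excludes. For q = 3, w = 2 both
  -- sides are 18 and the integrality of |y|² has to decide; for q = w = 2 there is no
  -- contradiction.
  data Size : Set where
    large       : + 3 ℤ.* q ℤ.+ + 10 ℤ.≤ + 2 ℤ.* M → Size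
    nine        : q ≡ + 3 → M ≡ + 9 → Size
    exceptional : q ≡ + 2 → k ≡ 0 → Size

  size : Size
  size with q ℤ.≟ + 2 | q ℤ.≟ + 3
  ... | yes q≡2 | _ = two k refl
    where
    two : ∀ n → k ≡ n → Size
    two zero    k≡0 = exceptional q≡2 k≡0
    two (suc n) k≡ = large (linℤ 3 (λ q m P → (q ≐ # 2 ∷ m ≐ # 2 ⊗ (# 2 ⊗ (# 2 ⊗ P)) ∷ # 1 ≦ P ∷ [] ⊢ # 3 ⊗ q ⊕
        # 10 ≦ # 2 ⊗ m)) q M (normZ (τZ ^Z n)) q≡2
      (trans M≡ (trans (cong (λ k → q ℤ.* (q ℤ.* normZ (τZ ^Z k))) k≡) (trans (cong (λ x → q ℤ.* (q ℤ.* x))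
          (trans (normZ-* τZ (τZ ^Z n)) (cong (ℤ._* normZ (τZ ^Z n)) normZ-τ)))
        (cong (λ x → x ℤ.* (x ℤ.* (x ℤ.* normZ (τZ ^Z n)))) q≡2)))) (1≤norm-τ^ n))
  ... | no _ | yes q≡3 = three k refl
    where
    three : ∀ n → k ≡ n → Size
    three zero k≡0 = nine q≡3 (trans M≡ (trans (cong (λ k → q ℤ.* (q ℤ.* normZ (τZ ^Z k))) k≡0)
      (trans (cong (λ x → q ℤ.* (q ℤ.* x)) normZ-1) (cong (λ x → x ℤ.* (x ℤ.* + 1)) q≡3))))
    three (suc n) k≡ = large (linℤ 3 (λ q m P → (q ≐ # 3 ∷ m ≐ # 3 ⊗ (# 3 ⊗ (# 3 ⊗ P)) ∷ # 1 ≦ P ∷ [] ⊢ # 3 ⊗ q ⊕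
        # 10 ≦ # 2 ⊗ m)) q M (normZ (τZ ^Z n)) q≡3
      (trans M≡ (trans (cong (λ k → q ℤ.* (q ℤ.* normZ (τZ ^Z k))) k≡) (trans (cong (λ x → q ℤ.* (q ℤ.* x))
          (trans (normZ-* τZ (τZ ^Z n)) (cong (ℤ._* normZ (τZ ^Z n)) normZ-τ)))
        (cong (λ x → x ℤ.* (x ℤ.* (x ℤ.* normZ (τZ ^Z n)))) q≡3)))) (1≤norm-τ^ n))
  -- M ≥ q² and q ≥ 4 give 2M ≥ 8q ≥ 3q + 20.
  ... | no q≢2 | no q≢3 = large (linℤ 3 (λ q m P → (# 4 ≦ q ∷ m ≐ q ⊗ (q ⊗ P) ∷ # 0 ≦ q ⊗ q ⊗ (P ⊖ # 1) ∷ # 0 ≦ q ⊗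
      (q ⊖ # 4) ∷ [] ⊢
      # 3 ⊗ q ⊕ # 10 ≦ # 2 ⊗ m)) q M (normZ (τZ ^Z k)) 4≤q M≡
      (*-nonNegℤ (*-nonNegℤ 0≤q 0≤q) (ℤₚ.i≤j⇒0≤j-i (1≤norm-τ^ k))) (*-nonNegℤ 0≤q (ℤₚ.i≤j⇒0≤j-i 4≤q)))
    where
    next : ∀ {n} → + n ℤ.≤ q → ¬ q ≡ + n → + suc n ℤ.≤ q
    next n≤q q≢n = ℤₚ.i<j⇒suc[i]≤j (ℤₚ.≤∧≢⇒< n≤q λ n≡q → q≢n (sym n≡q))
    4≤q : + 4 ℤ.≤ q
    4≤q = next (next 2≤q q≢2) q≢3
    0≤q : + 0 ℤ.≤ q
    0≤q = ℤₚ.≤-trans (ℤ.+≤+ ℕ.z≤n) 4≤q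

  p²≥0 : + 0 ℤ.≤ p ℤ.* p
  p²≥0 = square≥0ℤ p

  module Step {y : ZT} (y≢0 : ¬ y ≡ 0Z) (D : Division y) where
    open Division D

    private
      Y X N : ℤ
      Y = normZ y
      X = normZ x
      N = normZ d

    1≤Y : + 1 ℤ.≤ Y
    1≤Y = normZ>0 y≢0

    InτʷṼ⇒X<Y : InτʷṼ y → X ℤ.< Y
    InτʷṼ⇒X<Y y∈ = ℤₚ.<-≤-trans (subst (ℤ._< + 1) (sym (trans (cong normZ (InτʷṼ⇒x≡0 D y∈)) normZ-0))
        (ℤ.+<+ ℕ.z<s)) 1≤Y

    N-bound : + 4 ℤ.* N ℤ.≤ (q ℤ.+ + 1) ℤ.* M
    N-bound = linℤ 4 (λ p q m n → (# 16 ⊗ n ≦ (# 4 ⊗ q ⊖ p ⊗ p ⊕ # 4) ⊗ m ∷ # 0 ≦ p ⊗ p ⊗ m ∷ [] ⊢ # 4 ⊗ n ≦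
        (q ⊕ # 1) ⊗ m)) p q M N
      (digit-bound d d∈) (*-nonNegℤ p²≥0 (normZ≥0 t))

    private
      0≤M : + 0 ℤ.≤ M
      0≤M = normZ≥0 t

    4≤M : + 4 ℤ.≤ M
    4≤M = linℤ 3 (λ q m P → (# 2 ≦ q ∷ m ≐ q ⊗ (q ⊗ P) ∷ # 0 ≦ q ⊗ q ⊗ (P ⊖ # 1) ∷ # 0 ≦ (q ⊖ # 2) ⊗ (q ⊖ # 2) ∷ [] ⊢
        # 4 ≦ m)) q M (normZ (τZ ^Z k)) 2≤q M≡
      (*-nonNegℤ (*-nonNegℤ 0≤q 0≤q) (ℤₚ.i≤j⇒0≤j-i (1≤norm-τ^ k))) (*-nonNegℤ (ℤₚ.i≤j⇒0≤j-i 2≤q) (ℤₚ.i≤j⇒0≤j-i 2≤q))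
      where
      0≤q : + 0 ℤ.≤ q
      0≤q = ℤₚ.≤-trans (ℤ.+≤+ ℕ.z≤n) 2≤q

    private
      3≤M : + 3 ℤ.≤ M
      3≤M = ℤₚ.≤-trans (ℤ.+≤+ (ℕ.s≤s (ℕ.s≤s (ℕ.s≤s ℕ.z≤n)))) 4≤M

    large⇒X<Y : + 3 ℤ.* q ℤ.+ + 10 ℤ.≤ + 2 ℤ.* M → X ℤ.< Y
    large⇒X<Y lrg = ℤₚ.≰⇒> λ Y≤X → ℤₚ.<-irrefl refl (ℤₚ.<-≤-trans (InτʷṼ⇒X<Y (small⇒InτʷṼ y y≢0 (ℤₚ.≰⇒> λ M≤4Y →
      -- The bounds combine to 8(M - 3)Y ≤ 3(q + 1)M, and (4Y - M)(M - 3) ≥ 0 allows Y to be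
      -- replaced by M/4.
      linℤ 5 (λ q m Y X N → (# 4 ≦ m ∷ # 0 ≦ m ⊗ (X ⊖ Y) ∷ # 2 ⊗ (m ⊗ X) ≦ # 6 ⊗ Y ⊕ # 3 ⊗ N ∷ # 4 ⊗ N ≦
          (q ⊕ # 1) ⊗ m ∷
        # 0 ≦ (# 4 ⊗ Y ⊖ m) ⊗ (m ⊖ # 3) ∷ # 0 ≦ m ⊗ (# 2 ⊗ m ⊖ (# 3 ⊗ q ⊕ # 10)) ∷ [] ⊢ ff)) q M Y X N
        4≤M (*-nonNegℤ 0≤M (ℤₚ.i≤j⇒0≤j-i Y≤X)) weighted N-bound (*-nonNegℤ (ℤₚ.i≤j⇒0≤j-i M≤4Y) (ℤₚ.i≤j⇒0≤j-i 3≤M))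
        (*-nonNegℤ 0≤M (ℤₚ.i≤j⇒0≤j-i lrg))))) Y≤X)

    nine⇒X<Y : q ≡ + 3 → M ≡ + 9 → X ℤ.< Y
    nine⇒X<Y q≡3 M≡9 = ℤₚ.≰⇒> λ Y≤X → ℤₚ.<-irrefl refl (ℤₚ.<-≤-trans (InτʷṼ⇒X<Y (small⇒InτʷṼ y y≢0
        (subst (+ 4 ℤ.* Y ℤ.<_) (sym M≡9) (ℤₚ.≰⇒> λ 9≤4Y →
      -- 9 ≤ 4Y means Y ≥ 3 for an integer Y, whereas the bounds give 12Y ≤ 27.
      linℤ 3 (λ Y X N → (# 2 ⊗ (# 9 ⊗ X) ≦ # 6 ⊗ Y ⊕ # 3 ⊗ N ∷ # 4 ⊗ N ≦ (# 3 ⊕ # 1) ⊗ # 9 ∷ Y ≦ X ∷ # 3 ≦ Y ∷ [] ⊢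
          ff)) Y X N
        (subst (λ m → + 2 ℤ.* (m ℤ.* X) ℤ.≤ + 6 ℤ.* Y ℤ.+ + 3 ℤ.* N) M≡9 weighted)
        (subst₂ (λ q m → + 4 ℤ.* N ℤ.≤ (q ℤ.+ + 1) ℤ.* m) q≡3 M≡9 N-bound) Y≤X
        (ℤₚ.i<j⇒suc[i]≤j (linℤ 1 (λ Y → (# 9 ≦ # 4 ⊗ Y ∷ [] ⊢ # 2 ⋖ Y)) Y 9≤4Y)))))) Y≤X)

    module Two (q≡2 : q ≡ + 2) (k≡0 : k ≡ 0) where

      open Exceptional p q σ

      M≡4 : M ≡ + 4
      M≡4 = trans M≡ (trans (cong (λ k → q ℤ.* (q ℤ.* normZ (τZ ^Z k))) k≡0)
        (trans (cong (λ n → q ℤ.* (q ℤ.* n)) normZ-1) (cong (λ q → q ℤ.* (q ℤ.* + 1)) q≡2)))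

      t* : ∀ x → t *Z x ≡ τZ *Z (τZ *Z x)
      t* x = trans (*Z-assoc τZ (τZ ^Z suc k) x) (cong (τZ *Z_) (trans (*Z-assoc τZ (τZ ^Z k) x)
        (cong (τZ *Z_) (trans (cong (λ k → (τZ ^Z k) *Z x) k≡0) (trans (*Z-comm 1Z x) (*Z-identityʳ x))))))

      N≤ : + 4 ℤ.* N ℤ.≤ + 12 ℤ.- p ℤ.* p
      N≤ = linℤ 2 (λ p n → (# 16 ⊗ n ≦ (# 4 ⊗ # 2 ⊖ p ⊗ p ⊕ # 4) ⊗ # 4 ∷ [] ⊢ # 4 ⊗ n ≦ # 12 ⊖ p ⊗ p)) p N
        (subst₂ (λ q m → + 16 ℤ.* N ℤ.≤ (+ 4 ℤ.* q ℤ.- p ℤ.* p ℤ.+ + 4) ℤ.* m) q≡2 M≡4 (digit-bound d d∈))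

      exact₄ : + 4 ℤ.* X ℤ.+ normZ (y +Z d) ≡ + 2 ℤ.* Y ℤ.+ + 2 ℤ.* N
      exact₄ = subst (λ m → m ℤ.* X ℤ.+ normZ (y +Z d) ≡ + 2 ℤ.* Y ℤ.+ + 2 ℤ.* N) M≡4 exact

      opposite⇒tx≡2y : y +Z d ≡ 0Z → t *Z x ≡ y +Z y
      opposite⇒tx≡2y y+d≡0 = trans (sym y-d≡tx) (reflect y d y+d≡0)
        where
        reflect : ∀ y d → y +Z d ≡ 0Z → y -Z d ≡ y +Z y
        reflect (a , b) (c , e) eq = cong₂ _,_ (sub a c (cong proj₁ eq)) (sub b e (cong proj₂ eq))
          where
          sub : ∀ a c → a ℤ.+ c ≡ + 0 → a ℤ.- c ≡ a ℤ.+ a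
          sub = linℤ 2 (λ a c → (a ⊕ c ≐ # 0 ∷ [] ⊢ a ⊖ c ≐ a ⊕ a))

      -- Here N ≤ 2, so by `exact₄` a failure leaves Y ≤ 1 or y = -d. The latter gives τ²x = 2y,
      -- which makes τ divide y. In the former 4Y ≤ M, and since the same divisibility excludes the
      -- boundary case of `interior`, y is its own digit and x = 0.
      odd⇒X<Y : ¬ τZ ∣Z y → p ≡ + 1 ⊎ p ≡ -[1+ 0 ] → X ℤ.< Y
      odd⇒X<Y τ∤y p≡±1 = ℤₚ.≰⇒> λ Y≤X → ℤₚ.<-irrefl refl (ℤₚ.<-≤-trans (InτʷṼ⇒X<Y (interior⇒InτʷṼ y
          (subst (+ 4 ℤ.* Y ℤ.≤_) (sym M≡4) (4Y≤4 Y≤X)) 2y∉)) Y≤X)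
        where
        2y∉ : ∀ x → ¬ t *Z x ≡ y +Z y
        2y∉ x tx≡2y = τ∤y (odd⇒τ∣y q≡2 p≡±1 x y (trans (sym (t* x)) tx≡2y))
        p²≡1 : p ℤ.* p ≡ + 1
        p²≡1 = [ cong (λ p → p ℤ.* p) , cong (λ p → p ℤ.* p) ]′ p≡±1
        N≤2 : N ℤ.≤ + 2
        N≤2 = ℤₚ.≮⇒≥ λ 2<N → linℤ 2 (λ p n → (# 4 ⊗ n ≦ # 12 ⊖ p ⊗ p ∷ p ⊗ p ≐ # 1 ∷ # 3 ≦ n ∷ [] ⊢ ff)) p N N≤ p²≡1
            (ℤₚ.i<j⇒suc[i]≤j 2<N)
        4Y≤4 : Y ℤ.≤ X → + 4 ℤ.* Y ℤ.≤ + 4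
        4Y≤4 Y≤X = ℤₚ.≮⇒≥ λ 4<4Y → 2y∉ x (opposite⇒tx≡2y (normZ≡0⇒≡0 (y +Z d)
          (linℤ 4 (λ X Y N S → (# 4 ⊗ X ⊕ S ≐ # 2 ⊗ Y ⊕ # 2 ⊗ N ∷ N ≦ # 2 ∷ Y ≦ X ∷ # 2 ≦ Y ∷ [] ⊢ S ≦ # 0)) X Y N
              (normZ (y +Z d)) exact₄ N≤2 Y≤X
            (ℤₚ.i<j⇒suc[i]≤j (linℤ 1 (λ Y → (# 4 ⋖ # 4 ⊗ Y ∷ [] ⊢ # 1 ⋖ Y)) Y 4<4Y)))))

      -- N ≤ 3, Y ≥ 1 and N ≡ Y modulo 4 give N ≤ Y; then 4X + |y + d|² = 2Y + 2N ≤ 4Y ≤ 4X.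
      even⇒opposite : ∀ ε → p ≡ ε ℤ.+ ε → Y ℤ.≤ X → y +Z d ≡ 0Z
      even⇒opposite ε p≡2ε Y≤X = normZ≡0⇒≡0 (y +Z d) (bound (norm-mod-4 ε q≡2 p≡2ε y d (η ε *Z x)
          (trans y-d≡tx (trans (t* x) (τ²≡2η ε q≡2 p≡2ε x)))))
        where
        bound : (Σ ℤ λ z → N ≡ Y ℤ.+ + 4 ℤ.* z) → normZ (y +Z d) ℤ.≤ + 0
        bound (z , N≡) = linℤ 5 (λ X Y N S z → (# 4 ⊗ X ⊕ S ≐ # 2 ⊗ Y ⊕ # 2 ⊗ N ∷ N ≐ Y ⊕ # 4 ⊗ z ∷ z ≦ # 0 ∷ Y ≦ X ∷
            [] ⊢ S ≦ # 0)) X Y N (normZ (y +Z d)) z exact₄ N≡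
          (ℤₚ.≮⇒≥ λ 0<z → linℤ 4 (λ p Y N z → (# 4 ⊗ N ≦ # 12 ⊖ p ⊗ p ∷ # 0 ≦ p ⊗ p ∷ N ≐ Y ⊕ # 4 ⊗ z ∷ # 1 ≦ Y ∷
              # 1 ≦ z ∷ [] ⊢ ff)) p Y N z
            N≤ p²≥0 N≡ 1≤Y (ℤₚ.i<j⇒suc[i]≤j 0<z))
          Y≤X

      opposite⇒ηx≡y : ∀ ε → p ≡ ε ℤ.+ ε → y +Z d ≡ 0Z → η ε *Z x ≡ y
      opposite⇒ηx≡y ε p≡2ε y+d≡0 = halve (η ε *Z x) y (trans (sym (τ²≡2η ε q≡2 p≡2ε x)) (trans (sym (t* x))
          (opposite⇒tx≡2y y+d≡0)))

  private
    negated : ∀ x y d → y ≡ 0Z -Z x → y +Z d ≡ 0Z → x ≡ d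
    negated (a , b) (c , e) (f , g) y≡-x y+d≡0 =
      cong₂ _,_ (sub a c f (cong proj₁ y≡-x) (cong proj₁ y+d≡0)) (sub b e g (cong proj₂ y≡-x) (cong proj₂ y+d≡0))
      where
      sub : ∀ a c f → c ≡ + 0 ℤ.- a → c ℤ.+ f ≡ + 0 → a ≡ f
      sub = linℤ 3 (λ a c f → (c ≐ # 0 ⊖ a ∷ c ⊕ f ≐ # 0 ∷ [] ⊢ a ≐ f))

  step-division : ∀ {y} → ¬ y ≡ 0Z → ¬ τZ ∣Z y → (D : Division y) → Terminates (Division.x D) → Terminates y
  step-division {y} y≢0 τ∤y D = step y d x y≢0 τ∤y (InD-intro d τ∤d d∈) y-d≡tx
    where open Division D

  digit-terminates : ∀ {y} (D : Division y) → Terminates (Division.d D)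
  digit-terminates D with Division.d D ≟Z 0Z
  ... | yes d≡0 = subst Terminates (sym d≡0) ([] , done)
  ... | no d≢0  = step d d 0Z d≢0 τ∤d (InD-intro d τ∤d d∈) (trans (x-Zx≡0 d) (sym (*Z-zeroʳ t))) ([] , done)
    where open Division D

  module _ {y : ZT} (y≢0 : ¬ y ≡ 0Z) (τ∤y : ¬ τZ ∣Z y) (smaller : ∀ z → normZ z ℤ.< normZ y → Terminates z) where

    private
      D : Division y
      D = divide y τ∤y

    open Division D
    open Step y≢0 D

    even-terminates : q ≡ + 2 → k ≡ 0 → ∀ ε → p ≡ ε ℤ.+ ε → ε ≡ + 0 ⊎ (ε ≡ + 1 ⊎ ε ≡ -[1+ 0 ]) → Terminates y
    even-terminates q≡2 k≡0 ε p≡2ε ε∈ = step-division y≢0 τ∤y D (quotient-terminates (ℤₚ.<-cmp (normZ x) (normZ y)))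
      where
      open Two q≡2 k≡0
      open Exceptional p q σ

      -- y = ηx, so x has the norm of y and is not divisible by τ either. If its quotient x₂ is not
      -- smaller, then x = ηx₂ and y = η²x₂ = -x₂, so that x₂ = -y is the digit d.
      second : y +Z d ≡ 0Z → ε ≡ + 1 ⊎ ε ≡ -[1+ 0 ] → Terminates x
      second y+d≡0 ε≡±1 = step-division x≢0 τ∤x D₂ (next (normZ (Division.x D₂) ℤ.<? normZ x))
        where
        ηx≡y : η ε *Z x ≡ y
        ηx≡y = opposite⇒ηx≡y ε p≡2ε y+d≡0
        x≢0 : ¬ x ≡ 0Z
        x≢0 x≡0 = y≢0 (trans (sym ηx≡y) (trans (cong (η ε *Z_) x≡0) (*Z-zeroʳ (η ε))))
        τ∤x : ¬ τZ ∣Z x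
        τ∤x (c , x≡τc) = τ∤y (η ε *Z c , trans (sym ηx≡y) (trans (cong (η ε *Z_) x≡τc)
          (trans (sym (*Z-assoc (η ε) τZ c)) (trans (cong (_*Z c) (*Z-comm (η ε) τZ)) (*Z-assoc τZ (η ε) c)))))
        D₂ : Division x
        D₂ = divide x τ∤x
        X≡Y : normZ x ≡ normZ y
        X≡Y = linℤ 2 (λ x y → (# 4 ⊗ x ≐ # 4 ⊗ y ∷ [] ⊢ x ≐ y)) (normZ x) (normZ y)
          (trans (cong (ℤ._* normZ x) (sym M≡4)) (trans (sym (normZ-* t x))
              (trans (cong normZ (opposite⇒tx≡2y y+d≡0)) (normZ-double y))))
        next : Dec (normZ (Division.x D₂) ℤ.< normZ x) → Terminates (Division.x D₂)
        next (yes X₂<X) = smaller (Division.x D₂) (subst (normZ (Division.x D₂) ℤ.<_) X≡Y X₂<X)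
        next (no X₂≮X) = subst Terminates (sym (negated (Division.x D₂) y d
            (trans (sym ηx≡y) (trans (cong (η ε *Z_) (sym ηx₂≡x)) (η²≡-1 ε q≡2 p≡2ε ε≡±1 (Division.x D₂)))) y+d≡0))
                (digit-terminates D)
          where
          module S₂ = Step.Two x≢0 D₂ q≡2 k≡0
          ηx₂≡x : η ε *Z Division.x D₂ ≡ x
          ηx₂≡x = S₂.opposite⇒ηx≡y ε p≡2ε (S₂.even⇒opposite ε p≡2ε (ℤₚ.≮⇒≥ X₂≮X))

      -- For p = 0 one has η = -1, so already x = -y = d.
      first : y +Z d ≡ 0Z → ε ≡ + 0 ⊎ (ε ≡ + 1 ⊎ ε ≡ -[1+ 0 ]) → Terminates x
      first y+d≡0 (inj₁ ε≡0) = subst Terminates (sym (negated x y d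
        (trans (sym (opposite⇒ηx≡y ε p≡2ε y+d≡0)) (trans (cong (λ ε → η ε *Z x) ε≡0) (η≡-1 x))) y+d≡0))
            (digit-terminates D)
      first y+d≡0 (inj₂ ε≡±1) = second y+d≡0 ε≡±1

      quotient-terminates : _ → Terminates x
      quotient-terminates (tri< X<Y _ _) = smaller x X<Y
      quotient-terminates (tri≈ _ X≡Y _) = first (even⇒opposite ε p≡2ε (ℤₚ.≤-reflexive (sym X≡Y))) ε∈
      quotient-terminates (tri> _ _ Y<X) = first (even⇒opposite ε p≡2ε (ℤₚ.<⇒≤ Y<X)) ε∈

    nondivisible-terminates : Terminates y
    nondivisible-terminates with size
    ... | large big = step-division y≢0 τ∤y D (smaller x (large⇒X<Y big))
    ... | nine q≡3 M≡9 = step-division y≢0 τ∤y D (smaller x (nine⇒X<Y q≡3 M≡9))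
    ... | exceptional q≡2 k≡0 with Exceptional.parameter p q σ q≡2 0<4q-p²
    ...   | Exceptional.even ε p≡2ε ε∈ = even-terminates q≡2 k≡0 ε p≡2ε ε∈
    ...   | Exceptional.odd p≡±1 = step-division y≢0 τ∤y D (smaller x (Two.odd⇒X<Y q≡2 k≡0 τ∤y p≡±1))

  terminates : ∀ y → Terminates y
  terminates y = go y (<-wellFounded _)
    where
    ∣norm∣-mono : ∀ z y → normZ z ℤ.< normZ y → ℤ.∣ normZ z ∣ ℕ.< ℤ.∣ normZ y ∣
    ∣norm∣-mono z y lt = mono (normZ≥0 z) lt
      where
      mono : ∀ {a b} → + 0 ℤ.≤ a → a ℤ.< b → ℤ.∣ a ∣ ℕ.< ℤ.∣ b ∣
      mono (ℤ.+≤+ _) (ℤ.+<+ a<b) = a<b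
    go : ∀ y → Acc ℕ._<_ ℤ.∣ normZ y ∣ → Terminates y
    go y (acc rs) with y ≟Z 0Z | divisible? y 1<q
    ... | yes refl | _ = [] , done
    ... | no y≢0 | yes τ∣y@(c , y≡τc) = let ds , alg = go c (rs (∣norm∣-mono c y c<y)) in 0Z ∷ ds , step0 y≢0 τ∣y y≡τc alg
      where
      c<y : normZ c ℤ.< normZ y
      c<y = linℤ 3 (λ q c y → (y ≐ q ⊗ c ∷ # 1 ≦ y ∷ # 0 ≦ (q ⊖ # 2) ⊗ c ∷ # 0 ≦ c ∷ [] ⊢ c ⋖ y)) q (normZ c)
          (normZ y)
        (trans (cong normZ y≡τc) (trans (normZ-* τZ c) (cong (ℤ._* normZ c) normZ-τ))) (normZ>0 y≢0)
        (*-nonNegℤ (ℤₚ.i≤j⇒0≤j-i 2≤q) (normZ≥0 c)) (normZ≥0 c)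
    ... | no y≢0 | no τ∤y = nondivisible-terminates y≢0 τ∤y λ z z<y → go z (rs (∣norm∣-mono z y z<y))

-- The output is a w-NAF, and w-NAFs are unique

module NonAdjacentForms (p q : ℤ) (0<4q-p² : + 0 ℤ.< + 4 ℤ.* q ℤ.- p ℤ.* p) (σ : Sign) (1<q : + 1 ℤ.< q)
  (L : Setup.Labelling p q σ) (T : Tiling p q σ L) (k : ℕ) where

  open Setup p q σ hiding (fromℤ)
  open QuadraticRing p q σ
  open Definite 0<4q-p²
  open Digits p q 0<4q-p² σ 1<q L T k
  open Termination p q 0<4q-p² σ 1<q L T k using (terminates)

  τ-cancel : ∀ {x y} → τZ *Z x ≡ τZ *Z y → x ≡ y
  τ-cancel {x} {y} = cancelˡ τZ x y (subst (+ 1 ℤ.≤_) (sym normZ-τ) (ℤₚ.<⇒≤ 1<q))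

  τ∣τ^suc* : ∀ n x → τZ ∣Z ((τZ ^Z suc n) *Z x)
  τ∣τ^suc* n x = (τZ ^Z n) *Z x , *Z-assoc τZ (τZ ^Z n) x

  -- Each of the first n steps must be `step0`, as τ still divides the current value, or else the
  -- run is over and `listSeq` continues it by zeros.
  leading-zeros : ∀ {y ds} → Alg y ds → ∀ n → (τZ ^Z n) ∣Z y → ∀ j → j ℕ.< n → listSeq ds j ≡ 0Z
  leading-zeros done n _ j _ = refl
  leading-zeros (step0 _ _ _ _) (suc n) _ zero _ = refl
  leading-zeros (step0 {y} {y′} _ _ y≡τy′ alg) (suc n) (c , y≡) (suc j) (ℕ.s≤s j<n) =
    leading-zeros alg n (c , τ-cancel (trans (sym y≡τy′) (trans y≡ (*Z-assoc τZ (τZ ^Z n) c)))) j j<n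
  leading-zeros (stepD _ τ∤y _ _ _ _) (suc n) (c , y≡) j _ = ⊥-elim (τ∤y (subst (τZ ∣Z_) (sym y≡) (τ∣τ^suc* n c)))

  listSeq-digits : ∀ {y ds} → Alg y ds → ∀ j → InD (listSeq ds j)
  listSeq-digits done j = inj₁ refl
  listSeq-digits (step0 _ _ _ alg) zero = inj₁ refl
  listSeq-digits (step0 _ _ _ alg) (suc j) = listSeq-digits alg j
  listSeq-digits (stepD _ _ d∈ _ _ alg) zero = d∈
  listSeq-digits (stepD _ _ _ _ _ alg) (suc j) = listSeq-digits alg j

  listSeq-nonadj : ∀ {y ds} → Alg y ds → ∀ i j → i ℕ.< j → j ℕ.< i ℕ.+ w → listSeq ds i ≡ 0Z ⊎ listSeq ds j ≡ 0Z
  listSeq-nonadj done i j _ _ = inj₁ refl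
  listSeq-nonadj (step0 _ _ _ alg) zero j _ _ = inj₁ refl
  listSeq-nonadj (step0 _ _ _ alg) (suc i) (suc j) (ℕ.s≤s i<j) (ℕ.s≤s j<i+w) = listSeq-nonadj alg i j i<j j<i+w
  listSeq-nonadj (stepD {y} {y′} {d} _ _ _ (c , d-y≡tc) y-d≡τy′ alg) zero (suc j) _ (ℕ.s≤s j<w-1) =
    -- τy′ = y - d = τʷ(-c), so y′ is divisible by τ^(w-1) and w - 1 zeros follow the digit d.
    inj₂ (leading-zeros alg (suc k) (0Z -Z c , τ-cancel (trans (sym y-d≡τy′) (trans (sym (-Z-swap d y))
        (trans (cong (0Z -Z_) d-y≡tc)
      (trans (sym (trans (*Z-distribˡ-minus t 0Z c) (cong (_-Z (t *Z c)) (*Z-zeroʳ t)))) (*Z-assoc τZ (τZ ^Z suc k)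
          (0Z -Z c))))))) j j<w-1)
  listSeq-nonadj (stepD _ _ _ _ _ alg) (suc i) (suc j) (ℕ.s≤s i<j) (ℕ.s≤s j<i+w) = listSeq-nonadj alg i j i<j j<i+w

  listSeq-finite : ∀ ds → FinSupp (listSeq ds) (length ds)
  listSeq-finite [] j _ = refl
  listSeq-finite (d ∷ ds) (suc j) (ℕ.s≤s le) = listSeq-finite ds j le

  listSeq-NAF : ∀ {y ds} → Alg y ds → IsNAFfin0 (listSeq ds)
  listSeq-NAF {ds = ds} alg = record
    { digits = listSeq-digits alg ; nonadj = listSeq-nonadj alg ; finite = length ds , listSeq-finite ds }

  -- `partialValue` grows at the highest digit, whereas the algorithm and the uniqueness proof
  -- remove the lowest one; this Horner form connects the two.
  partialValue-suc : ∀ N ξ → partialValue (suc N) ξ ≡ ξ 0 +Z (τZ *Z partialValue N (ξ ∘ suc))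
  partialValue-suc zero ξ = trans (+Z-identityˡ (ξ 0 *Z 1Z)) (trans (*Z-identityʳ (ξ 0))
    (sym (trans (cong (ξ 0 +Z_) (*Z-zeroʳ τZ)) (+Z-identityʳ (ξ 0)))))
  partialValue-suc (suc N) ξ = begin
    partialValue (suc N) ξ +Z (ξ (suc N) *Z (τZ *Z (τZ ^Z N)))
      ≡⟨ cong₂ _+Z_ (partialValue-suc N ξ) (left-comm (ξ (suc N)) (τZ ^Z N)) ⟩
    (ξ 0 +Z (τZ *Z partialValue N (ξ ∘ suc))) +Z (τZ *Z (ξ (suc N) *Z (τZ ^Z N)))
      ≡⟨ +Z-assoc (ξ 0) (τZ *Z partialValue N (ξ ∘ suc)) (τZ *Z (ξ (suc N) *Z (τZ ^Z N))) ⟩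
    ξ 0 +Z ((τZ *Z partialValue N (ξ ∘ suc)) +Z (τZ *Z (ξ (suc N) *Z (τZ ^Z N))))
      ≡⟨ cong (ξ 0 +Z_) (*Z-distribˡ-+Z τZ (partialValue N (ξ ∘ suc)) (ξ (suc N) *Z (τZ ^Z N))) ⟨
    ξ 0 +Z (τZ *Z (partialValue N (ξ ∘ suc) +Z (ξ (suc N) *Z (τZ ^Z N)))) ∎
    where
    open ≡-Reasoning
    left-comm : ∀ x y → x *Z (τZ *Z y) ≡ τZ *Z (x *Z y)
    left-comm x y = trans (sym (*Z-assoc x τZ y)) (trans (cong (_*Z y) (*Z-comm x τZ)) (*Z-assoc τZ x y))

  listSeq-value : ∀ {y ds} → Alg y ds → partialValue (length ds) (listSeq ds) ≡ y
  listSeq-value done = refl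
  listSeq-value (step0 {y} {y′} {ds} _ _ y≡τy′ alg) = trans (partialValue-suc (length ds) (listSeq (0Z ∷ ds)))
    (trans (+Z-identityˡ (τZ *Z partialValue (length ds) (listSeq ds))) (trans (cong (τZ *Z_) (listSeq-value alg))
        (sym y≡τy′)))
  listSeq-value (stepD {y} {y′} {d} {ds} _ _ _ _ y-d≡τy′ alg) = trans (partialValue-suc (length ds)
      (listSeq (d ∷ ds)))
    (trans (cong (λ v → d +Z (τZ *Z v)) (listSeq-value alg)) (trans (cong (d +Z_) (sym y-d≡τy′)) (restore d y)))
    where
    restore : ∀ d y → d +Z (y -Z d) ≡ y
    restore (a , b) (c , e) = cong₂ _,_ (sub a c) (sub b e)
      where
      sub : ∀ a c → a ℤ.+ (c ℤ.- a) ≡ c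
      sub = linℤ 2 (λ a c → ([] ⊢ a ⊕ (c ⊖ a) ≐ c))

  Spaced : Seq → Set
  Spaced ξ = ∀ i j → i ℕ.< j → j ℕ.< i ℕ.+ w → ξ i ≡ 0Z ⊎ ξ j ≡ 0Z

  zeros⇒τ^∣ : ∀ n N ξ → (∀ j → j ℕ.< n → ξ j ≡ 0Z) → (τZ ^Z n) ∣Z partialValue N ξ
  zeros⇒τ^∣ n zero ξ _ = 0Z , sym (*Z-zeroʳ (τZ ^Z n))
  zeros⇒τ^∣ zero (suc N) ξ _ = partialValue (suc N) ξ , sym (trans (*Z-comm 1Z (partialValue (suc N) ξ))
      (*Z-identityʳ (partialValue (suc N) ξ)))
  zeros⇒τ^∣ (suc n) (suc N) ξ ξ≡0 with c , eq ← zeros⇒τ^∣ n N (ξ ∘ suc) (λ j j<n → ξ≡0 (suc j) (ℕ.s≤s j<n)) =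
    c , trans (partialValue-suc N ξ) (trans (cong (_+Z (τZ *Z partialValue N (ξ ∘ suc))) (ξ≡0 0 (ℕ.s≤s ℕ.z≤n)))
      (trans (+Z-identityˡ (τZ *Z partialValue N (ξ ∘ suc))) (trans (cong (τZ *Z_) eq)
          (sym (*Z-assoc τZ (τZ ^Z n) c)))))

  private
    transpose : ∀ a b c d → a +Z b ≡ c +Z d → c -Z a ≡ b -Z d
    transpose (a , a′) (b , b′) (c , c′) (d , d′) eq = cong₂ _,_ (sub a b c d (cong proj₁ eq)) (sub a′ b′ c′ d′
        (cong proj₂ eq))
      where
      sub : ∀ a b c d → a ℤ.+ b ≡ c ℤ.+ d → c ℤ.- a ≡ b ℤ.- d
      sub = linℤ 4 (λ a b c d → (a ⊕ b ≐ c ⊕ d ∷ [] ⊢ c ⊖ a ≐ b ⊖ d))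

    +Z-cancelˡ : ∀ a b c → a +Z b ≡ a +Z c → b ≡ c
    +Z-cancelˡ (a , a′) (b , b′) (c , c′) eq = cong₂ _,_ (sub a b c (cong proj₁ eq)) (sub a′ b′ c′ (cong proj₂ eq))
      where
      sub : ∀ a b c → a ℤ.+ b ≡ a ℤ.+ c → b ≡ c
      sub = linℤ 3 (λ a b c → (a ⊕ b ≐ a ⊕ c ∷ [] ⊢ b ≐ c))

    x-0≡x : ∀ x → x -Z 0Z ≡ x
    x-0≡x (a , b) = cong₂ _,_ (ℤₚ.+-identityʳ a) (ℤₚ.+-identityʳ b)

  -- d, d′ are the digits of index 0, and v, v′ the values of the remaining ones.
  first-digit : ∀ d d′ v v′ → InD d → InD d′ → (¬ d ≡ 0Z → (τZ ^Z suc k) ∣Z v) → (¬ d′ ≡ 0Z → (τZ ^Z suc k) ∣Z v′) →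
    d +Z (τZ *Z v) ≡ d′ +Z (τZ *Z v′) → d′ ≡ d
  first-digit d d′ v v′ d∈ d′∈ gap gap′ eq = match d∈ d′∈
    where
    difference : d′ -Z d ≡ τZ *Z (v -Z v′)
    difference = trans (transpose d (τZ *Z v) d′ (τZ *Z v′) eq) (sym (*Z-distribˡ-minus τZ v v′))
    difference′ : d -Z d′ ≡ τZ *Z (v′ -Z v)
    difference′ = trans (transpose d′ (τZ *Z v′) d (τZ *Z v) (sym eq)) (sym (*Z-distribˡ-minus τZ v′ v))
    nonzero : ∀ d → ¬ τZ ∣Z d → ¬ d ≡ 0Z
    nonzero d τ∤d d≡0 = τ∤d (0Z , trans d≡0 (sym (*Z-zeroʳ τZ)))
    match : InD d → InD d′ → d′ ≡ d
    match (inj₁ d≡0) (inj₁ d′≡0) = trans d′≡0 (sym d≡0)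
    match (inj₁ d≡0) (inj₂ (τ∤d′ , _)) = ⊥-elim (τ∤d′ (v -Z v′ , trans (sym (x-0≡x d′))
        (trans (cong (d′ -Z_) (sym d≡0)) difference)))
    match (inj₂ (τ∤d , _)) (inj₁ d′≡0) = ⊥-elim (τ∤d (v′ -Z v , trans (sym (x-0≡x d))
        (trans (cong (d -Z_) (sym d′≡0)) difference′)))
    -- Both remaining values are divisible by τ^(w-1), so the two digits agree modulo τʷ and the
    -- uniqueness clause of `InD` applies.
    match (inj₂ (τ∤d , _ , unique-digit)) (inj₂ (τ∤d′ , d′∈τʷṼ , _)) with c , v≡ ← gap (nonzero d τ∤d) | c′ ,
        v′≡ ← gap′ (nonzero d′ τ∤d′) =
      unique-digit d′ (c -Z c′ , trans difference (trans (cong (τZ *Z_) (trans (cong₂ _-Z_ v≡ v′≡)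
          (sym (*Z-distribˡ-minus (τZ ^Z suc k) c c′))))
        (sym (*Z-assoc τZ (τZ ^Z suc k) (c -Z c′))))) d′∈τʷṼ

  -- Induction on a common length: `gap` turns the spacing after a nonzero lowest digit into
  -- divisibility of the rest by τ^(w-1), `first-digit` equates the lowest digits, and τ is
  -- cancelled from the rest.
  partialValue-injective : ∀ N ξ ξ′ → (∀ j → InD (ξ j)) → (∀ j → InD (ξ′ j)) → Spaced ξ → Spaced ξ′ →
    FinSupp ξ N → FinSupp ξ′ N → partialValue N ξ ≡ partialValue N ξ′ → ∀ j → ξ′ j ≡ ξ j
  partialValue-injective zero ξ ξ′ _ _ _ _ fin fin′ _ j = trans (fin′ j ℕ.z≤n) (sym (fin j ℕ.z≤n))
  partialValue-injective (suc N) ξ ξ′ dig dig′ sp sp′ fin fin′ eq = cases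
    where
    v v′ : ZT
    v = partialValue N (ξ ∘ suc)
    v′ = partialValue N (ξ′ ∘ suc)
    eq′ : ξ 0 +Z (τZ *Z v) ≡ ξ′ 0 +Z (τZ *Z v′)
    eq′ = trans (sym (partialValue-suc N ξ)) (trans eq (partialValue-suc N ξ′))
    gap : ∀ ξ → Spaced ξ → ¬ ξ 0 ≡ 0Z → (τZ ^Z suc k) ∣Z partialValue N (ξ ∘ suc)
    gap ξ sp ξ0≢0 = zeros⇒τ^∣ (suc k) N (ξ ∘ suc) λ j j< →
      [ (λ ξ0≡0 → ⊥-elim (ξ0≢0 ξ0≡0)) , (λ ξj≡0 → ξj≡0) ]′ (sp 0 (suc j) (ℕ.s≤s ℕ.z≤n) (ℕ.s≤s j<))
    head : ξ′ 0 ≡ ξ 0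
    head = first-digit (ξ 0) (ξ′ 0) v v′ (dig 0) (dig′ 0) (gap ξ sp) (gap ξ′ sp′) eq′
    tail : v ≡ v′
    tail = τ-cancel (+Z-cancelˡ (ξ 0) (τZ *Z v) (τZ *Z v′) (trans eq′ (cong (_+Z (τZ *Z v′)) head)))
    shift : ∀ {ξ} → Spaced ξ → Spaced (ξ ∘ suc)
    shift sp i j i<j j< = sp (suc i) (suc j) (ℕ.s≤s i<j) (ℕ.s≤s j<)
    cases : ∀ j → ξ′ j ≡ ξ j
    cases zero = head
    cases (suc j) = partialValue-injective N (ξ ∘ suc) (ξ′ ∘ suc) (dig ∘ suc) (dig′ ∘ suc) (shift sp) (shift sp′)
      (λ j N≤j → fin (suc j) (ℕ.s≤s N≤j)) (λ j N≤j → fin′ (suc j) (ℕ.s≤s N≤j)) tail j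

  -- Serves to evaluate two sequences with different supports at one common length.
  partialValue-+ : ∀ m N ξ → FinSupp ξ N → partialValue (m ℕ.+ N) ξ ≡ partialValue N ξ
  partialValue-+ zero N ξ fin = refl
  partialValue-+ (suc m) N ξ fin = trans (cong₂ _+Z_ (partialValue-+ m N ξ fin)
    (trans (cong (_*Z (τZ ^Z (m ℕ.+ N))) (fin (m ℕ.+ N) (ℕₚ.m≤n+m N m))) (trans (*Z-comm 0Z (τZ ^Z (m ℕ.+ N)))
        (*Z-zeroʳ (τZ ^Z (m ℕ.+ N))))))
    (+Z-identityʳ (partialValue N ξ))

  NAF-unique : ∀ z ξ ξ′ → IsNAFfin0 ξ → IsNAFfin0 ξ′ → HasValue ξ z → HasValue ξ′ z → ∀ j → ξ′ j ≡ ξ j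
  NAF-unique z ξ ξ′ naf naf′ (N , fin , val) (N′ , fin′ , val′) = partialValue-injective (N′ ℕ.+ N) ξ ξ′
    (IsNAFfin0.digits naf) (IsNAFfin0.digits naf′) (IsNAFfin0.nonadj naf) (IsNAFfin0.nonadj naf′)
    (λ j le → fin j (ℕₚ.≤-trans (ℕₚ.m≤n+m N N′) le)) (λ j le → fin′ j (ℕₚ.≤-trans (ℕₚ.m≤m+n N′ N) le))
    (trans (partialValue-+ N′ N ξ fin) (trans val (trans (sym val′) (trans (sym (partialValue-+ N N′ ξ′ fin′))
      (cong (λ n → partialValue n ξ′) (ℕₚ.+-comm N N′))))))

  -- `Alg` is a relation, so the second half concerns every run and not just the one built by
  -- `terminates`.
  algorithm-correct : AlgorithmCorrect
  algorithm-correct z = terminates z , λ ds alg → listSeq-NAF alg , length ds , listSeq-finite ds , listSeq-value alg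

  digit-set : IsWidthNAFDigitSet
  digit-set z with ds , alg ← terminates z =
    listSeq ds , listSeq-NAF alg , (length ds , listSeq-finite ds , listSeq-value alg) ,
    λ ξ′ naf′ val′ → NAF-unique z (listSeq ds) ξ′ (listSeq-NAF alg) naf′ (length ds , listSeq-finite ds ,
        listSeq-value alg) val′

open import Data.Nat using (ℕ; _≤_)
open import Data.Integer using (ℤ; +_; _*_; _-_; _<_)

theorem7p1 : (p q : ℤ) → + 0 < + 4 * q - p * p → (σ : Sign) →
    + 1 < Setup.normZ p q σ (Setup.τZ p q σ) →
    (w : ℕ) → 2 ≤ w → (L : Setup.Labelling p q σ) →
    Setup.Width.IsWidthNAFDigitSet p q σ L w × Setup.Width.AlgorithmCorrect p q σ L w
theorem7p1 p q 0<4q-p² σ 1<τ (suc (suc k)) (ℕ.s≤s (ℕ.s≤s _)) L = digit-set , algorithm-correct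
  where
  open NonAdjacentForms p q 0<4q-p² σ (subst (+ 1 <_) (QuadraticRing.normZ-τ p q σ) 1<τ) L
    (voronoi-tiling p q 0<4q-p² σ L) k
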